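{- There exists a deterministic algorithm that receives as input positive integers $D<N$ with $$D > \exp\left(\sqrt{2\log N \log\log N}\right),$$ and returns, in $O(D^{1/2+o(1)})$ time, one of the following (the returned output being correct): 1. an element $a\in\mathbb{Z}_N^*$ with $\operatorname{ord}_N(a)>D$; 2. a non-trivial factor of $N$; 3. the statement "$N$ is prime".
   Context: $\log$ is the natural logarithm. $\mathbb{Z}_N^*$ denotes the multiplicative group of residue classes modulo $N$ that are coprime to $N$. For a positive integer $a$ coprime to $N$, $\operatorname{ord}_N(a)$ is the smallest positive integer $k$ with $a^k\equiv 1 \pmod N$. A non-trivial factor of $N$ is a divisor $d$ of $N$ with $1<d<N$. The output is correct in the sense that an element returned as in 1 does satisfy $\operatorname{ord}_N(a)>D$, an integer returned as in 2 is a non-trivial factor of $N$, and "$N$ is prime" is returned only if $N$ is prime. Running time is worst-case time in a standard deterministic model of computation, in which basic arithmetic on integers modulo $N$ takes time polynomial in $\log N$. The bound $O(D^{1/2+o(1)})$ means: there are a constant $C$ and a function $\varepsilon(D)\to 0$ as $D\to\infty$, independent of $N$, such that the running time is at most $C\,D^{1/2+\varepsilon(D)}$ on all admissible inputs $(D,N)$. The hypothesis on $D$ is understood to include that the square root is a real number (i.e. $N\ge 3$). -}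

module Defs where

open import Data.Bool.Base using (if_then_else_)
open import Data.Integer.Base using (+_; -[1+_])
open import Data.List.Base using (List; []; _∷_)
open import Data.Maybe.Base using (Maybe; just; nothing)
open import Data.Nat.Base using (ℕ; zero; suc; _+_; _*_; _∸_; _^_; _/_; _≤_; _<_; _≡ᵇ_; ∣_-_∣; _!)
open import Data.Nat.Coprimality using (Coprime)
open import Data.Nat.Divisibility using (_∣_)
open import Data.Nat.Logarithm using (⌊log₂_⌋)
open import Data.Nat.Primality using (Prime)
open import Data.Nat.Properties using (_!≢0)
open import Data.Product.Base using (_×_; ∃-syntax)
open import Data.Rational.Base as ℚ using (ℚ; 0ℚ; ↥_; ↧ₙ_)
open import Algebra.Definitions.RawSemiring ℚ.+-*-rawSemiring using () renaming (_^_ to _^ℚ_)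
open import Relation.Binary.PropositionalEquality using (_≡_)

------------------------------------------------------------------------
-- Real numbers

-- A real number x is represented by its upper Dedekind cut: the
-- rationals q with x < q.  All operations below are given by their
-- values on cuts.

ℝ : Set₁
ℝ = ℚ → Set

infix 4 _<ᵣ_
infixl 7 _*ᵣ_
infix 8 √_

_<ᵣ_ : ℝ → ℚ → Set
x <ᵣ q = x q

fromℕ : ℕ → ℚ
fromℕ n = + n ℚ./ 1

real : ℕ → ℝ
real n q = fromℕ n ℚ.< q

-- The sum of q ^ k / k ! over k < n.
expSum : ℕ → ℚ → ℚ
expSum zero    q = 0ℚ
expSum (suc n) q = expSum n q ℚ.+ (q ^ℚ n) ℚ.* ((+ 1 ℚ./ (n !)) {{n !≢0}})

infix 4 _<exp_ _exp<_

-- r <exp q is r < exp q, and q exp< r is exp q < r.  As exp q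
-- is the limit of expSum n q, each says that the partial sums are
-- eventually separated from r.
_<exp_ : ℚ → ℚ → Set
r <exp q = ∃[ s ] r ℚ.< s × ∃[ k ] (∀ n → k ≤ n → s ℚ.≤ expSum n q)

_exp<_ : ℚ → ℚ → Set
q exp< r = ∃[ s ] s ℚ.< r × ∃[ k ] (∀ n → k ≤ n → expSum n q ℚ.≤ s)

exp : ℝ → ℝ
exp x q = ∃[ r ] x <ᵣ r × r exp< q

-- The inverse of exp; meant for y > 0.
log : ℝ → ℝ
log y q = ∃[ r ] y <ᵣ r × r <exp q

-- Meant for x, y ≥ 0.
_*ᵣ_ : ℝ → ℝ → ℝ
(x *ᵣ y) q = ∃[ r ] ∃[ s ] x <ᵣ r × y <ᵣ s × r ℚ.* s ℚ.≤ q

-- Meant for x ≥ 0.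
√_ : ℝ → ℝ
(√ x) q = 0ℚ ℚ.≤ q × x <ᵣ q ℚ.* q

------------------------------------------------------------------------
-- Random access machines with logarithmic cost (Aho, Hopcroft and
-- Ullman, The Design and Analysis of Computer Algorithms, §1.2-1.3),
-- with natural numbers
-- in the registers: subtraction is truncated,
-- and division by 0 yields 0.  Register 0 is the accumulator.

data Operand : Set where
  lit dir ind : ℕ → Operand

data Instr : Set where
  load add sub mult div : Operand → Instr
  store storeInd        : ℕ → Instr
  jump jgtz jzero       : ℕ → Instr
  halt                  : Instr

Program : Set
Program = List Instr

Memory : Set
Memory = ℕ → ℕ

_[_≔_] : Memory → ℕ → ℕ → Memory
(m [ i ≔ v ]) j = if i ≡ᵇ j then v else m j

record State : Set where
  constructor ⟨_,_⟩
  field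
    pc  : ℕ
    mem : Memory

value : Operand → Memory → ℕ
value (lit i) m = i
value (dir i) m = m i
value (ind i) m = m (m i)

_div₀_ : ℕ → ℕ → ℕ
a div₀ zero  = 0
a div₀ suc b = a / suc b

next : Instr → State → Maybe State
next (load o)     ⟨ p , m ⟩ = just ⟨ suc p , m [ 0 ≔ value o m ] ⟩
next (add o)      ⟨ p , m ⟩ = just ⟨ suc p , m [ 0 ≔ m 0 + value o m ] ⟩
next (sub o)      ⟨ p , m ⟩ = just ⟨ suc p , m [ 0 ≔ m 0 ∸ value o m ] ⟩
next (mult o)     ⟨ p , m ⟩ = just ⟨ suc p , m [ 0 ≔ m 0 * value o m ] ⟩
next (div o)      ⟨ p , m ⟩ = just ⟨ suc p , m [ 0 ≔ m 0 div₀ value o m ] ⟩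
next (store i)    ⟨ p , m ⟩ = just ⟨ suc p , m [ i ≔ m 0 ] ⟩
next (storeInd i) ⟨ p , m ⟩ = just ⟨ suc p , m [ m i ≔ m 0 ] ⟩
next (jump l)     ⟨ p , m ⟩ = just ⟨ l , m ⟩
next (jgtz l)     ⟨ p , m ⟩ = just ⟨ (if m 0 ≡ᵇ 0 then suc p else l) , m ⟩
next (jzero l)    ⟨ p , m ⟩ = just ⟨ (if m 0 ≡ᵇ 0 then l else suc p) , m ⟩
next halt         _         = nothing

-- The number of binary digits of n (and 1 for n = 0).
size : ℕ → ℕ
size n = suc ⌊log₂ n ⌋

operandCost : Operand → Memory → ℕ
operandCost (lit i) m = size i
operandCost (dir i) m = size i + size (m i)
operandCost (ind i) m = size i + size (m i) + size (m (m i))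

cost : Instr → Memory → ℕ
cost (load o)     m = operandCost o m
cost (add o)      m = size (m 0) + operandCost o m
cost (sub o)      m = size (m 0) + operandCost o m
cost (mult o)     m = size (m 0) + operandCost o m
cost (div o)      m = size (m 0) + operandCost o m
cost (store i)    m = size (m 0) + size i
cost (storeInd i) m = size (m 0) + size i + size (m i)
cost (jump l)     m = 1
cost (jgtz l)     m = size (m 0)
cost (jzero l)    m = size (m 0)
cost halt         m = 1

fetch : Program → ℕ → Maybe Instr
fetch []       _       = nothing
fetch (i ∷ P)  zero    = just i
fetch (i ∷ P)  (suc p) = fetch P p

-- Run P s t m: started in state s, the program P reaches a halt
-- instruction, at total cost t and with final memory m.  Leaving the
-- program text is a crash, not a halt.
data Run (P : Program) : State → ℕ → Memory → Set where
  stop : ∀ {p m} → fetch P p ≡ just halt → Run P ⟨ p , m ⟩ (cost halt m) m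
  step : ∀ {p m i s t m′} → fetch P p ≡ just i → next i ⟨ p , m ⟩ ≡ just s →
         Run P s t m′ → Run P ⟨ p , m ⟩ (cost i m + t) m′

input : ℕ → ℕ → State
input D N = ⟨ 0 , ((λ _ → 0) [ 1 ≔ D ]) [ 2 ≔ N ] ⟩

data Output : Set where
  element : ℕ → Output
  factor  : ℕ → Output
  isPrime : Output

-- The accumulator tells the kind of output, register 1 its value.
decode : Memory → Maybe Output
decode m with m 0
... | 1 = just (element (m 1))
... | 2 = just (factor (m 1))
... | 3 = just isPrime
... | _ = nothing

------------------------------------------------------------------------
-- Correctness of the output

_≡_[mod_] : ℕ → ℕ → ℕ → Set
a ≡ b [mod N ] = N ∣ ∣ a - b ∣

-- k is the order of a modulo N.
IsOrder : ℕ → ℕ → ℕ → Set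
IsOrder N a k = 0 < k × (a ^ k) ≡ 1 [mod N ] × (∀ j → 0 < j → (a ^ j) ≡ 1 [mod N ] → k ≤ j)

-- Elements of ℤ_N^* are given by their representatives below N.
Correct : ℕ → ℕ → Output → Set
Correct D N (element a) = a < N × Coprime a N × ∃[ k ] IsOrder N a k × D < k
Correct D N (factor d)  = d ∣ N × 1 < d × d < N
Correct D N isPrime     = Prime N

------------------------------------------------------------------------
-- Running time bounds

infix 4 _≤_·_^^_

-- t ≤ C · D ^ e, where e = ↥ e / ↧ₙ e; both sides are raised to the
-- power ↧ₙ e, and a negative power of D is moved to the left.
_≤_·_^^_ : ℕ → ℕ → ℕ → ℚ → Set
t ≤ C · D ^^ e with ↥ e
... | + n      = t ^ ↧ₙ e ≤ C ^ ↧ₙ e * D ^ n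
... | -[1+ n ] = t ^ ↧ₙ e * D ^ suc n ≤ C ^ ↧ₙ e

TendsToZero : (ℕ → ℚ) → Set
TendsToZero ε = ∀ δ → 0ℚ ℚ.< δ → ∃[ n₀ ] (∀ n → n₀ ≤ n → ℚ.∣ ε n ∣ ℚ.< δ)

{-# OPTIONS --safe #-}

-- Let K be least with K² > D.  The algorithm keeps an element g of order M ≤ D modulo N, starting
-- with -1, and runs through a = 2, …, 2 K.  A divisor a of N is returned.  If x = a ^ M is 1, the next a
-- is taken.  Otherwise a baby-step giant-step search of length K finds the order m of x, or shows that
-- x has order above D; for a prime q dividing m, the powers g ^ (q ^ α) and (a ^ (m / q)) ^ M₀, where
-- M = M₀ q ^ α with q ∤ M₀, have coprime orders M₀ and q ^ (α + 1), so their product has order M q.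
-- Thus M at least doubles, and there are only O(log D) searches.
--
-- In the end ±1, …, ±2 K are roots of X ^ M - 1 modulo each prime p dividing N, and there are at most M ≤ D roots.
-- The more than D fractions with numerator and denominator up to 2 K are roots too, and distinct if
-- p > (2 K)²; hence p ≤ (2 K)².  Then, by Thue's lemma, every residue is a fraction ± u / v with u, v ≤ 2 K, so
-- that all units modulo p are roots, and p - 1 divides M.  It remains to try 1 + i and 1 + M / i
-- for the divisors i ≤ K of M.
--
-- All this takes K ≤ 2 √D steps up to a power of log N, and the hypothesis on D is only used to bound
-- log N by a power of log D.

module Submission where

open import Data.Empty using (⊥; ⊥-elim)
open import Data.Maybe.Base using (just)
open import Data.Product.Base using (_×_; _,_; proj₁; proj₂; ∃-syntax; Σ-syntax)
open import Data.Sum.Base using (_⊎_; inj₁; inj₂)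
open import Relation.Nullary using (¬_; yes; no; Dec)
open import Relation.Binary.PropositionalEquality

-- The prime divisors p of N are unknown, so all powers are computed modulo N, while roots are
-- counted modulo p, where the order of g may drop. Hence only the identities a ^ M = 1 are carried
-- over to p, never an order.
--
-- Starting from -1 keeps M even, and even powers do not see the signs left over by Thue's lemma.
--
-- The fractions x / y with x, y ≤ K are not distinct, and counting the reduced ones would need a
-- density estimate. Instead each pair is encoded in a reduced fraction with entries up to 2 K, from
-- which it can be recovered; this is where the bound 2 K on a comes from.
--
-- The table of a search is indexed directly by residues modulo N. At logarithmic cost so large an
-- address is cheap, and memory that was never written reads as 0, so nothing has to be initialised
-- or cleared.
--
-- The hypothesis speaks of Dedekind cuts, and little can be read off it before the arguments of exp
-- are known to be positive. The estimates are crude: the length of N is bounded by 130 times the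
-- fourth power of the length of D, which affects only the o(1) in the exponent.

-- Estimates for the partial sums of the exponential series.

module ExponentialBounds where

  open import Defs using (fromℕ; expSum)

  open import Data.Integer.Base as ℤ using (ℤ; +_; 1ℤ)
  import Data.Integer.Properties as ℤₚ
  open import Data.Nat.Base as ℕ using (ℕ; zero; suc; _!; z≤n; s≤s)
  import Data.Nat.Properties as ℕₚ
  open import Data.Nat.Properties using (_!≢0)
  import Data.Nat.Solver
  module ℕS = Data.Nat.Solver.+-*-Solver

  open import Data.Rational.Base as ℚ using (ℚ; 0ℚ; 1ℚ; ½; _+_; _*_; _≤_; _<_)
  open import Data.Rational.Properties
  import Data.Rational.Unnormalised.Base as ℚᵘ
  import Data.Rational.Unnormalised.Properties as ℚᵘₚ
  open import Data.Rational.Solver using (module +-*-Solver)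
  open import Algebra.Definitions.RawSemiring ℚ.+-*-rawSemiring using () renaming (_^_ to _^ℚ_)

  ℕ^-distribʳ-* : ∀ a b n → (a ℕ.* b) ℕ.^ n ≡ a ℕ.^ n ℕ.* b ℕ.^ n
  ℕ^-distribʳ-* a b zero    = refl
  ℕ^-distribʳ-* a b (suc n) = trans (cong (a ℕ.* b ℕ.*_) (ℕ^-distribʳ-* a b n))
    (ℕS.solve 4 (λ a b c d → a ℕS.:* b ℕS.:* (c ℕS.:* d) ℕS.:= a ℕS.:* c ℕS.:* (b ℕS.:* d)) refl a b (a ℕ.^ n) (b ℕ.^ n))

  n<2^n : ∀ n → n ℕ.< 2 ℕ.^ n
  n<2^n zero    = s≤s z≤n
  n<2^n (suc n) = ℕₚ.+-mono-≤ (ℕₚ.m^n>0 2 n) (ℕₚ.≤-trans (n<2^n n) (ℕₚ.≤-reflexive (sym (ℕₚ.+-identityʳ _))))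

  fromℕ≃ : ∀ n → ℚ.toℚᵘ (fromℕ n) ℚᵘ.≃ ℚᵘ.mkℚᵘ (+ n) 0
  fromℕ≃ n = toℚᵘ-fromℚᵘ (ℚᵘ.mkℚᵘ (+ n) 0)

  fromℕ-+ : ∀ a b → fromℕ (a ℕ.+ b) ≡ fromℕ a + fromℕ b
  fromℕ-+ a b = toℚᵘ-injective (ℚᵘₚ.≃-trans (fromℕ≃ (a ℕ.+ b)) (ℚᵘₚ.≃-trans (ℚᵘ.*≡* (cong (ℤ._* 1ℤ)
      (trans (ℤₚ.pos-+ a b) (sym (cong₂ ℤ._+_ (ℤₚ.*-identityʳ (+ a)) (ℤₚ.*-identityʳ (+ b)))))))
    (ℚᵘₚ.≃-sym (ℚᵘₚ.≃-trans (toℚᵘ-homo-+ (fromℕ a) (fromℕ b)) (ℚᵘₚ.+-cong (fromℕ≃ a) (fromℕ≃ b))))))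

  fromℕ-* : ∀ a b → fromℕ (a ℕ.* b) ≡ fromℕ a * fromℕ b
  fromℕ-* a b = toℚᵘ-injective (ℚᵘₚ.≃-trans (fromℕ≃ (a ℕ.* b)) (ℚᵘₚ.≃-trans (ℚᵘ.*≡* (cong (ℤ._* 1ℤ)
      (ℤₚ.pos-* a b)))
    (ℚᵘₚ.≃-sym (ℚᵘₚ.≃-trans (toℚᵘ-homo-* (fromℕ a) (fromℕ b)) (ℚᵘₚ.*-cong (fromℕ≃ a) (fromℕ≃ b))))))

  fromℕ-mono-≤ : ∀ {a b} → a ℕ.≤ b → fromℕ a ≤ fromℕ b
  fromℕ-mono-≤ {a} {b} a≤b = toℚᵘ-cancel-≤ (ℚᵘₚ.≤-respˡ-≃ (ℚᵘₚ.≃-sym (fromℕ≃ a)) (ℚᵘₚ.≤-respʳ-≃ (ℚᵘₚ.≃-sym (fromℕ≃ b))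
    (ℚᵘ.*≤* (ℤₚ.*-monoʳ-≤-nonNeg 1ℤ (ℤ.+≤+ a≤b)))))

  fromℕ-cancel-< : ∀ {a b} → fromℕ a < fromℕ b → a ℕ.< b
  fromℕ-cancel-< {a} {b} p = ℕₚ.≰⇒> λ b≤a → <-irrefl refl (<-≤-trans p (fromℕ-mono-≤ b≤a))

  0≤fromℕ : ∀ n → 0ℚ ≤ fromℕ n
  0≤fromℕ n = fromℕ-mono-≤ {0} {n} z≤n

  -- The denominator is at least 1, so dropping it can only enlarge the absolute value.
  ≤-archimedean : ∀ p → p ≤ fromℕ ℤ.∣ ℚ.↥ p ∣
  ≤-archimedean p = toℚᵘ-cancel-≤ (ℚᵘₚ.≤-respʳ-≃ (ℚᵘₚ.≃-sym (fromℕ≃ ℤ.∣ ℚ.↥ p ∣)) (lem p))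
    where
    lem : ∀ p → ℚ.toℚᵘ p ℚᵘ.≤ ℚᵘ.mkℚᵘ (+ ℤ.∣ ℚ.↥ p ∣) 0
    lem p@record{} = ℚᵘ.*≤* (ℤₚ.≤-trans (ℤₚ.≤-reflexive (ℤₚ.*-identityʳ (ℚ.↥ p)))
      (ℤₚ.≤-trans (i≤∣i∣ (ℚ.↥ p)) (ℤₚ.≤-trans (ℤₚ.≤-reflexive (sym (ℤₚ.*-identityʳ _)))
        (ℤₚ.*-monoˡ-≤-nonNeg (+ ℤ.∣ ℚ.↥ p ∣) (ℤ.+≤+ (s≤s z≤n))))))
      where
      i≤∣i∣ : ∀ i → i ℤ.≤ + ℤ.∣ i ∣
      i≤∣i∣ (+ n) = ℤₚ.≤-refl
      i≤∣i∣ ℤ.-[1+ n ] = ℤ.-≤+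

  *-mono-≤ : ∀ {a b c d} → 0ℚ ≤ a → 0ℚ ≤ d → a ≤ b → c ≤ d → a * c ≤ b * d
  *-mono-≤ {a} {b} {c} {d} 0≤a 0≤d a≤b c≤d = ≤-trans
    (*-monoˡ-≤-nonNeg a {{ℚ.nonNegative 0≤a}} c≤d) (*-monoʳ-≤-nonNeg d {{ℚ.nonNegative 0≤d}} a≤b)

  0≤* : ∀ {a b} → 0ℚ ≤ a → 0ℚ ≤ b → 0ℚ ≤ a * b
  0≤* {a} {b} 0≤a 0≤b = subst (_≤ a * b) (*-zeroʳ a) (*-monoˡ-≤-nonNeg a {{ℚ.nonNegative 0≤a}} 0≤b)

  0≤+ : ∀ {a b} → 0ℚ ≤ a → 0ℚ ≤ b → 0ℚ ≤ a + b
  0≤+ {a} {b} 0≤a 0≤b = subst (_≤ a + b) (+-identityˡ 0ℚ) (+-mono-≤ 0≤a 0≤b)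

  recip : ∀ n → .{{_ : ℕ.NonZero n}} → ℚ
  recip n = + 1 ℚ./ n

  fromℕ*recip : ∀ n .{{_ : ℕ.NonZero n}} → fromℕ n * recip n ≡ 1ℚ
  fromℕ*recip n@(suc d) = toℚᵘ-injective (ℚᵘₚ.≃-trans (toℚᵘ-homo-* (fromℕ n) (recip n)) (ℚᵘₚ.≃-trans
    (ℚᵘₚ.*-cong (fromℕ≃ n) (toℚᵘ-fromℚᵘ (ℚᵘ.mkℚᵘ (+ 1) d)))
    (ℚᵘ.*≡* (trans (ℤₚ.*-identityʳ _) (trans (ℤₚ.*-identityʳ (+ n)) (sym (trans (ℤₚ.*-identityˡ _) (cong +_ (ℕₚ.*-identityˡ n)))))))))

  0≤recip : ∀ n .{{_ : ℕ.NonZero n}} → 0ℚ ≤ recip n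
  0≤recip n@(suc d) = toℚᵘ-cancel-≤ (ℚᵘₚ.≤-respʳ-≃ (ℚᵘₚ.≃-sym (toℚᵘ-fromℚᵘ (ℚᵘ.mkℚᵘ (+ 1) d))) (ℚᵘ.*≤* (ℤ.+≤+ z≤n)))

  ^ℚ-nonNeg : ∀ {q} n → 0ℚ ≤ q → 0ℚ ≤ q ^ℚ n
  ^ℚ-nonNeg zero    _   = fromℕ-mono-≤ {0} {1} z≤n
  ^ℚ-nonNeg (suc n) 0≤q = 0≤* 0≤q (^ℚ-nonNeg n 0≤q)

  ^ℚ-mono : ∀ {p q} n → 0ℚ ≤ p → p ≤ q → p ^ℚ n ≤ q ^ℚ n
  ^ℚ-mono zero    _   _   = ≤-refl
  ^ℚ-mono (suc n) 0≤p p≤q = *-mono-≤ 0≤p (^ℚ-nonNeg n (≤-trans 0≤p p≤q)) p≤q (^ℚ-mono n 0≤p p≤q)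

  fromℕ-^ : ∀ a n → fromℕ (a ℕ.^ n) ≡ fromℕ a ^ℚ n
  fromℕ-^ a zero    = refl
  fromℕ-^ a (suc n) = trans (fromℕ-* a (a ℕ.^ n)) (cong (fromℕ a *_) (fromℕ-^ a n))

  term : ℕ → ℚ → ℚ
  term n q = q ^ℚ n * recip (n !) {{n !≢0}}

  0≤term : ∀ n {q} → 0ℚ ≤ q → 0ℚ ≤ term n q
  0≤term n 0≤q = 0≤* (^ℚ-nonNeg n 0≤q) (0≤recip (n !) {{n !≢0}})

  recip-! : ∀ n → fromℕ (suc n) * recip (suc n !) {{suc n !≢0}} ≡ recip (n !) {{n !≢0}}
  recip-! n = begin
    fromℕ (suc n) * r′                          ≡⟨ *-identityʳ _ ⟨
    fromℕ (suc n) * r′ * 1ℚ                     ≡⟨ cong (fromℕ (suc n) * r′ *_) (fromℕ*recip (n !) {{n !≢0}}) ⟨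
    fromℕ (suc n) * r′ * (fromℕ (n !) * r)      ≡⟨ lem (fromℕ (suc n)) r′ (fromℕ (n !)) r ⟩
    fromℕ (suc n) * fromℕ (n !) * r′ * r        ≡⟨ cong (λ z → z * r′ * r) (fromℕ-* (suc n) (n !)) ⟨
    fromℕ (suc n !) * r′ * r                    ≡⟨ cong (_* r) (fromℕ*recip (suc n !) {{suc n !≢0}}) ⟩
    1ℚ * r                                      ≡⟨ *-identityˡ r ⟩
    r                                           ∎
    where
    open ≡-Reasoning
    r r′ : ℚ
    r = recip (n !) {{n !≢0}}
    r′ = recip (suc n !) {{suc n !≢0}}
    lem : ∀ a b c d → a * b * (c * d) ≡ a * c * b * d
    lem = solve 4 (λ a b c d → a :* b :* (c :* d) := a :* c :* b :* d) refl where open +-*-Solver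

  term-suc : ∀ n q → fromℕ (suc n) * term (suc n) q ≡ q * term n q
  term-suc n q = trans (lem (fromℕ (suc n)) q (q ^ℚ n) (recip (suc n !) {{suc n !≢0}}))
    (trans (cong (λ z → q * (q ^ℚ n * z)) (recip-! n)) refl)
    where
    lem : ∀ s q p r → s * (q * p * r) ≡ q * (p * (s * r))
    lem = solve 4 (λ s q p r → s :* (q :* p :* r) := q :* (p :* (s :* r))) refl where open +-*-Solver

  ½^+½^ : ∀ n → ½ ^ℚ suc n + ½ ^ℚ suc n ≡ ½ ^ℚ n
  ½^+½^ n = trans (sym (*-distribʳ-+ (½ ^ℚ n) ½ ½)) (*-identityˡ (½ ^ℚ n))

  2^*½^ : ∀ n → fromℕ (2 ℕ.^ n) * ½ ^ℚ n ≡ 1ℚ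
  2^*½^ zero    = refl
  2^*½^ (suc n) = trans (cong (_* ½ ^ℚ suc n) (fromℕ-* 2 (2 ℕ.^ n))) (trans (lem (fromℕ 2) (fromℕ (2 ℕ.^ n)) ½ (½ ^ℚ n))
    (trans (cong (fromℕ 2 * ½ *_) (2^*½^ n)) refl))
    where
    lem : ∀ a b c d → a * b * (c * d) ≡ a * c * (b * d)
    lem = solve 4 (λ a b c d → a :* b :* (c :* d) := a :* c :* (b :* d)) refl where open +-*-Solver

  -- Past i = 2 T the terms T ^ i / i ! at least halve.
  2T^i≤ : ∀ T i → (2 ℕ.* T) ℕ.^ i ℕ.≤ (2 ℕ.* T) ℕ.^ (2 ℕ.* T) ℕ.* (i !)
  2T^i≤ zero    zero    = s≤s z≤n
  2T^i≤ zero    (suc i) = z≤n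
  2T^i≤ (suc T) zero    = ℕₚ.≤-trans (ℕₚ.m^n>0 (2 ℕ.* suc T) (2 ℕ.* suc T)) (ℕₚ.≤-reflexive (sym (ℕₚ.*-identityʳ _)))
  2T^i≤ T@(suc _) (suc i) with ℕₚ.≤-total (suc i) (2 ℕ.* T)
  ... | inj₁ i<2T = ℕₚ.≤-trans (ℕₚ.^-monoʳ-≤ (2 ℕ.* T) i<2T) (ℕₚ.m≤m*n _ (suc i !) {{suc i !≢0}})
  ... | inj₂ 2T≤i = ℕₚ.≤-trans (ℕₚ.*-mono-≤ 2T≤i (2T^i≤ T i)) (ℕₚ.≤-reflexive (lem (suc i) ((2 ℕ.* T) ℕ.^ (2 ℕ.* T)) (i !)))
    where
    lem : ∀ a b c → a ℕ.* (b ℕ.* c) ≡ b ℕ.* (a ℕ.* c)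
    lem a b c = trans (sym (ℕₚ.*-assoc a b c)) (trans (cong (ℕ._* c) (ℕₚ.*-comm a b)) (ℕₚ.*-assoc b a c))

  -- The factor in front of the geometric majorant of the terms; thus exp T is at most twice this.
  bound : ℕ → ℕ
  bound T = (2 ℕ.* T) ℕ.^ (2 ℕ.* T)

  term≤ : ∀ T i {q} → 0ℚ ≤ q → q ≤ fromℕ T → term i q ≤ fromℕ (bound T) * ½ ^ℚ i
  term≤ T i {q} 0≤q q≤T = begin
    q ^ℚ i * r                                    ≤⟨ *-monoʳ-≤-nonNeg r {{ℚ.nonNegative 0≤r}} (^ℚ-mono i 0≤q q≤T) ⟩
    fromℕ T ^ℚ i * r                              ≡⟨ *-identityˡ _ ⟨
    1ℚ * (fromℕ T ^ℚ i * r)                       ≡⟨ cong (_* (fromℕ T ^ℚ i * r)) (2^*½^ i) ⟨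
    fromℕ (2 ℕ.^ i) * h * (fromℕ T ^ℚ i * r)      ≡⟨ cong (λ z → fromℕ (2 ℕ.^ i) * h * (z * r)) (fromℕ-^ T i) ⟨
    fromℕ (2 ℕ.^ i) * h * (fromℕ (T ℕ.^ i) * r)   ≡⟨ lem (fromℕ (2 ℕ.^ i)) h (fromℕ (T ℕ.^ i)) r ⟩
    fromℕ (2 ℕ.^ i) * fromℕ (T ℕ.^ i) * (r * h)   ≡⟨ cong (_* (r * h)) (fromℕ-* (2 ℕ.^ i) (T ℕ.^ i)) ⟨
    fromℕ (2 ℕ.^ i ℕ.* T ℕ.^ i) * (r * h)         ≡⟨ cong (λ z → fromℕ z * (r * h)) (ℕ^-distribʳ-* 2 T i) ⟨
    fromℕ ((2 ℕ.* T) ℕ.^ i) * (r * h)             ≤⟨ *-monoʳ-≤-nonNeg (r * h) {{ℚ.nonNegative (0≤* 0≤r 0≤h)}} (fromℕ-mono-≤ (2T^i≤ T i)) ⟩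
    fromℕ (bound T ℕ.* i !) * (r * h)             ≡⟨ cong (_* (r * h)) (fromℕ-* (bound T) (i !)) ⟩
    fromℕ (bound T) * fromℕ (i !) * (r * h)       ≡⟨ lem₂ (fromℕ (bound T)) (fromℕ (i !)) r h ⟩
    fromℕ (i !) * r * (fromℕ (bound T) * h)       ≡⟨ cong (_* (fromℕ (bound T) * h)) (fromℕ*recip (i !) {{i !≢0}}) ⟩
    1ℚ * (fromℕ (bound T) * h)                    ≡⟨ *-identityˡ _ ⟩
    fromℕ (bound T) * h                           ∎
    where
    open ≤-Reasoning
    r h : ℚ
    r = recip (i !) {{i !≢0}}
    h = ½ ^ℚ i
    0≤r : 0ℚ ≤ r
    0≤r = 0≤recip (i !) {{i !≢0}}
    0≤h : 0ℚ ≤ h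
    0≤h = ^ℚ-nonNeg i (0≤recip 2)
    lem : ∀ a b c d → a * b * (c * d) ≡ a * c * (d * b)
    lem = solve 4 (λ a b c d → a :* b :* (c :* d) := a :* c :* (d :* b)) refl where open +-*-Solver
    lem₂ : ∀ a b c d → a * b * (c * d) ≡ b * c * (a * d)
    lem₂ = solve 4 (λ a b c d → a :* b :* (c :* d) := b :* c :* (a :* d)) refl where open +-*-Solver

  -- The majorant of `term≤` is geometric with ratio ½. The induction `go` carries along the tail,
  -- twice `A * ½ ^ n`: the next term uses up exactly half of it.
  expSum≤ : ∀ T n {q} → 0ℚ ≤ q → q ≤ fromℕ T → expSum n q ≤ fromℕ (2 ℕ.* bound T)
  expSum≤ T n {q} 0≤q q≤T = begin
    expSum n q                          ≡⟨ +-identityʳ _ ⟨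
    expSum n q + 0ℚ                     ≤⟨ +-monoʳ-≤ (expSum n q) (0≤+ 0≤Ah 0≤Ah) ⟩
    expSum n q + (A * ½ ^ℚ n + A * ½ ^ℚ n) ≤⟨ go n ⟩
    A + A                               ≡⟨ cong (λ z → A + z) (+-identityʳ A) ⟨
    A + (A + 0ℚ)                        ≡⟨ cong (λ z → A + z) (fromℕ-+ (bound T) 0) ⟨
    A + fromℕ (bound T ℕ.+ 0)           ≡⟨ fromℕ-+ (bound T) (bound T ℕ.+ 0) ⟨
    fromℕ (2 ℕ.* bound T)               ∎
    where
    open ≤-Reasoning
    A : ℚ
    A = fromℕ (bound T)
    0≤Ah : 0ℚ ≤ A * ½ ^ℚ n
    0≤Ah = 0≤* (0≤fromℕ (bound T)) (^ℚ-nonNeg n (0≤recip 2))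
    go : ∀ n → expSum n q + (A * ½ ^ℚ n + A * ½ ^ℚ n) ≤ A + A
    go zero    = ≤-reflexive (trans (+-identityˡ _) (cong₂ _+_ (*-identityʳ A) (*-identityʳ A)))
    go (suc n) = ≤-trans (≤-reflexive (trans (cong (λ z → expSum n q + term n q + z)
        (trans (sym (*-distribˡ-+ A (½ ^ℚ suc n) (½ ^ℚ suc n))) (cong (A *_) (½^+½^ n))))
        (+-assoc (expSum n q) (term n q) (A * ½ ^ℚ n))))
      (≤-trans (+-monoʳ-≤ (expSum n q) (+-monoˡ-≤ (A * ½ ^ℚ n) (term≤ T n 0≤q q≤T))) (go n))

  expSum-mono : ∀ {q} → 0ℚ ≤ q → ∀ m n → expSum m q ≤ expSum (n ℕ.+ m) q
  expSum-mono 0≤q m zero    = ≤-refl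
  expSum-mono {q} 0≤q m (suc n) = ≤-trans (expSum-mono 0≤q m n) (≤-trans (≤-reflexive (sym (+-identityʳ _)))
    (+-monoʳ-≤ (expSum (n ℕ.+ m) q) (0≤term (n ℕ.+ m) 0≤q)))

  0≤expSum : ∀ {q} n → 0ℚ ≤ q → 0ℚ ≤ expSum n q
  0≤expSum n 0≤q = subst (λ k → 0ℚ ≤ expSum k _) (ℕₚ.+-identityʳ n) (expSum-mono 0≤q 0 n)

  i!≤i^i : ∀ i → i ! ℕ.≤ i ℕ.^ i
  i!≤i^i i = go i ℕₚ.≤-refl
    where
    go : ∀ {k} j → j ℕ.≤ k → j ! ℕ.≤ k ℕ.^ j
    go zero    _   = ℕₚ.≤-refl
    go (suc j) j<k = ℕₚ.*-mono-≤ j<k (go j (ℕₚ.<⇒≤ j<k))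

  -- A single term suffices: by `i ! ≤ i ^ i` the term of index i is at least (2 i) ^ i / i ^ i, and
  -- `i < n` ensures that it is among the summands.
  expSum≥ : ∀ i n {q} → fromℕ (2 ℕ.* i) ≤ q → i ℕ.< n → fromℕ (2 ℕ.^ i) ≤ expSum n q
  expSum≥ i n {q} 2i≤q i<n = begin
    fromℕ (2 ℕ.^ i)                        ≡⟨ *-identityʳ _ ⟨
    fromℕ (2 ℕ.^ i) * 1ℚ                   ≡⟨ cong (fromℕ (2 ℕ.^ i) *_) (fromℕ*recip (i !) {{i !≢0}}) ⟨
    fromℕ (2 ℕ.^ i) * (fromℕ (i !) * r)    ≡⟨ *-assoc (fromℕ (2 ℕ.^ i)) (fromℕ (i !)) r ⟨
    fromℕ (2 ℕ.^ i) * fromℕ (i !) * r      ≡⟨ cong (_* r) (fromℕ-* (2 ℕ.^ i) (i !)) ⟨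
    fromℕ (2 ℕ.^ i ℕ.* i !) * r            ≤⟨ *-monoʳ-≤-nonNeg r {{ℚ.nonNegative 0≤r}} (fromℕ-mono-≤ (ℕₚ.≤-trans
                                                (ℕₚ.*-monoʳ-≤ (2 ℕ.^ i) (i!≤i^i i)) (ℕₚ.≤-reflexive (sym (ℕ^-distribʳ-* 2 i i))))) ⟩
    fromℕ ((2 ℕ.* i) ℕ.^ i) * r            ≡⟨ cong (_* r) (fromℕ-^ (2 ℕ.* i) i) ⟩
    fromℕ (2 ℕ.* i) ^ℚ i * r               ≤⟨ *-monoʳ-≤-nonNeg r {{ℚ.nonNegative 0≤r}} (^ℚ-mono i (0≤fromℕ (2 ℕ.* i)) 2i≤q) ⟩
    term i q                               ≡⟨ +-identityˡ _ ⟨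
    0ℚ + term i q                          ≤⟨ +-monoˡ-≤ (term i q) (0≤expSum i 0≤q) ⟩
    expSum (suc i) q                       ≤⟨ expSum-mono 0≤q (suc i) (n ℕ.∸ suc i) ⟩
    expSum (n ℕ.∸ suc i ℕ.+ suc i) q       ≡⟨ cong (λ k → expSum k q) (ℕₚ.m∸n+n≡m i<n) ⟩
    expSum n q                             ∎
    where
    open ≤-Reasoning
    r : ℚ
    r = recip (i !) {{i !≢0}}
    0≤r : 0ℚ ≤ r
    0≤r = 0≤recip (i !) {{i !≢0}}
    0≤q : 0ℚ ≤ q
    0≤q = ≤-trans (0≤fromℕ (2 ℕ.* i)) 2i≤q

-- Positivity of the argument when the exponential is at least 3.

module ExponentialSign where

  open import Defs using (fromℕ; expSum)
  open import Data.Integer.Base as ℤ using (ℤ; +_)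
  open import Data.Nat.Base as ℕ using (ℕ; zero; suc; z≤n; s≤s)
  import Data.Nat.Properties as ℕₚ

  open import Data.Rational.Base as ℚ using (ℚ; 0ℚ; 1ℚ; ½; _+_; _*_; -_; _≤_; _<_)
  open import Data.Rational.Properties
  open import Data.Rational.Solver using (module +-*-Solver)
  open import Algebra.Definitions.RawSemiring ℚ.+-*-rawSemiring using () renaming (_^_ to _^ℚ_)

  open ExponentialBounds

  sumTo : ℕ → (ℕ → ℚ) → ℚ
  sumTo zero    f = 0ℚ
  sumTo (suc n) f = sumTo n f + f n

  sumTo-cong : ∀ n {f g} → (∀ i → i ℕ.< n → f i ≡ g i) → sumTo n f ≡ sumTo n g
  sumTo-cong zero    eq = refl
  sumTo-cong (suc n) eq = cong₂ _+_ (sumTo-cong n λ i i<n → eq i (ℕₚ.m<n⇒m<1+n i<n)) (eq n ℕₚ.≤-refl)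

  sumTo-+ : ∀ n f g → sumTo n (λ i → f i + g i) ≡ sumTo n f + sumTo n g
  sumTo-+ zero    f g = refl
  sumTo-+ (suc n) f g = trans (cong (λ z → z + (f n + g n)) (sumTo-+ n f g)) (lem (sumTo n f) (sumTo n g) (f n) (g n))
    where
    lem : ∀ a b c d → a + b + (c + d) ≡ a + c + (b + d)
    lem = solve 4 (λ a b c d → a :+ b :+ (c :+ d) := a :+ c :+ (b :+ d)) refl where open +-*-Solver

  sumTo-* : ∀ n c f → sumTo n (λ i → c * f i) ≡ c * sumTo n f
  sumTo-* zero    c f = sym (*-zeroʳ c)
  sumTo-* (suc n) c f = trans (cong (λ z → z + c * f n) (sumTo-* n c f)) (sym (*-distribˡ-+ c (sumTo n f) (f n)))

  sumTo-head : ∀ n f → sumTo (suc n) f ≡ f 0 + sumTo n (λ i → f (suc i))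
  sumTo-head zero    f = trans (+-identityˡ (f 0)) (sym (+-identityʳ (f 0)))
  sumTo-head (suc n) f = trans (cong (λ z → z + f (suc n)) (sumTo-head n f)) (+-assoc (f 0) _ (f (suc n)))

  fromℕ-cancel : ∀ n {a} → fromℕ (suc n) * a ≡ 0ℚ → a ≡ 0ℚ
  fromℕ-cancel n {a} eq = begin
    a                                         ≡⟨ *-identityˡ a ⟨
    1ℚ * a                                    ≡⟨ cong (_* a) (fromℕ*recip (suc n)) ⟨
    fromℕ (suc n) * recip (suc n) * a         ≡⟨ lem (fromℕ (suc n)) (recip (suc n)) a ⟩
    recip (suc n) * (fromℕ (suc n) * a)       ≡⟨ cong (recip (suc n) *_) eq ⟩
    recip (suc n) * 0ℚ                        ≡⟨ *-zeroʳ (recip (suc n)) ⟩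
    0ℚ                                        ∎
    where
    open ≡-Reasoning
    lem : ∀ a b c → a * b * c ≡ b * (a * c)
    lem = solve 3 (λ a b c → a :* b :* c := b :* (a :* c)) refl where open +-*-Solver

  -- The series of exp x and exp (- x) have Cauchy product 1, so the partial sums of exp (- x), weighted by
  -- the terms x ^ i / i !, add up to 1: for x ≥ 0 they cannot all stay above 3.
  module _ (x : ℚ) where
    private
      t : ℚ
      t = - x
      w e : ℕ → ℚ
      w i = term i x
      e i = term i t
      conv : ℕ → ℚ
      conv s = sumTo (suc s) (λ i → w (s ℕ.∸ i) * e i)

      0*≡0 : ∀ a → fromℕ 0 * a ≡ 0ℚ
      0*≡0 a = *-zeroˡ a

      -- This replaces the binomial theorem. Multiplied by `suc s`, written as the sum of
      -- `suc s ∸ i` and `i`, each summand splits in two; `term-suc` absorbs one factor into the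
      -- term of x, the other into the term of t, and `(x + t) * conv s` is left, which vanishes.
      conv-suc : ∀ s → conv (suc s) ≡ 0ℚ
      conv-suc s = fromℕ-cancel s (begin
        fromℕ (suc s) * conv (suc s)
          ≡⟨ sumTo-* (suc (suc s)) (fromℕ (suc s)) F ⟨
        sumTo (suc (suc s)) (λ i → fromℕ (suc s) * F i)
          ≡⟨ sumTo-cong (suc (suc s)) split ⟩
        sumTo (suc (suc s)) (λ i → G i + H i)
          ≡⟨ sumTo-+ (suc (suc s)) G H ⟩
        sumTo (suc s) G + G (suc s) + sumTo (suc (suc s)) H
          ≡⟨ cong₂ _+_ (cong (λ z → sumTo (suc s) G + z) G-last) (sumTo-head (suc s) H) ⟩
        sumTo (suc s) G + 0ℚ + (H 0 + sumTo (suc s) (λ i → H (suc i)))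
          ≡⟨ cong₂ _+_ (trans (+-identityʳ _) (trans (sumTo-cong (suc s) G≡) (sumTo-* (suc s) x _)))
               (trans (cong (_+ sumTo (suc s) (λ i → H (suc i))) H-head) (trans (+-identityˡ _)
               (trans (sumTo-cong (suc s) H≡) (sumTo-* (suc s) t _)))) ⟩
        x * conv s + - x * conv s
          ≡⟨ *-distribʳ-+ (conv s) x (- x) ⟨
        (x + - x) * conv s
          ≡⟨ trans (cong (_* conv s) (+-inverseʳ x)) (*-zeroˡ (conv s)) ⟩
        0ℚ ∎)
        where
        open ≡-Reasoning
        F G H : ℕ → ℚ
        F i = w (suc s ℕ.∸ i) * e i
        G i = fromℕ (suc s ℕ.∸ i) * F i
        H i = fromℕ i * F i
        split : ∀ i → i ℕ.< suc (suc s) → fromℕ (suc s) * F i ≡ G i + H i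
        split i i≤ = trans (cong (λ k → fromℕ k * F i) (sym (ℕₚ.m∸n+n≡m (ℕ.s≤s⁻¹ i≤))))
          (trans (cong (_* F i) (fromℕ-+ (suc s ℕ.∸ i) i)) (*-distribʳ-+ (F i) (fromℕ (suc s ℕ.∸ i)) (fromℕ i)))
        G-last : G (suc s) ≡ 0ℚ
        G-last = trans (cong (λ k → fromℕ k * F (suc s)) (ℕₚ.n∸n≡0 (suc s))) (0*≡0 (F (suc s)))
        H-head : H 0 ≡ 0ℚ
        H-head = 0*≡0 (F 0)
        G≡ : ∀ i → i ℕ.< suc s → G i ≡ x * (w (s ℕ.∸ i) * e i)
        G≡ i i≤ = trans (cong (λ k → fromℕ k * (w k * e i)) (ℕₚ.+-∸-assoc 1 (ℕ.s≤s⁻¹ i≤)))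
          (trans (sym (*-assoc (fromℕ (suc (s ℕ.∸ i))) (w (suc (s ℕ.∸ i))) (e i)))
          (trans (cong (_* e i) (term-suc (s ℕ.∸ i) x)) (*-assoc x (w (s ℕ.∸ i)) (e i))))
        H≡ : ∀ i → i ℕ.< suc s → H (suc i) ≡ t * (w (s ℕ.∸ i) * e i)
        H≡ i i≤ = trans (lem (fromℕ (suc i)) (w (s ℕ.∸ i)) (e (suc i)))
          (trans (cong (w (s ℕ.∸ i) *_) (term-suc i t)) (lem (w (s ℕ.∸ i)) t (e i)))
          where
          lem : ∀ a b c → a * (b * c) ≡ b * (a * c)
          lem = solve 3 (λ a b c → a :* (b :* c) := b :* (a :* c)) refl where open +-*-Solver

      E : ℕ → ℚ
      E j = expSum j t

      T : ℕ → ℚ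
      T n = sumTo (suc n) (λ j → w (n ℕ.∸ j) * E j)

      T-suc : ∀ n → T (suc n) ≡ T n + conv n
      T-suc n = begin
        T (suc n)                                              ≡⟨ sumTo-head (suc n) (λ j → w (suc n ℕ.∸ j) * E j) ⟩
        w (suc n) * 0ℚ + sumTo (suc n) (λ j → w (n ℕ.∸ j) * (E j + e j))
          ≡⟨ cong₂ _+_ (*-zeroʳ (w (suc n))) (trans (sumTo-cong (suc n) λ j _ → *-distribˡ-+ (w (n ℕ.∸ j)) (E j) (e j))
               (sumTo-+ (suc n) (λ j → w (n ℕ.∸ j) * E j) (λ j → w (n ℕ.∸ j) * e j))) ⟩
        0ℚ + (T n + conv n)                                    ≡⟨ +-identityˡ _ ⟩
        T n + conv n                                           ∎
        where open ≡-Reasoning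

      T≡1 : ∀ n → T (suc n) ≡ 1ℚ
      T≡1 zero    = trans (T-suc 0) refl
      T≡1 (suc n) = trans (T-suc (suc n)) (trans (cong₂ _+_ (T≡1 n) (conv-suc n)) (+-identityʳ 1ℚ))

    -- The early partial sums of the series at `- x` may be negative, and nothing is assumed about
    -- them; a common lower bound for finitely many is enough.
    E-lower : ∀ k → Σ[ C ∈ ℚ ] 0ℚ ≤ C × (∀ j → j ℕ.< k → - C ≤ E j)
    E-lower zero = 0ℚ , ≤-refl , λ j ()
    E-lower (suc k) with E-lower k
    ... | C , 0≤C , low = C + ℚ.∣ E k ∣ , 0≤+ 0≤C (0≤∣p∣ (E k)) , λ j j<sk → bnd j (ℕₚ.m≤n⇒m<n∨m≡n (ℕ.s≤s⁻¹ j<sk))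
      where
      weaken : ∀ {a b} → 0ℚ ≤ b → - (a + b) ≤ - a
      weaken {a} {b} 0≤b = neg-antimono-≤ (subst (_≤ a + b) (+-identityʳ a) (+-monoʳ-≤ a 0≤b))
      -∣p∣≤p : ∀ p → - ℚ.∣ p ∣ ≤ p
      -∣p∣≤p p with ≤-total 0ℚ p
      ... | inj₁ 0≤p = ≤-trans (neg-antimono-≤ (0≤∣p∣ p)) 0≤p
      ... | inj₂ p≤0 = ≤-reflexive (trans (cong -_ (trans (sym (∣-p∣≡∣p∣ p)) (0≤p⇒∣p∣≡p (neg-antimono-≤ p≤0))))
                         (neg-involutive p))
        where
        neg-involutive : ∀ p → - (- p) ≡ p
        neg-involutive = solve 1 (λ p → :- (:- p) := p) refl where open +-*-Solver
      bnd : ∀ j → j ℕ.< k ⊎ j ≡ k → - (C + ℚ.∣ E k ∣) ≤ E j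
      bnd j (inj₁ j<k) = ≤-trans (weaken (0≤∣p∣ (E k))) (low j j<k)
      bnd j (inj₂ refl) = ≤-trans (subst (λ z → - z ≤ - ℚ.∣ E k ∣) (+-comm ℚ.∣ E k ∣ C) (weaken 0≤C)) (-∣p∣≤p (E k))

    module _ (0≤x : 0ℚ ≤ x) {k : ℕ} (low : ∀ n → k ℕ.≤ n → fromℕ 3 ≤ expSum n (- x)) where
      private
        C : ℚ
        C = proj₁ (E-lower k)
        0≤C : 0ℚ ≤ C
        0≤C = proj₁ (proj₂ (E-lower k))
        X A Q n : ℕ
        X = ℤ.∣ ℚ.↥ x ∣
        A = bound X
        -- large enough for the first k summands of T n to contribute at least - 1
        Q = ℤ.∣ ℚ.↥ C ∣ ℕ.* A ℕ.* k
        n = suc (k ℕ.+ Q)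

        δ : ℚ
        δ = C * (fromℕ A * ½ ^ℚ Q)

        ½^-anti : ∀ i j → i ℕ.≤ j → ½ ^ℚ j ≤ ½ ^ℚ i
        ½^-anti i       zero    z≤n = ≤-refl
        ½^-anti zero    (suc j) _ = ≤-trans (*-mono-≤ (0≤recip 2) (0≤fromℕ 1) ½≤1 (½^-anti 0 j z≤n)) (≤-reflexive (*-identityˡ 1ℚ))
          where
          ½≤1 : ½ ≤ 1ℚ
          ½≤1 = ≤ᵇ⇒≤ _
        ½^-anti (suc i) (suc j) (s≤s i≤j) = *-monoˡ-≤-nonNeg ½ (½^-anti i j i≤j)

        0≤w : ∀ i → 0ℚ ≤ w i
        0≤w i = 0≤term i 0≤x

        w≤ : ∀ j → j ℕ.≤ k → w (n ℕ.∸ j) ≤ fromℕ A * ½ ^ℚ Q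
        w≤ j j≤k = ≤-trans (term≤ X (n ℕ.∸ j) 0≤x (≤-archimedean x)) (*-monoˡ-≤-nonNeg (fromℕ A) {{ℚ.nonNegative (0≤fromℕ A)}}
          (½^-anti Q (n ℕ.∸ j) (ℕₚ.≤-trans (ℕₚ.≤-reflexive (sym (ℕₚ.m+n∸m≡n k Q))) (ℕₚ.∸-mono (ℕₚ.n≤1+n (k ℕ.+ Q)) j≤k))))

        S : ℕ → ℚ
        S m = sumTo m (λ j → w (n ℕ.∸ j) * E j)

        early : ∀ m → m ℕ.≤ k → - (fromℕ m * δ) ≤ S m
        early zero    _   = ≤-reflexive (cong -_ (*-zeroˡ δ))
        early (suc m) m<k = begin
          - (fromℕ (suc m) * δ)           ≡⟨ cong -_ (trans (cong (_* δ) (trans (cong fromℕ (ℕₚ.+-comm 1 m)) (fromℕ-+ m 1)))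
                                               (trans (*-distribʳ-+ δ (fromℕ m) 1ℚ) (cong (λ z → fromℕ m * δ + z) (*-identityˡ δ)))) ⟩
          - (fromℕ m * δ + δ)             ≡⟨ neg-distrib-+ (fromℕ m * δ) δ ⟩
          - (fromℕ m * δ) + - δ           ≤⟨ +-mono-≤ (early m (ℕₚ.<⇒≤ m<k)) step ⟩
          S m + w (n ℕ.∸ m) * E m         ∎
          where
          open ≤-Reasoning
          wm : ℚ
          wm = w (n ℕ.∸ m)
          step : - δ ≤ wm * E m
          step = begin
            - (C * (fromℕ A * ½ ^ℚ Q))    ≤⟨ neg-antimono-≤ (*-monoˡ-≤-nonNeg C {{ℚ.nonNegative 0≤C}} (w≤ m (ℕₚ.<⇒≤ m<k))) ⟩
            - (C * wm)                    ≡⟨ trans (cong -_ (*-comm C wm)) (neg-distribʳ-* wm C) ⟩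
            wm * - C                      ≤⟨ *-monoˡ-≤-nonNeg wm {{ℚ.nonNegative (0≤w (n ℕ.∸ m))}} (proj₂ (proj₂ (E-lower k)) m m<k) ⟩
            wm * E m                      ∎

        late : ∀ m → S k ≤ S (m ℕ.+ k)
        late zero    = ≤-refl
        late (suc m) = ≤-trans (late m) (≤-trans (≤-reflexive (sym (+-identityʳ _))) (+-monoʳ-≤ (S (m ℕ.+ k))
          (0≤* (0≤w (n ℕ.∸ (m ℕ.+ k))) (≤-trans (0≤fromℕ 3) (low (m ℕ.+ k) (ℕₚ.m≤n+m k m))))))

        kδ≤1 : fromℕ k * δ ≤ 1ℚ
        kδ≤1 = begin
          fromℕ k * (C * (fromℕ A * h))            ≤⟨ *-monoˡ-≤-nonNeg (fromℕ k) {{ℚ.nonNegative (0≤fromℕ k)}}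
                                                       (*-monoʳ-≤-nonNeg (fromℕ A * h) {{ℚ.nonNegative (0≤* (0≤fromℕ A) 0≤h)}} (≤-archimedean C)) ⟩
          fromℕ k * (fromℕ c * (fromℕ A * h))      ≡⟨ lem (fromℕ k) (fromℕ c) (fromℕ A) h ⟩
          fromℕ c * fromℕ A * fromℕ k * h          ≡⟨ cong (_* h) (trans (fromℕ-* (c ℕ.* A) k) (cong (_* fromℕ k) (fromℕ-* c A))) ⟨
          fromℕ Q * h                              ≤⟨ *-monoʳ-≤-nonNeg h {{ℚ.nonNegative 0≤h}} (fromℕ-mono-≤ (ℕₚ.<⇒≤ (n<2^n Q))) ⟩
          fromℕ (2 ℕ.^ Q) * h                      ≡⟨ 2^*½^ Q ⟩
          1ℚ                                       ∎
          where
          open ≤-Reasoning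
          c : ℕ
          c = ℤ.∣ ℚ.↥ C ∣
          h : ℚ
          h = ½ ^ℚ Q
          0≤h : 0ℚ ≤ h
          0≤h = ^ℚ-nonNeg Q (0≤recip 2)
          lem : ∀ a b c d → a * (b * (c * d)) ≡ b * c * a * d
          lem = solve 4 (λ a b c d → a :* (b :* (c :* d)) := b :* c :* a :* d) refl where open +-*-Solver

      -- In the weighted sum, which equals 1, the first k summands contribute at least -1 and the
      -- later ones are nonnegative. The last one has weight `w 0 = 1` and contributes at least 3,
      -- so the total would be at least 2.
      exp-neg≱3 : ⊥
      exp-neg≱3 = <-irrefl refl (<-≤-trans 1<2 2≤1)
        where
        open ≤-Reasoning
        1<2 : fromℕ 1 < fromℕ 2
        1<2 = ≰⇒> λ p → ℕₚ.<-irrefl refl (fromℕ-cancel-< {1} {1} (<-≤-trans (ℚ.*<* (ℤ.+<+ (s≤s (s≤s z≤n)))) p))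
        2≤1 : fromℕ 2 ≤ fromℕ 1
        2≤1 = begin
          fromℕ 2                            ≡⟨⟩
          - 1ℚ + fromℕ 3                     ≤⟨ +-mono-≤ (neg-antimono-≤ kδ≤1) (low n (ℕₚ.m≤n⇒m≤1+n (ℕₚ.m≤m+n k Q))) ⟩
          - (fromℕ k * δ) + E n              ≤⟨ +-monoˡ-≤ (E n) (≤-trans (early k ℕₚ.≤-refl) (late (suc Q))) ⟩
          S (suc Q ℕ.+ k) + E n              ≡⟨ cong₂ _+_ (cong S (cong suc (ℕₚ.+-comm Q k))) (sym (trans (cong (λ i → w i * E n) (ℕₚ.n∸n≡0 n)) (*-identityˡ (E n)))) ⟩
          S n + w (n ℕ.∸ n) * E n            ≡⟨ T≡1 (k ℕ.+ Q) ⟩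
          fromℕ 1                            ∎

-- From the hypothesis on D to a bound for the length of N.

module Hypothesis where

  open import Defs using (fromℕ; expSum; _<exp_; _exp<_)

  open import Data.Integer.Base using (+_)
  open import Data.Nat.Base as ℕ using (ℕ; zero; suc; z≤n; s≤s)
  import Data.Nat.Properties as ℕₚ

  open import Data.Rational.Base as ℚ using (ℚ; 0ℚ; 1ℚ; _+_; _*_; -_; _≤_; _<_)
  open import Data.Rational.Properties
  open import Data.Rational.Solver using (module +-*-Solver)

  open ExponentialBounds
  open ExponentialSign
  open import Defs using (size; exp; √_; real; _*ᵣ_; log; _<ᵣ_)
  open import Data.Nat.Logarithm using (⌊log₂_⌋; ⌊log₂⌋-mono-≤; ⌊log₂⌊n/2⌋⌋≡⌊log₂n⌋∸1; ⌊log₂[2^n]⌋≡n)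
  open import Data.Nat.Induction using (<-rec)

  2^⌊log₂⌋≤ : ∀ n → 0 ℕ.< n → 2 ℕ.^ ⌊log₂ n ⌋ ℕ.≤ n
  2^⌊log₂⌋≤ = <-rec _ go
    where
    2*⌊n/2⌋≤n : ∀ n → 2 ℕ.* ℕ.⌊ n /2⌋ ℕ.≤ n
    2*⌊n/2⌋≤n n = ℕₚ.≤-trans (ℕₚ.+-monoʳ-≤ ℕ.⌊ n /2⌋ (ℕₚ.≤-trans (ℕₚ.≤-reflexive (ℕₚ.+-identityʳ _)) (ℕₚ.⌊n/2⌋≤⌈n/2⌉ n)))
      (ℕₚ.≤-reflexive (ℕₚ.⌊n/2⌋+⌈n/2⌉≡n n))
    go : ∀ n → (∀ {m} → m ℕ.< n → 0 ℕ.< m → 2 ℕ.^ ⌊log₂ m ⌋ ℕ.≤ m) → 0 ℕ.< n → 2 ℕ.^ ⌊log₂ n ⌋ ℕ.≤ n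
    go 1 rec _ = s≤s z≤n
    go n@(suc (suc k)) rec _ = ℕₚ.≤-trans (ℕₚ.≤-reflexive (cong (2 ℕ.^_) l≡)) (ℕₚ.≤-trans
        (ℕₚ.*-monoʳ-≤ 2 (rec (ℕₚ.⌊n/2⌋<n (suc k)) (s≤s z≤n))) (2*⌊n/2⌋≤n n))
      where
      l≡ : ⌊log₂ n ⌋ ≡ suc ⌊log₂ ℕ.⌊ n /2⌋ ⌋
      l≡ = trans (sym (ℕₚ.m+[n∸m]≡n (⌊log₂⌋-mono-≤ {2} {n} (s≤s (s≤s z≤n))))) (cong suc (sym (⌊log₂⌊n/2⌋⌋≡⌊log₂n⌋∸1 n)))

  n<2^size : ∀ n → n ℕ.< 2 ℕ.^ size n
  n<2^size n = ℕₚ.≰⇒> λ p → ℕₚ.<⇒≱ (ℕₚ.n<1+n ⌊log₂ n ⌋)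
    (ℕₚ.≤-trans (ℕₚ.≤-reflexive (sym (⌊log₂[2^n]⌋≡n (size n)))) (⌊log₂⌋-mono-≤ p))

  <2^⇒size≤ : ∀ n m → 0 ℕ.< n → n ℕ.< 2 ℕ.^ m → size n ℕ.≤ m
  <2^⇒size≤ n m 0<n n<2^m = ℕₚ.≰⇒> λ m≤ → ℕₚ.<⇒≱ n<2^m (ℕₚ.≤-trans (ℕₚ.^-monoʳ-≤ 2 m≤) (2^⌊log₂⌋≤ n 0<n))

  -- An element t of the cut of a logarithm is only known through `s <exp t`, whereas the bounds for
  -- partial sums assume a nonnegative argument. Were t ≤ 0, the series at `- (- t)` would stay
  -- above 3.
  exp-positive : ∀ {s t} → fromℕ 3 ≤ s → s <exp t → 0ℚ < t
  exp-positive {s} {t} 3≤s (s′ , s<s′ , k , low) = ≰⇒> λ t≤0 → exp-neg≱3 (- t) (neg-antimono-≤ t≤0) {k}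
    λ n k≤n → ≤-trans 3≤s (≤-trans (<⇒≤ s<s′) (subst (λ z → s′ ≤ expSum n z) (sym (neg-involutive t)) (low n k≤n)))
    where
    neg-involutive : ∀ p → - (- p) ≡ p
    neg-involutive = solve 1 (λ p → :- (:- p) := p) refl where open +-*-Solver

  <exp⇒< : ∀ T {s t} → 0ℚ ≤ t → t ≤ fromℕ T → s <exp t → s < fromℕ (2 ℕ.* bound T)
  <exp⇒< T 0≤t t≤T (s′ , s<s′ , k , low) = <-≤-trans s<s′ (≤-trans (low k ℕₚ.≤-refl) (expSum≤ T k 0≤t t≤T))

  exp<⇒< : ∀ i {r D} → fromℕ (2 ℕ.* i) ≤ r → r exp< fromℕ D → 2 ℕ.^ i ℕ.< D
  exp<⇒< i 2i≤r (s , s<D , k , up) = fromℕ-cancel-< (≤-<-trans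
    (≤-trans (expSum≥ i (k ℕ.+ suc i) 2i≤r (ℕₚ.m≤n+m (suc i) k)) (up (k ℕ.+ suc i) (ℕₚ.m≤m+n k (suc i)))) s<D)

  module _ {D N : ℕ} (3≤N : 3 ℕ.≤ N) (hyp : exp (√ (real 2 *ᵣ log (real N) *ᵣ log (log (real N)))) <ᵣ fromℕ D) where

    2≤D : 2 ℕ.≤ D
    -- The case i = 0 of `exp<⇒<`: for r ≥ 0 the exponential is at least 1.
    2≤D = let r , (0≤r , _) , r<D = hyp in exp<⇒< 0 0≤r r<D

    private
      L T : ℕ
      L = size D
      T = 2 ℕ.* L ℕ.* (2 ℕ.* L)

      r² : ∀ {r} → 0ℚ ≤ r → r exp< fromℕ D → r * r ≤ fromℕ T
      r² {r} 0≤r r<D = ≤-trans (*-mono-≤ 0≤r (0≤fromℕ (2 ℕ.* L)) r≤ r≤) (≤-reflexive (sym (fromℕ-* (2 ℕ.* L) (2 ℕ.* L))))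
        where
        r≤ : r ≤ fromℕ (2 ℕ.* L)
        -- If r were at least 2 L, then 2 ^ L < D, although D has only L binary digits.
        r≤ = <⇒≤ (≰⇒> λ p → ℕₚ.<-asym (exp<⇒< L p r<D) (n<2^size D))

      3≤ : ∀ {s} → real N <ᵣ s → fromℕ 3 ≤ s
      3≤ N<s = <⇒≤ (≤-<-trans (fromℕ-mono-≤ 3≤N) N<s)

      -- `bound 8` is 16 ^ 16 = 2 ^ 64.
      16^16≤ : 2 ℕ.* bound 8 ℕ.≤ 2 ℕ.^ 65
      16^16≤ = ℕₚ.≤ᵇ⇒≤ (2 ℕ.* bound 8) (2 ℕ.^ 65) _

      bound≤ : 2 ℕ.* bound T ℕ.≤ 2 ℕ.^ (1 ℕ.+ 2 ℕ.* T ℕ.* (2 ℕ.* T))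
      bound≤ = ℕₚ.*-monoʳ-≤ 2 (ℕₚ.≤-trans (ℕₚ.^-monoˡ-≤ (2 ℕ.* T) (ℕₚ.<⇒≤ (n<2^n (2 ℕ.* T)))) (ℕₚ.≤-reflexive (ℕₚ.^-*-assoc 2 (2 ℕ.* T) (2 ℕ.* T))))

      -- The sum of the bounds of the two cases below, in place of their maximum.
      target : ℕ
      target = 65 ℕ.+ (1 ℕ.+ 2 ℕ.* T ℕ.* (2 ℕ.* T))

      0<N : 0 ℕ.< N
      0<N = ℕₚ.≤-trans (s≤s z≤n) 3≤N

      small : ∀ {s₂} → s₂ ≤ fromℕ 8 → log (real N) <ᵣ s₂ → size N ℕ.≤ target
      small s₂≤8 (s₃ , N<s₃ , s₃<) = ℕₚ.≤-trans (<2^⇒size≤ N 65 0<N (ℕₚ.<-≤-trans (fromℕ-cancel-< (<-trans N<s₃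
        (<exp⇒< 8 (<⇒≤ (exp-positive (3≤ N<s₃) s₃<)) s₂≤8 s₃<))) 16^16≤)) (ℕₚ.m≤m+n 65 _)

      large : ∀ {r u v w t s₂} → r * r ≤ fromℕ T → u * v ≤ r * r → fromℕ 2 < w → w * t ≤ u →
              log (real N) <ᵣ t → fromℕ 8 < s₂ → s₂ <exp v → size N ℕ.≤ target
      large {r} {u} {v} {w} {t} {s₂} r²≤ uv≤ 2<w wt≤u (s , N<s , s<) 8<s₂ s₂< =
        ℕₚ.≤-trans (<2^⇒size≤ N _ 0<N (ℕₚ.<-≤-trans (fromℕ-cancel-< (<-trans N<s (<exp⇒< T (<⇒≤ 0<t) t≤T s<))) bound≤))
          (ℕₚ.m≤n+m _ 65)
        where
        0<t : 0ℚ < t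
        0<t = exp-positive (3≤ N<s) s<
        0≤t : 0ℚ ≤ t
        0≤t = <⇒≤ 0<t
        0<v : 0ℚ < v
        0<v = exp-positive (≤-trans (fromℕ-mono-≤ {3} {8} (s≤s (s≤s (s≤s z≤n)))) (<⇒≤ 8<s₂)) s₂<
        1≤v : 1ℚ ≤ v
        -- This explains the threshold 8: for v ≤ 1 the exponential of v, and with it s₂, would be
        -- less than `2 * bound 1 = 8`.
        1≤v = <⇒≤ (≰⇒> λ v≤1 → <-asym 8<s₂ (<exp⇒< 1 (<⇒≤ 0<v) v≤1 s₂<))
        1≤w : 1ℚ ≤ w
        1≤w = ≤-trans (fromℕ-mono-≤ {1} {2} (s≤s z≤n)) (<⇒≤ 2<w)
        t≤u : t ≤ u
        t≤u = ≤-trans (≤-trans (≤-reflexive (sym (*-identityˡ t))) (*-monoʳ-≤-nonNeg t {{ℚ.nonNegative 0≤t}} 1≤w)) wt≤u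
        t≤T : t ≤ fromℕ T
        t≤T = ≤-trans t≤u (≤-trans (≤-trans (≤-reflexive (sym (*-identityʳ u)))
          (*-monoˡ-≤-nonNeg u {{ℚ.nonNegative (≤-trans 0≤t t≤u)}} 1≤v)) (≤-trans uv≤ r²≤))

      decide : ∀ {r u v w t s₂} → r * r ≤ fromℕ T → u * v ≤ r * r → fromℕ 2 < w → w * t ≤ u →
               log (real N) <ᵣ t → log (real N) <ᵣ s₂ → s₂ <exp v → Dec (s₂ ≤ fromℕ 8) → size N ℕ.≤ target
      decide _ _ _ _ _ Ns₂ _ (yes s₂≤8) = small s₂≤8 Ns₂
      decide {r} r²≤ uv≤ 2<w wt≤u Nt _ s₂< (no s₂≰8) = large {r} r²≤ uv≤ 2<w wt≤u Nt (≰⇒> s₂≰8) s₂<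

    size-bound : size N ℕ.≤ target
    size-bound =
      let r , (0≤r , u , v , (w , t , 2<w , Nt , wt≤u) , (s₂ , Ns₂ , s₂<) , uv≤) , r<D = hyp
      in decide {r} (r² 0≤r r<D) uv≤ 2<w wt≤u Nt Ns₂ s₂< (s₂ ≤? fromℕ 8)

-- Congruences and orders modulo N.

module Congruences where

  open import Data.Integer.Base as ℤ using (ℤ; +_; 0ℤ; 1ℤ)
  import Data.Integer.Properties as ℤₚ
  import Data.Integer.Divisibility.Signed as ℤ∣
  open ℤ∣ using () renaming (_∣_ to _∣ᶻ_)
  open import Data.Integer.Solver using (module +-*-Solver)

  open import Data.Nat.Base
  open import Data.Nat.Coprimality as Cop using (Coprime; coprime-divisor)
  open import Data.Nat.Divisibility
  open import Data.Nat.DivMod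
  open import Data.Nat.Primality
  open import Data.Nat.Properties

  ∣ᶻ⇒∣ : ∀ {a b} → + a ∣ᶻ b → a ∣ ℤ.∣ b ∣
  ∣ᶻ⇒∣ = ℤ∣.∣⇒∣ᵤ

  ∣⇒∣ᶻ : ∀ {a b} → a ∣ ℤ.∣ b ∣ → + a ∣ᶻ b
  ∣⇒∣ᶻ = ℤ∣.∣ᵤ⇒∣

  pos-^ : ∀ a n → + (a ^ n) ≡ (+ a) ℤ.^ n
  pos-^ a zero    = refl
  pos-^ a (suc n) = trans (ℤₚ.pos-* a (a ^ n)) (cong (+ a ℤ.*_) (pos-^ a n))

  ^ᶻ-distribʳ-* : ∀ a b n → (a ℤ.* b) ℤ.^ n ≡ a ℤ.^ n ℤ.* b ℤ.^ n
  ^ᶻ-distribʳ-* a b zero    = refl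
  ^ᶻ-distribʳ-* a b (suc n) = trans (cong (a ℤ.* b ℤ.*_) (^ᶻ-distribʳ-* a b n))
    (interchange a b (a ℤ.^ n) (b ℤ.^ n))
    where
    interchange : ∀ a b c d → a ℤ.* b ℤ.* (c ℤ.* d) ≡ a ℤ.* c ℤ.* (b ℤ.* d)
    interchange = solve 4 (λ a b c d → a :* b :* (c :* d) := a :* c :* (b :* d)) refl where open +-*-Solver

  abs-^ : ∀ a n → ℤ.∣ a ℤ.^ n ∣ ≡ ℤ.∣ a ∣ ^ n
  abs-^ a zero    = refl
  abs-^ a (suc n) = trans (ℤₚ.abs-* a (a ℤ.^ n)) (cong (ℤ.∣ a ∣ *_) (abs-^ a n))

  ∣⊖∣ : ∀ a b → ℤ.∣ a ℤ.⊖ b ∣ ≡ ∣ a - b ∣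
  ∣⊖∣ a b with ≤-total a b
  ... | inj₁ a≤b = trans (ℤₚ.∣⊖∣-≤ a≤b) (sym (m≤n⇒∣m-n∣≡n∸m a≤b))
  ... | inj₂ b≤a = trans (ℤₚ.∣m⊖n∣≡∣n⊖m∣ a b) (trans (ℤₚ.∣⊖∣-≤ b≤a) (sym (m≤n⇒∣n-m∣≡n∸m b≤a)))

  infix 4 _≅_⟨_⟩
  -- A record, because the difference `a ℤ.- b` alone would not determine the two sides.
  record _≅_⟨_⟩ (a b : ℤ) (N : ℕ) : Set where
    constructor mk≅
    field divides-diff : + N ∣ᶻ a ℤ.- b
  open _≅_⟨_⟩ public

  module _ {N : ℕ} where

    ≅-refl : ∀ {a} → a ≅ a ⟨ N ⟩
    ≅-refl {a} = mk≅ (subst (+ N ∣ᶻ_) (sym (ℤₚ.+-inverseʳ a)) (ℤ∣.divides 0ℤ refl))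

    ≅-reflexive : ∀ {a b} → a ≡ b → a ≅ b ⟨ N ⟩
    ≅-reflexive refl = ≅-refl

    ≅-sym : ∀ {a b} → a ≅ b ⟨ N ⟩ → b ≅ a ⟨ N ⟩
    ≅-sym {a} {b} (mk≅ d) = mk≅ (subst (+ N ∣ᶻ_) (lem a b) (ℤ∣.∣m⇒∣-m d))
      where
      lem : ∀ a b → ℤ.- (a ℤ.- b) ≡ b ℤ.- a
      lem = solve 2 (λ a b → :- (a :- b) := b :- a) refl where open +-*-Solver

    ≅-trans : ∀ {a b c} → a ≅ b ⟨ N ⟩ → b ≅ c ⟨ N ⟩ → a ≅ c ⟨ N ⟩
    ≅-trans {a} {b} {c} (mk≅ d) (mk≅ e) = mk≅ (subst (+ N ∣ᶻ_) (lem a b c) (ℤ∣.∣m∣n⇒∣m+n d e))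
      where
      lem : ∀ a b c → (a ℤ.- b) ℤ.+ (b ℤ.- c) ≡ a ℤ.- c
      lem = solve 3 (λ a b c → (a :- b) :+ (b :- c) := a :- c) refl where open +-*-Solver

    ≅-* : ∀ {a b c d} → a ≅ b ⟨ N ⟩ → c ≅ d ⟨ N ⟩ → a ℤ.* c ≅ b ℤ.* d ⟨ N ⟩
    ≅-* {a} {b} {c} {d} (mk≅ p) (mk≅ q) = mk≅ (subst (+ N ∣ᶻ_) (lem a b c d)
        (ℤ∣.∣m∣n⇒∣m+n (ℤ∣.∣m⇒∣m*n c p) (ℤ∣.∣n⇒∣m*n b q)))
      where
      lem : ∀ a b c d → (a ℤ.- b) ℤ.* c ℤ.+ b ℤ.* (c ℤ.- d) ≡ a ℤ.* c ℤ.- b ℤ.* d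
      lem = solve 4 (λ a b c d → (a :- b) :* c :+ b :* (c :- d) := a :* c :- b :* d) refl where open +-*-Solver

    ≅-^ : ∀ {a b} n → a ≅ b ⟨ N ⟩ → a ℤ.^ n ≅ b ℤ.^ n ⟨ N ⟩
    ≅-^ zero    p = ≅-refl
    ≅-^ (suc n) p = ≅-* p (≅-^ n p)

    ≅-absorb : ∀ a {b} → b ≅ 1ℤ ⟨ N ⟩ → a ℤ.* b ≅ a ⟨ N ⟩
    ≅-absorb a p = ≅-trans (≅-* (≅-refl {a}) p) (≅-reflexive (ℤₚ.*-identityʳ a))

    1^-≅ : ∀ {a} n → a ≅ 1ℤ ⟨ N ⟩ → a ℤ.^ n ≅ 1ℤ ⟨ N ⟩
    1^-≅ n p = ≅-trans (≅-^ n p) (≅-reflexive (ℤₚ.^-zeroˡ n))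

    ≅? : ∀ a b → Dec (a ≅ b ⟨ N ⟩)
    ≅? a b with (+ N) ℤ∣.∣? (a ℤ.- b)
    ... | yes d = yes (mk≅ d)
    ... | no ¬d = no λ (mk≅ d) → ¬d d

    ≅-∣ : ∀ {a b p} → p ∣ N → a ≅ b ⟨ N ⟩ → a ≅ b ⟨ p ⟩
    ≅-∣ p∣N (mk≅ d) = mk≅ (ℤ∣.∣-trans (∣⇒∣ᶻ p∣N) d)

    ≅-cancelˡ : ∀ {a b} c → Coprime ℤ.∣ c ∣ N → c ℤ.* a ≅ c ℤ.* b ⟨ N ⟩ → a ≅ b ⟨ N ⟩
    ≅-cancelˡ {a} {b} c cop (mk≅ d) = mk≅ (∣⇒∣ᶻ (coprime-divisor (Cop.sym cop)
        (subst (N ∣_) (trans (cong ℤ.∣_∣ (lem c a b)) (ℤₚ.abs-* c (a ℤ.- b))) (∣ᶻ⇒∣ d))))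
      where
      lem : ∀ c a b → c ℤ.* a ℤ.- c ℤ.* b ≡ c ℤ.* (a ℤ.- b)
      lem = solve 3 (λ c a b → c :* a :- c :* b := c :* (a :- b)) refl where open +-*-Solver

    %-≅ : ∀ a .{{_ : NonZero N}} → + (a % N) ≅ + a ⟨ N ⟩
    %-≅ a = ≅-sym (mk≅ (ℤ∣.divides (+ (a / N)) (begin
        + a ℤ.- + (a % N)                                  ≡⟨ cong (λ z → + z ℤ.- + (a % N)) (m≡m%n+[m/n]*n a N) ⟩
        + (a % N + a / N * N) ℤ.- + (a % N)                ≡⟨ cong (ℤ._- + (a % N)) (ℤₚ.pos-+ (a % N) (a / N * N)) ⟩
        + (a % N) ℤ.+ + (a / N * N) ℤ.- + (a % N)          ≡⟨ lem (+ (a % N)) (+ (a / N * N)) ⟩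
        + (a / N * N)                                      ≡⟨ ℤₚ.pos-* (a / N) N ⟩
        + (a / N) ℤ.* + N                                  ∎)))
      where
      open ≡-Reasoning
      lem : ∀ a b → a ℤ.+ b ℤ.- a ≡ b
      lem = solve 2 (λ a b → a :+ b :- a := b) refl where open +-*-Solver

    ≅⇒∣-∣ : ∀ {a b} → + a ≅ + b ⟨ N ⟩ → N ∣ ∣ a - b ∣
    ≅⇒∣-∣ {a} {b} (mk≅ d) = subst (N ∣_) (trans (cong ℤ.∣_∣ (ℤₚ.[+m]-[+n]≡m⊖n a b)) (∣⊖∣ a b)) (∣ᶻ⇒∣ d)

    ∣-∣⇒≅ : ∀ {a b} → N ∣ ∣ a - b ∣ → + a ≅ + b ⟨ N ⟩
    ∣-∣⇒≅ {a} {b} d = mk≅ (∣⇒∣ᶻ (subst (N ∣_) (sym (trans (cong ℤ.∣_∣ (ℤₚ.[+m]-[+n]≡m⊖n a b)) (∣⊖∣ a b))) d))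

    ≅⇒≡ : ∀ {a b} → + a ≅ + b ⟨ N ⟩ → a < N → b < N → a ≡ b
    ≅⇒≡ {a} {b} c a<N b<N with ∣ a - b ∣ in eq
      | ≅⇒∣-∣ c | ∣m-n∣≤m⊔n a b
    ... | zero  | _ | _ = ∣m-n∣≡0⇒m≡n eq
    ... | suc k | d | l = ⊥-elim (<-irrefl refl (<-≤-trans (≤-<-trans (≤-trans (∣⇒≤ d) l) (⊔-lub-< a<N b<N)) ≤-refl))
      where
      ⊔-lub-< : ∀ {a b c} → a < c → b < c → a ⊔ b < c
      ⊔-lub-< p q = ⊔-pres-<m p q

    coprime-≅ : ∀ a b → a ≅ b ⟨ N ⟩ → Coprime ℤ.∣ a ∣ N → Coprime ℤ.∣ b ∣ N
    coprime-≅ a b (mk≅ d) cop {e} (e∣b , e∣N) = cop (e∣a , e∣N)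
      where
      lem : ∀ a b → (a ℤ.- b) ℤ.+ b ≡ a
      lem = solve 2 (λ a b → (a :- b) :+ b := a) refl where open +-*-Solver
      e∣a : e ∣ ℤ.∣ a ∣
      e∣a = ∣ᶻ⇒∣ (subst (+ e ∣ᶻ_) (lem a b) (ℤ∣.∣m∣n⇒∣m+n (ℤ∣.∣-trans (∣⇒∣ᶻ e∣N) d) (∣⇒∣ᶻ e∣b)))

  coprime-* : ∀ {a b n} → Coprime a n → Coprime b n → Coprime (a * b) n
  coprime-* ca cb {d} (d∣ab , d∣n) = cb (coprime-divisor (λ (p , q) → ca (q , ∣-trans p d∣n)) d∣ab , d∣n)

  coprime-^ : ∀ {a n} k → Coprime a n → Coprime (a ^ k) n
  coprime-^ zero    c = Cop.1-coprimeTo _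
  coprime-^ (suc k) c = coprime-* c (coprime-^ k c)

  coprime-^ᶻ : ∀ {N} {a} k → Coprime ℤ.∣ a ∣ N → Coprime ℤ.∣ a ℤ.^ k ∣ N
  coprime-^ᶻ {N} {a} k c = subst (λ z → Coprime z N) (sym (abs-^ a k)) (coprime-^ k c)

  ^≅1⇒coprime : ∀ {N a k} → 0 < k → a ℤ.^ k ≅ 1ℤ ⟨ N ⟩ → Coprime ℤ.∣ a ∣ N
  ^≅1⇒coprime {N} {a} {suc k} _ p {d} (d∣a , d∣N) =
    coprime-≅ 1ℤ (a ℤ.^ suc k) (≅-sym p) (Cop.1-coprimeTo N)
      (subst (d ∣_) (sym (ℤₚ.abs-* a (a ℤ.^ k))) (∣m⇒∣m*n _ d∣a) , d∣N)

  prime-coprime : ∀ {p n} → Prime p → ¬ p ∣ n → Coprime n p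
  prime-coprime pr p∤n {d} (d∣n , d∣p) with prime⇒irreducible pr d∣p
  ... | inj₁ d≡1 = d≡1
  ... | inj₂ refl = ⊥-elim (p∤n d∣n)

  -- Minimality is stated as divisibility, for all exponents: in this form it combines with
  -- coprimality, and no comparison of exponents is needed for products and powers.
  record Ord (N : ℕ) (x : ℤ) (r : ℕ) : Set where
    field
      positive : 0 < r
      power    : x ℤ.^ r ≅ 1ℤ ⟨ N ⟩
      minimal  : ∀ k → x ℤ.^ k ≅ 1ℤ ⟨ N ⟩ → r ∣ k
  open Ord public

  module _ {N : ℕ} where

    ord-≅ : ∀ {x y r} → x ≅ y ⟨ N ⟩ → Ord N x r → Ord N y r
    ord-≅ {r = r} x≅y o = record
      { positive = positive o
      ; power    = ≅-trans (≅-^ r (≅-sym x≅y)) (power o)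
      ; minimal  = λ k p → minimal o k (≅-trans (≅-^ k x≅y) p) }

    ^∣-≅ : ∀ x r k → x ℤ.^ r ≅ 1ℤ ⟨ N ⟩ → r ∣ k → x ℤ.^ k ≅ 1ℤ ⟨ N ⟩
    ^∣-≅ x r _ p (divides q refl) = ≅-trans
      (≅-reflexive (trans (cong (x ℤ.^_) (*-comm q r)) (sym (ℤₚ.^-*-assoc x r q)))) (1^-≅ q p)

    -- The remainder modulo r of an exponent k with x ^ k = 1 is again such an exponent, and it is
    -- less than r. This form is what a search for the first coincidence provides.
    least⇒ord : ∀ {x r} → 0 < r → x ℤ.^ r ≅ 1ℤ ⟨ N ⟩ →
                (∀ e → 0 < e → e < r → ¬ x ℤ.^ e ≅ 1ℤ ⟨ N ⟩) → Ord N x r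
    least⇒ord {x} {r@(suc _)} 0<r p least = record { positive = 0<r ; power = p ; minimal = min }
      where
      min : ∀ k → x ℤ.^ k ≅ 1ℤ ⟨ N ⟩ → r ∣ k
      min k q with k % r in eq
      ... | zero  = m%n≡0⇒n∣m k r eq
      ... | suc e = ⊥-elim (least (suc e) z<s (subst (_< r) eq (m%n<n k r)) (≅-trans (≅-sym red) q))
        where
        red : x ℤ.^ k ≅ x ℤ.^ suc e ⟨ N ⟩
        red = ≅-trans (≅-reflexive (trans
                (cong (x ℤ.^_) (trans (m≡m%n+[m/n]*n k r) (cong (_+ k / r * r) eq)))
                (ℤₚ.^-distribˡ-+-* x (suc e) (k / r * r))))
              (≅-absorb (x ℤ.^ suc e) (^∣-≅ x r (k / r * r) p (divides (k / r) refl)))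

    ord-^ : ∀ {x r s} → 0 < r → 0 < s → Ord N x (r * s) → Ord N (x ℤ.^ s) r
    ord-^ {x} {r} {s@(suc _)} 0<r 0<s o = record
      { positive = 0<r
      ; power    = ≅-trans (≅-reflexive (trans (ℤₚ.^-*-assoc x s r) (cong (x ℤ.^_) (*-comm s r)))) (power o)
      ; minimal  = λ k p → *-cancelʳ-∣ s (minimal o (k * s)
          (≅-trans (≅-reflexive (trans (cong (x ℤ.^_) (*-comm k s)) (sym (ℤₚ.^-*-assoc x s k)))) p)) }

    -- If (x y) ^ k = 1, raising to the power s removes y, so r divides s k and, by coprimality, k;
    -- likewise s divides k.
    ord-* : ∀ {x y r s} → Coprime r s → Ord N x r → Ord N y s → Ord N (x ℤ.* y) (r * s)
    ord-* {x} {y} {r} {s} cop ox oy = record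
      { positive = *-mono-≤ (positive ox) (positive oy)
      ; power    = ≅-trans (≅-reflexive (^ᶻ-distribʳ-* x y (r * s)))
                     (≅-* (^∣-≅ x r (r * s) (power ox) (m∣m*n s)) (^∣-≅ y s (r * s) (power oy) (n∣m*n r)))
      ; minimal  = min }
      where
      half : ∀ {x y r s} → Coprime r s → Ord N x r → Ord N y s → ∀ k →
             (x ℤ.* y) ℤ.^ k ≅ 1ℤ ⟨ N ⟩ → r ∣ k
      half {x} {y} {r} {s} cop ox oy k p = coprime-divisor cop (minimal ox (s * k)
        (≅-trans (≅-sym (≅-absorb (x ℤ.^ (s * k)) (^∣-≅ y s (s * k) (power oy) (m∣m*n k))))
        (≅-trans (≅-reflexive (trans (sym (^ᶻ-distribʳ-* x y (s * k)))
            (trans (cong ((x ℤ.* y) ℤ.^_) (*-comm s k)) (sym (ℤₚ.^-*-assoc (x ℤ.* y) k s)))))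
          (1^-≅ s p))))
      join : ∀ {k} → r ∣ k → s ∣ k → r * s ∣ k
      join (divides k' refl) s∣k = subst (r * s ∣_) (*-comm r k') (*-monoʳ-∣ r
        (coprime-divisor {s} {r} {k'} (λ (d , e) → cop (e , d)) (subst (s ∣_) (*-comm k' r) s∣k)))
      min : ∀ k → (x ℤ.* y) ℤ.^ k ≅ 1ℤ ⟨ N ⟩ → r * s ∣ k
      min k p = join {k} (half {x} {y} {r} {s} cop ox oy k p)
        (half {y} {x} {s} {r} (λ (d , e) → cop (e , d)) oy ox k
          (≅-trans (≅-reflexive (cong (ℤ._^ k) (ℤₚ.*-comm y x))) p))

    -- For exponent q itself: were n prime to q, a Bézout identity between natural numbers would
    -- give y = 1 without an inverse of y. In general this is applied to the power `q ^ suc α` of y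
    -- to split one factor q off n, and the induction continues with `y ^ q`.
    ord-prime-power : ∀ {y q} α → Prime q → y ℤ.^ (q ^ suc α) ≅ 1ℤ ⟨ N ⟩ →
                      ¬ y ℤ.^ (q ^ α) ≅ 1ℤ ⟨ N ⟩ → Ord N y (q ^ suc α)
    ord-prime-power {y} {q} α pr p np = record
      { positive = m^n>0 q {{prime⇒nonZero pr}} (suc α) ; power = p ; minimal = min α p np }
      where
      base : ∀ {y} → y ℤ.^ q ≅ 1ℤ ⟨ N ⟩ → ¬ y ≅ 1ℤ ⟨ N ⟩ → ∀ n → y ℤ.^ n ≅ 1ℤ ⟨ N ⟩ → q ∣ n
      base {y} p np n pn with q ∣? n
      ... | yes d = d
      ... | no ¬d = ⊥-elim (np (bez (Cop.coprime-Bézout (prime-coprime pr ¬d))))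
        where
        open import Data.Nat.GCD using (module Bézout)
        open Bézout
        go : ∀ a b m n → y ℤ.^ m ≅ 1ℤ ⟨ N ⟩ → y ℤ.^ n ≅ 1ℤ ⟨ N ⟩ → 1 + a * m ≡ b * n → y ≅ 1ℤ ⟨ N ⟩
        go a b m n pm pn eq = ≅-trans
          (≅-sym (≅-absorb y (^∣-≅ y m (a * m) pm (n∣m*n a))))
          (≅-trans (≅-reflexive (cong (y ℤ.^_) eq)) (^∣-≅ y n (b * n) pn (n∣m*n b)))
        bez : Identity 1 n q → y ≅ 1ℤ ⟨ N ⟩
        bez (+- a b eq) = go b a q n p pn eq
        bez (-+ a b eq) = go a b n q pn p eq
      min : ∀ {y} α → y ℤ.^ (q ^ suc α) ≅ 1ℤ ⟨ N ⟩ → ¬ y ℤ.^ (q ^ α) ≅ 1ℤ ⟨ N ⟩ →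
            ∀ n → y ℤ.^ n ≅ 1ℤ ⟨ N ⟩ → q ^ suc α ∣ n
      min {y} zero p np n pn = subst (_∣ n) (sym (*-identityʳ q))
        (base (subst (λ z → y ℤ.^ z ≅ 1ℤ ⟨ N ⟩) (*-identityʳ q) p)
          (λ e → np (≅-trans (≅-reflexive (ℤₚ.^-identityʳ y)) e)) n pn)
      min {y} (suc α) p np n pn with base {y ℤ.^ (q ^ suc α)}
            (≅-trans (≅-reflexive (trans (ℤₚ.^-*-assoc y (q ^ suc α) q) (cong (y ℤ.^_) (*-comm (q ^ suc α) q)))) p)
            np n
            (≅-trans (≅-reflexive (trans (ℤₚ.^-*-assoc y (q ^ suc α) n)
              (trans (cong (y ℤ.^_) (*-comm (q ^ suc α) n)) (sym (ℤₚ.^-*-assoc y n (q ^ suc α)))))) (1^-≅ (q ^ suc α) pn))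
      ... | divides n' refl = subst (q * q ^ suc α ∣_) (*-comm q n') (*-monoʳ-∣ q
        (min {y ℤ.^ q} α (≅-trans (≅-reflexive (ℤₚ.^-*-assoc y q _)) p)
          (λ e → np (≅-trans (≅-reflexive (sym (ℤₚ.^-*-assoc y q _))) e)) n'
          (≅-trans (≅-reflexive (trans (ℤₚ.^-*-assoc y q n') (cong (y ℤ.^_) (*-comm q n')))) pn)))

    -- Only the q-part of M changes: it is raised by the factor q that the order of c ^ M contributes.
    ord-extend : ∀ {g c q M₀ α} → Prime q → ¬ q ∣ M₀ → Ord N g (M₀ * q ^ α) →
                 ¬ c ℤ.^ (M₀ * q ^ α) ≅ 1ℤ ⟨ N ⟩ → (c ℤ.^ (M₀ * q ^ α)) ℤ.^ q ≅ 1ℤ ⟨ N ⟩ →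
                 Ord N (g ℤ.^ (q ^ α) ℤ.* c ℤ.^ M₀) (M₀ * q ^ α * q)
    ord-extend {g} {c} {q} {M₀} {α} pr q∤M₀ og nc pc = subst (Ord N _) eq
      (ord-* {r = M₀} {q ^ suc α} (Cop.sym (coprime-^ (suc α) (Cop.sym (prime-coprime pr q∤M₀))))
        (ord-^ {g} {M₀} {q ^ α} (n≢0⇒n>0 λ where refl → q∤M₀ (q ∣0)) (m^n>0 q {{prime⇒nonZero pr}} α) og)
        (ord-prime-power α pr
          (≅-trans (≅-reflexive (trans (ℤₚ.^-*-assoc c M₀ (q ^ suc α))
              (trans (cong (c ℤ.^_) eq) (sym (ℤₚ.^-*-assoc c (M₀ * q ^ α) q))))) pc)
          (λ e → nc (≅-trans (≅-reflexive (sym (ℤₚ.^-*-assoc c M₀ (q ^ α)))) e))))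
      where
      eq : M₀ * q ^ suc α ≡ M₀ * q ^ α * q
      eq = trans (cong (M₀ *_) (*-comm q (q ^ α))) (sym (*-assoc M₀ (q ^ α) q))

    prime-quotient : ∀ {x q m} → 1 < q → Ord N x (m * q) → (¬ x ℤ.^ m ≅ 1ℤ ⟨ N ⟩) × ((x ℤ.^ m) ℤ.^ q ≅ 1ℤ ⟨ N ⟩)
    prime-quotient {x} {q} {zero} 1<q o = ⊥-elim (<-irrefl refl (positive o))
    prime-quotient {x} {q} {m@(suc _)} 1<q o =
      (λ e → <⇒≱ (m<m*n m q 1<q) (∣⇒≤ (minimal o m e))) ,
      ≅-trans (≅-reflexive (ℤₚ.^-*-assoc x m q)) (power o)

-- Existence of orders, and the number of roots of unity modulo a prime.

module RootsOfUnity where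

  open import Defs using (Correct; element)
  open import Data.Fin.Base using (Fin; toℕ; fromℕ<)
  import Data.Fin.Properties as Finₚ
  open import Data.Integer.Base as ℤ using (ℤ; +_; 0ℤ; 1ℤ)
  import Data.Integer.Properties as ℤₚ
  import Data.Integer.Divisibility.Signed as ℤ∣
  open ℤ∣ using () renaming (_∣_ to _∣ᶻ_)
  open import Data.Integer.Solver using (module +-*-Solver)
  open import Data.List.Base using (List; []; _∷_; length; tabulate; _++_)
  open import Data.List.Properties using (length-tabulate; length-++)
  open import Data.List.Membership.Propositional using (_∈_)
  open import Data.List.Membership.Propositional.Properties using (∈-∃++; ∈-++⁺ˡ; ∈-++⁺ʳ; ∈-++⁻)
  open import Data.List.Relation.Unary.Any using (here; there)
  open import Data.List.Relation.Unary.All as All using (All; []; _∷_)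
  import Data.List.Relation.Unary.All.Properties as Allₚ
  open import Data.List.Relation.Unary.AllPairs using (AllPairs; []; _∷_)
  import Data.List.Relation.Unary.AllPairs.Properties as AllPairsₚ
  open import Data.List.Relation.Binary.Permutation.Propositional using (_↭_; ↭-sym; ↭-trans; prep; ↭-refl)
  open import Data.List.Relation.Binary.Permutation.Propositional.Properties using (shift)

  open import Data.Nat.Base hiding (_/_)
  open import Data.Nat.Coprimality using (Coprime)
  open import Data.Nat.Divisibility
  open import Data.Nat.DivMod
  open import Data.Nat.Primality
  open import Data.Nat.Properties
  open Congruences

  -- Upward search: the numbers from 1 to `k ∸ fuel` have already been excluded, and the fuel cannot
  -- run out before k is reached.
  least-positive : ∀ {P : ℕ → Set} → (∀ n → Dec (P n)) → ∀ k → 0 < k → P k →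
                   ∃[ r ] 0 < r × P r × (∀ e → 0 < e → e < r → ¬ P e)
  least-positive {P} P? k 0<k pk = go k (λ e 0<e e<1 → ⊥-elim (<⇒≱ 0<e (s≤s⁻¹ (subst (λ z → e < suc z) (n∸n≡0 k) e<1)))) ≤-refl
    where
    go : ∀ fuel → (∀ e → 0 < e → e < suc (k ∸ fuel) → ¬ P e) → fuel ≤ k →
         ∃[ r ] 0 < r × P r × (∀ e → 0 < e → e < r → ¬ P e)
    go zero    none _ = ⊥-elim (none k 0<k (n<1+n k) pk)
    go (suc f) none f≤k with P? (suc (k ∸ suc f))
    ... | yes p = suc (k ∸ suc f) , z<s , p , none
    ... | no ¬p = go f step (<⇒≤ f≤k)
      where
      step : ∀ e → 0 < e → e < suc (k ∸ f) → ¬ P e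
      step e 0<e e< pe with m≤n⇒m<n∨m≡n (s≤s⁻¹ (subst (λ z → e < suc z) (+-∸-assoc 1 f≤k) e<))
      ... | inj₁ lt   = none e 0<e lt pe
      ... | inj₂ refl = ¬p pe

  module _ {N : ℕ} .{{_ : NonZero N}} where

    -- Two of the N + 1 powers x ^ 0, ..., x ^ N agree modulo N, and the smaller one can be
    -- cancelled.
    positive-power : ∀ x → Coprime x N → ∃[ k ] 0 < k × (+ x) ℤ.^ k ≅ 1ℤ ⟨ N ⟩
    positive-power x cop with Finₚ.pigeonhole (n<1+n N) (λ (i : Fin (suc N)) → fromℕ< (m%n<n (x ^ toℕ i) N))
    ... | i , j , i<j , eq = toℕ j ∸ toℕ i , m<n⇒0<n∸m i<j ,
        ≅-sym (≅-cancelˡ ((+ x) ℤ.^ toℕ i) (coprime-^ᶻ {a = + x} (toℕ i) cop)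
          (≅-trans (≅-reflexive (ℤₚ.*-identityʳ _)) (≅-trans powers
            (≅-reflexive (trans (cong ((+ x) ℤ.^_) (sym (m+[n∸m]≡n (<⇒≤ i<j)))) (ℤₚ.^-distribˡ-+-* (+ x) (toℕ i) (toℕ j ∸ toℕ i)))))))
      where
      powers : (+ x) ℤ.^ toℕ i ≅ (+ x) ℤ.^ toℕ j ⟨ N ⟩
      powers = ≅-trans (≅-reflexive (sym (pos-^ x (toℕ i)))) (≅-trans (≅-sym (%-≅ (x ^ toℕ i)))
        (≅-trans (≅-reflexive (cong +_ (trans (sym (Finₚ.toℕ-fromℕ< _)) (trans (cong toℕ eq) (Finₚ.toℕ-fromℕ< _)))))
          (≅-trans (%-≅ (x ^ toℕ j)) (≅-reflexive (pos-^ x (toℕ j))))))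

    element-correct : ∀ {D x} → x < N → Coprime x N →
                      (∀ e → 0 < e → e ≤ D → ¬ (+ x) ℤ.^ e ≅ 1ℤ ⟨ N ⟩) → Correct D N (element x)
    element-correct {D} {x} x<N cop none = correct (order (positive-power x cop))
      where
      P : ℕ → Set
      P e = (+ x) ℤ.^ e ≅ 1ℤ ⟨ N ⟩
      Least : Set
      Least = ∃[ r ] 0 < r × P r × (∀ e → 0 < e → e < r → ¬ P e)
      order : ∃[ k ] 0 < k × P k → Least
      order (k , 0<k , pk) = least-positive (λ e → ≅? ((+ x) ℤ.^ e) 1ℤ) k 0<k pk
      correct : Least → Correct D N (element x)
      correct (r , 0<r , pr , least) = x<N , cop , r ,
        (0<r , ≅⇒∣-∣ {N} {x ^ r} {1} (≅-trans (≅-reflexive (pos-^ x r)) pr) ,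
          λ j 0<j d → ≮⇒≥ λ j<r → least j 0<j j<r (≅-trans (≅-reflexive (sym (pos-^ x j))) (∣-∣⇒≅ {N} {x ^ j} {1} d))) ,
        ≰⇒> λ r≤D → none r 0<r r≤D pr

    ord⇒element-correct : ∀ {D x r} → x < N → Ord N (+ x) r → D < r → Correct D N (element x)
    ord⇒element-correct {D} {x} {r} x<N o D<r = element-correct x<N (^≅1⇒coprime {a = + x} (positive o) (power o))
      λ { e@(suc _) _ e≤D p → <⇒≱ (≤-<-trans e≤D D<r) (∣⇒≤ (minimal o e p)) }

  -- Deg n c f: f is a polynomial function of degree at most n with c as
  -- the coefficient of degree n, expressed through its difference quotients.
  Deg : ℕ → ℤ → (ℤ → ℤ) → Set
  Deg zero    c f = ∀ x → f x ≡ c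
  Deg (suc n) c f = ∀ r → Σ[ g ∈ (ℤ → ℤ) ] (∀ x → f x ℤ.- f r ≡ (x ℤ.- r) ℤ.* g x) × Deg n c g

  Deg-+ : ∀ n {c d f g} → Deg n c f → Deg n d g → Deg n (c ℤ.+ d) (λ x → f x ℤ.+ g x)
  Deg-+ zero    p q x = cong₂ ℤ._+_ (p x) (q x)
  Deg-+ (suc n) {f = f} {g} p q r with p r | q r
  ... | f′ , ef , df | g′ , eg , dg = _ , (λ x → trans (lem (f x) (g x) (f r) (g r))
        (trans (cong₂ ℤ._+_ (ef x) (eg x)) (sym (ℤₚ.*-distribˡ-+ (x ℤ.- r) (f′ x) (g′ x))))) , Deg-+ n {f = f′} {g′} df dg
    where
    lem : ∀ a b c d → a ℤ.+ b ℤ.- (c ℤ.+ d) ≡ (a ℤ.- c) ℤ.+ (b ℤ.- d)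
    lem = solve 4 (λ a b c d → a :+ b :- (c :+ d) := (a :- c) :+ (b :- d)) refl where open +-*-Solver

  Deg-*ᶜ : ∀ n k {c f} → Deg n c f → Deg n (k ℤ.* c) (λ x → k ℤ.* f x)
  Deg-*ᶜ zero    k p x = cong (k ℤ.*_) (p x)
  Deg-*ᶜ (suc n) k {f = f} p r with p r
  ... | g , eq , dg = _ , (λ x → trans (lem k (f x) (f r)) (trans (cong (k ℤ.*_) (eq x)) (lem₂ k (x ℤ.- r) (g x)))) , Deg-*ᶜ n k {f = g} dg
    where
    open +-*-Solver
    lem : ∀ k a b → k ℤ.* a ℤ.- k ℤ.* b ≡ k ℤ.* (a ℤ.- b)
    lem = solve 3 (λ k a b → k :* a :- k :* b := k :* (a :- b)) refl
    lem₂ : ∀ k a b → k ℤ.* (a ℤ.* b) ≡ a ℤ.* (k ℤ.* b)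
    lem₂ = solve 3 (λ k a b → k :* (a :* b) := a :* (k :* b)) refl

  Deg-weaken : ∀ n {c f} → Deg n c f → Deg (suc n) 0ℤ f
  Deg-weaken zero {c} p r = (λ _ → 0ℤ) , (λ x → trans (cong₂ ℤ._-_ (p x) (p r)) (trans (ℤₚ.+-inverseʳ c) (sym (ℤₚ.*-zeroʳ (x ℤ.- r))))) , λ _ → refl
  Deg-weaken (suc n) p r with p r
  ... | g , eq , dg = g , eq , Deg-weaken n {f = g} dg

  -- Product rule: the difference quotient of x f(x) at r is f(x) + r g(x), with g that of f. The
  -- second summand has lower degree, so the leading coefficient is that of f.
  Deg-x* : ∀ n {c f} → Deg n c f → Deg (suc n) c (λ x → x ℤ.* f x)
  Deg-x* zero {f = f} p r = f , (λ x → trans (cong (λ z → x ℤ.* f x ℤ.- r ℤ.* z) (trans (p r) (sym (p x)))) (lem x r (f x))) , p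
    where
    lem : ∀ x r a → x ℤ.* a ℤ.- r ℤ.* a ≡ (x ℤ.- r) ℤ.* a
    lem = solve 3 (λ x r a → x :* a :- r :* a := (x :- r) :* a) refl where open +-*-Solver
  Deg-x* (suc n) {c} {f} p r with p r
  ... | g , eq , dg = (λ x → f x ℤ.+ r ℤ.* g x) ,
      (λ x → trans (lem x r (f x) (f r)) (trans (cong (λ z → (x ℤ.- r) ℤ.* f x ℤ.+ r ℤ.* z) (eq x)) (lem₂ x r (f x) (g x)))) ,
      subst (λ z → Deg (suc n) z (λ x → f x ℤ.+ r ℤ.* g x)) (ℤₚ.+-identityʳ c) (Deg-+ (suc n) {f = f} {λ x → r ℤ.* g x} p (Deg-weaken n {f = λ x → r ℤ.* g x} (Deg-*ᶜ n r {f = g} dg)))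
    where
    open +-*-Solver
    lem : ∀ x r a b → x ℤ.* a ℤ.- r ℤ.* b ≡ (x ℤ.- r) ℤ.* a ℤ.+ r ℤ.* (a ℤ.- b)
    lem = solve 4 (λ x r a b → x :* a :- r :* b := (x :- r) :* a :+ r :* (a :- b)) refl
    lem₂ : ∀ x r a b → (x ℤ.- r) ℤ.* a ℤ.+ r ℤ.* ((x ℤ.- r) ℤ.* b) ≡ (x ℤ.- r) ℤ.* (a ℤ.+ r ℤ.* b)
    lem₂ = solve 4 (λ x r a b → (x :- r) :* a :+ r :* ((x :- r) :* b) := (x :- r) :* (a :+ r :* b)) refl

  Deg-^ : ∀ n → Deg n 1ℤ (ℤ._^ n)
  Deg-^ zero    x = refl
  Deg-^ (suc n) = Deg-x* n {f = ℤ._^ n} (Deg-^ n)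

  Deg-const : ∀ n c → Deg (suc n) 0ℤ (λ _ → c)
  Deg-const zero    c = Deg-weaken 0 {c} {λ _ → c} λ _ → refl
  Deg-const (suc n) c = Deg-weaken (suc n) {f = λ _ → c} (Deg-const n c)

  Deg-unity : ∀ {n} → 0 < n → Deg n 1ℤ (λ x → x ℤ.^ n ℤ.- 1ℤ)
  Deg-unity {suc n} _ = Deg-+ (suc n) {f = ℤ._^ suc n} {λ _ → ℤ.- 1ℤ} (Deg-^ (suc n)) (Deg-const n (ℤ.- 1ℤ))

  module _ {p : ℕ} (pr : Prime p) where

    euclidᶻ : ∀ a b → + p ∣ᶻ a ℤ.* b → ¬ + p ∣ᶻ a → + p ∣ᶻ b
    euclidᶻ a b d ¬a with euclidsLemma ℤ.∣ a ∣ ℤ.∣ b ∣ pr (subst (p ∣_) (ℤₚ.abs-* a b) (∣ᶻ⇒∣ d))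
    ... | inj₁ p∣a = ⊥-elim (¬a (∣⇒∣ᶻ p∣a))
    ... | inj₂ p∣b = ∣⇒∣ᶻ p∣b

    -- Any further root s of f is a root of the difference quotient at r, because p does not divide
    -- s - r; and this quotient has the same leading coefficient.
    lagrange : ∀ n {c f} → Deg n c f → ¬ + p ∣ᶻ c → ∀ rs → AllPairs (λ a b → ¬ a ≅ b ⟨ p ⟩) rs →
               All (λ r → + p ∣ᶻ f r) rs → length rs ≤ n
    lagrange n deg ¬c [] _ _ = z≤n
    lagrange zero deg ¬c (r ∷ rs) _ (pr ∷ _) = ⊥-elim (¬c (subst (+ p ∣ᶻ_) (deg r) pr))
    lagrange (suc n) {f = f} deg ¬c (r ∷ rs) (r≉ ∷ distinct) (p∣fr ∷ roots) with deg r
    ... | g , eq , dg = s≤s (lagrange n {f = g} dg ¬c rs distinct (All.zipWith quot (r≉ , roots)))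
      where
      quot : ∀ {s} → (¬ r ≅ s ⟨ p ⟩) × + p ∣ᶻ f s → + p ∣ᶻ g s
      quot {s} (r≉s , p∣fs) = euclidᶻ (s ℤ.- r) (g s)
        (subst (+ p ∣ᶻ_) (eq s) (ℤ∣.∣m∣n⇒∣m-n p∣fs p∣fr)) λ d → r≉s (≅-sym (mk≅ d))

    roots-of-unity : ∀ {M} → 0 < M → ∀ {k} (f : Fin k → ℤ) → (∀ i → f i ℤ.^ M ≅ 1ℤ ⟨ p ⟩) →
                     (∀ {i j} → i ≢ j → ¬ f i ≅ f j ⟨ p ⟩) → k ≤ M
    roots-of-unity {M} 0<M f root inj = subst (_≤ M) (length-tabulate f)
      (lagrange M {f = λ x → x ℤ.^ M ℤ.- 1ℤ} (Deg-unity 0<M) (λ d → p∤1 (∣ᶻ⇒∣ d)) (tabulate f) (AllPairsₚ.tabulate⁺ inj)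
        (Allₚ.tabulate⁺ (λ i → divides-diff (root i))))
      where
      p∤1 : ¬ p ∣ 1
      p∤1 d with ∣1⇒≡1 d
      ... | refl = ¬prime[1] pr

  -- An injective map of a finite set to itself permutes it; stated for lists, so that the products
  -- of the two lists can be compared.
  distinct-sublist⇒↭ : ∀ {A : Set} (xs ys : List A) → AllPairs _≢_ xs → (∀ {z} → z ∈ xs → z ∈ ys) →
                       length ys ≤ length xs → xs ↭ ys
  distinct-sublist⇒↭ []       []       _ _ _ = ↭-refl
  distinct-sublist⇒↭ (x ∷ xs) ys (x∉ ∷ un) sub len with ∈-∃++ (sub (here refl))
  ... | as , bs , refl = ↭-trans (prep x (distinct-sublist⇒↭ xs (as ++ bs) un sub′ len′)) (↭-sym (shift x as bs))
    where
    sub′ : ∀ {z} → z ∈ xs → z ∈ as ++ bs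
    sub′ {z} z∈ with ∈-++⁻ as (sub (there z∈))
    ... | inj₁ i = ∈-++⁺ˡ i
    ... | inj₂ (here refl) = ⊥-elim (All.lookup x∉ z∈ refl)
    ... | inj₂ (there i) = ∈-++⁺ʳ as i
    len′ : length (as ++ bs) ≤ length xs
    len′ = s≤s⁻¹ (subst (_≤ suc (length xs)) (trans (length-++ as) (trans (+-suc (length as) (length bs))
      (cong suc (sym (length-++ as))))) len)

-- Fermat's little theorem and the exponents of the unit group.

module Fermat where

  open import Data.Fin.Base as Fin using (Fin; toℕ; fromℕ<)
  import Data.Fin.Properties as Finₚ
  open import Data.Integer.Base as ℤ using (ℤ; +_; 1ℤ)
  import Data.Integer.Properties as ℤₚ
  open import Data.Integer.Solver using (module +-*-Solver)
  open import Data.List.Base using (List; []; _∷_; tabulate)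
  open import Data.List.Properties using (length-tabulate)
  open import Data.List.Membership.Propositional using (_∈_)
  open import Data.List.Membership.Propositional.Properties using (∈-tabulate⁺; ∈-tabulate⁻)

  open import Data.List.Relation.Unary.All using (All; []; _∷_)
  import Data.List.Relation.Unary.All.Properties as Allₚ
  import Data.List.Relation.Unary.AllPairs.Properties as AllPairsₚ
  open import Data.Nat.ListAction.Properties using (product-↭)
  open import Data.Nat.ListAction using (product)
  open import Data.Nat.Base hiding (_/_)
  open import Data.Nat.Coprimality as Cop using (Coprime)
  open import Data.Nat.Divisibility
  open import Data.Nat.DivMod
  open import Data.Nat.Primality
  open import Data.Nat.Properties

  open Congruences
  open RootsOfUnity

  module _ {n : ℕ} (pr : Prime (suc n)) where
    private
      p : ℕ
      p = suc n

    small-coprime : ∀ {a} → 0 < a → a < p → Coprime a p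
    small-coprime {suc a} _ a<p = Cop.sym (Cop.prime⇒coprime pr a<p)

    module _ {c : ℕ} (cop : Coprime c p) where
      private
        f : Fin n → ℕ
        f i = c * suc (toℕ i) % p

        f≅ : ∀ i → + f i ≅ + c ℤ.* + suc (toℕ i) ⟨ p ⟩
        f≅ i = ≅-trans (%-≅ (c * suc (toℕ i))) (≅-reflexive (ℤₚ.pos-* c (suc (toℕ i))))

        f-injective : ∀ {i j} → f i ≡ f j → i ≡ j
        f-injective {i} {j} eq = Finₚ.toℕ-injective (suc-injective (≅⇒≡ {p}
          (≅-cancelˡ (+ c) cop (≅-trans (≅-sym (f≅ i)) (≅-trans (≅-reflexive (cong +_ eq)) (f≅ j))))
          (s<s (Finₚ.toℕ<n i)) (s<s (Finₚ.toℕ<n j))))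

        0<f : ∀ i → 0 < f i
        0<f i = n≢0⇒n>0 λ eq → <⇒≢ (prime>1) (sym (coprime-* cop (small-coprime z<s (s<s (Finₚ.toℕ<n i)))
                  (m%n≡0⇒n∣m _ p eq , ∣-refl)))
          where
          prime>1 : 1 < p
          prime>1 = nonTrivial⇒n>1 p {{prime⇒nonTrivial pr}}

        units : List ℕ
        units = tabulate {n = n} (λ i → suc (toℕ i))

        f∈units : ∀ {z} → z ∈ tabulate f → z ∈ units
        f∈units z∈ with ∈-tabulate⁻ z∈
        ... | i , refl = subst (_∈ units) eq (∈-tabulate⁺ {f = λ i → suc (toℕ i)} (fromℕ< lt))
          where
          lt : f i ∸ 1 < n
          lt = ≤-<-trans (≤-reflexive refl) (s<s⁻¹ (subst (_< p) (sym (m+[n∸m]≡n (0<f i))) (m%n<n (c * suc (toℕ i)) p)))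
          eq : suc (toℕ (fromℕ< lt)) ≡ f i
          eq = trans (cong suc (Finₚ.toℕ-fromℕ< lt)) (m+[n∸m]≡n (0<f i))

        product-f : ∀ k (g : Fin k → ℕ) (h : Fin k → ℕ) → (∀ i → + h i ≅ + c ℤ.* + g i ⟨ p ⟩) →
                    + product (tabulate h) ≅ (+ c) ℤ.^ k ℤ.* + product (tabulate g) ⟨ p ⟩
        product-f zero    g h eq = ≅-refl
        product-f (suc k) g h eq = ≅-trans (≅-reflexive (ℤₚ.pos-* (h Fin.zero) _))
          (≅-trans (≅-* (eq Fin.zero) (product-f k (λ i → g (Fin.suc i)) (λ i → h (Fin.suc i)) (λ i → eq (Fin.suc i))))
          (≅-reflexive (trans (lem (+ c) (+ g Fin.zero) ((+ c) ℤ.^ k) (+ P))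
            (cong ((+ c) ℤ.^ suc k ℤ.*_) (sym (ℤₚ.pos-* (g Fin.zero) P))))))
          where
          P : ℕ
          P = product (tabulate (λ i → g (Fin.suc i)))
          lem : ∀ c g ck P → c ℤ.* g ℤ.* (ck ℤ.* P) ≡ c ℤ.* ck ℤ.* (g ℤ.* P)
          lem = solve 4 (λ c g ck P → c :* g :* (ck :* P) := c :* ck :* (g :* P)) refl where open +-*-Solver

        coprime-product : ∀ xs → All (λ x → Coprime x p) xs → Coprime (product xs) p
        coprime-product []       _        = Cop.1-coprimeTo p
        coprime-product (x ∷ xs) (c ∷ cs) = coprime-* c (coprime-product xs cs)

      -- Multiplication by c permutes the nonzero residues. Their product thus gains the factor c ^
      -- n, and being coprime to p it can be cancelled.
      fermat : (+ c) ℤ.^ n ≅ 1ℤ ⟨ p ⟩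
      fermat = ≅-cancelˡ (+ product units) (coprime-product units (Allₚ.tabulate⁺ λ i → small-coprime z<s (s<s (Finₚ.toℕ<n i))))
        (≅-trans (≅-reflexive (ℤₚ.*-comm (+ product units) ((+ c) ℤ.^ n)))
        (≅-trans (≅-sym (product-f n (λ i → suc (toℕ i)) f f≅))
        (≅-reflexive (trans (cong +_ (product-↭ (distinct-sublist⇒↭ (tabulate f) units
            (AllPairsₚ.tabulate⁺ (λ i≢j eq → i≢j (f-injective eq))) f∈units
            (≤-reflexive (trans (length-tabulate {n = n} (λ i → suc (toℕ i))) (sym (length-tabulate f)))))))
          (sym (ℤₚ.*-identityʳ (+ product units)))))))

    -- If every unit is a root of X ^ M - 1, then so it is of X ^ (M % n) - 1, which has too few roots unless n divides M.
    exponent-divisible : ∀ {M} → (∀ c → 0 < c → c < p → (+ c) ℤ.^ M ≅ 1ℤ ⟨ p ⟩) → n ∣ M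
    exponent-divisible {M} all = go n refl
      where
      go : ∀ k → k ≡ n → n ∣ M
      go zero refl = ⊥-elim (¬prime[1] pr)
      go n′@(suc _) refl with M % n in eq
      ... | zero  = m%n≡0⇒n∣m M n eq
      ... | suc e = ⊥-elim (<⇒≱ (subst (_< n) eq (m%n<n M n)) (roots-of-unity pr z<s (λ (i : Fin n) → + suc (toℕ i)) root distinct))
        where
        root : ∀ i → (+ suc (toℕ i)) ℤ.^ suc e ≅ 1ℤ ⟨ p ⟩
        root i = ≅-trans (≅-sym (≅-absorb (x ℤ.^ suc e) (^∣-≅ x n (M / n * n)
            (fermat (small-coprime z<s (s<s (Finₚ.toℕ<n i)))) (divides (M / n) refl))))
          (≅-trans (≅-reflexive (trans (sym (ℤₚ.^-distribˡ-+-* x (suc e) (M / n * n)))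
            (cong (x ℤ.^_) (sym (trans (m≡m%n+[m/n]*n M n) (cong (_+ M / n * n) eq))))))
            (all (suc (toℕ i)) z<s (s<s (Finₚ.toℕ<n i))))
          where
          x : ℤ
          x = + suc (toℕ i)
        distinct : ∀ {i j : Fin n} → i ≢ j → ¬ + suc (toℕ i) ≅ + suc (toℕ j) ⟨ p ⟩
        distinct {i} {j} i≢j c = i≢j (Finₚ.toℕ-injective (suc-injective
          (≅⇒≡ c (s<s (Finₚ.toℕ<n i)) (s<s (Finₚ.toℕ<n j)))))

-- Prime divisors modulo which all small integers are roots of unity.

module PrimeDivisors where

  open import Data.Fin.Base as Fin using (Fin; toℕ; fromℕ<; combine; remQuot)
  import Data.Fin.Properties as Finₚ
  open import Data.Integer.Base as ℤ using (ℤ; +_; 0ℤ; 1ℤ)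
  import Data.Integer.Properties as ℤₚ
  import Data.Integer.Divisibility.Signed as ℤ∣
  open ℤ∣ using () renaming (_∣_ to _∣ᶻ_)
  open import Data.Integer.Solver using (module +-*-Solver)

  open import Data.Nat.Base hiding (_/_)
  open import Data.Nat.Coprimality as Cop using (Coprime; coprime-divisor)
  open import Data.Nat.Divisibility
  open import Data.Nat.DivMod
  open import Data.Nat.GCD using (gcd; gcd[m,n]∣m; gcd[m,n]∣n)
  open import Data.Nat.Primality
  open import Data.Nat.Properties
  import Data.Nat.Solver
  module ℕS = Data.Nat.Solver.+-*-Solver

  open Congruences
  open RootsOfUnity
  open Fermat

  -- This is why the exponent is written `2 * h` throughout: the differences in Thue's lemma come
  -- with unknown signs.
  even-^ : ∀ d h → d ℤ.^ (2 * h) ≡ (+ ℤ.∣ d ∣) ℤ.^ (2 * h)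
  even-^ (+ a)        h = refl
  even-^ ℤ.-[1+ a ] h = begin
    d ℤ.^ (2 * h)         ≡⟨ ℤₚ.^-*-assoc d 2 h ⟨
    (d ℤ.^ 2) ℤ.^ h       ≡⟨ cong (ℤ._^ h) (lem (+ suc a)) ⟩
    ((+ suc a) ℤ.^ 2) ℤ.^ h ≡⟨ ℤₚ.^-*-assoc (+ suc a) 2 h ⟩
    (+ suc a) ℤ.^ (2 * h) ∎
    where
    open ≡-Reasoning
    d = ℤ.-[1+ a ]
    lem : ∀ x → (ℤ.- x) ℤ.* (ℤ.- x ℤ.* 1ℤ) ≡ x ℤ.* (x ℤ.* 1ℤ)
    lem = solve 1 (λ x → (:- x) :* (:- x :* con 1ℤ) := x :* (x :* con 1ℤ)) refl where open +-*-Solver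

  ∣+-+∣≤ : ∀ {a b B} → a ≤ B → b ≤ B → ℤ.∣ + a ℤ.- + b ∣ ≤ B
  ∣+-+∣≤ {a} {b} a≤ b≤ = ≤-trans (≤-reflexive (cong ℤ.∣_∣ (ℤₚ.[+m]-[+n]≡m⊖n a b))) (≤-trans (ℤₚ.∣m⊝n∣≤m⊔n a b) (⊔-lub a≤ b≤))

  SmallRoots : ℕ → ℕ → ℕ → Set
  SmallRoots p B M = ∀ a → 0 < a → a ≤ B → (+ a) ℤ.^ M ≅ 1ℤ ⟨ p ⟩

  module _ {n : ℕ} (pr : Prime (suc n)) {B h : ℕ} (0<h : 0 < h) (roots : SmallRoots (suc n) B (2 * h)) where
    private
      p : ℕ
      p = suc n

    -- A root of unity is coprime to p. In particular B < p, which excludes the degenerate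
    -- coincidences in Thue's lemma.
    small-∤ : ∀ {a} → 0 < a → a ≤ B → ¬ p ∣ a
    small-∤ {a} 0<a a≤B d with ^≅1⇒coprime {p} {+ a} {2 * h} (*-mono-≤ (z<s {1}) 0<h) (roots a 0<a a≤B) (d , ∣-refl)
    ... | refl = ¬prime[1] pr

    signed-root : ∀ d → 0 < ℤ.∣ d ∣ → ℤ.∣ d ∣ ≤ B → d ℤ.^ (2 * h) ≅ 1ℤ ⟨ p ⟩
    signed-root d 0<d d≤B = ≅-trans (≅-reflexive (even-^ d h)) (roots ℤ.∣ d ∣ 0<d d≤B)

    -- Thue's lemma: by the pigeonhole principle c is, up to sign, a quotient of two integers in [1, B].
    thue-root : p < suc B * suc B → ∀ c → 0 < c → c < p → (+ c) ℤ.^ (2 * h) ≅ 1ℤ ⟨ p ⟩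
    thue-root p<B² c 0<c c<p = found (Finₚ.pigeonhole p<B² (λ i → fromℕ< (m%n<n (val i) p)))
      where
      X Y val : Fin (suc B * suc B) → ℕ
      X i = toℕ (proj₁ (remQuot {suc B} (suc B) i))
      Y i = toℕ (proj₂ (remQuot {suc B} (suc B) i))
      -- As n = p - 1, this is c Y - X modulo p, written without subtraction.
      val i = c * Y i + n * X i
      X≤ : ∀ i → X i ≤ B
      X≤ i = s≤s⁻¹ (Finₚ.toℕ<n (proj₁ (remQuot {suc B} (suc B) i)))
      Y≤ : ∀ i → Y i ≤ B
      Y≤ i = s≤s⁻¹ (Finₚ.toℕ<n (proj₂ (remQuot {suc B} (suc B) i)))
      XY-injective : ∀ {i j} → X i ≡ X j → Y i ≡ Y j → i ≡ j
      XY-injective {i} {j} ex ey = trans (sym (Finₚ.combine-remQuot {suc B} (suc B) i))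
        (trans (cong₂ combine (Finₚ.toℕ-injective ex) (Finₚ.toℕ-injective ey)) (Finₚ.combine-remQuot {suc B} (suc B) j))
      found : ∃[ i ] ∃[ j ] (i Fin.< j × fromℕ< (m%n<n (val i) p) ≡ fromℕ< (m%n<n (val j) p)) →
              (+ c) ℤ.^ (2 * h) ≅ 1ℤ ⟨ p ⟩
      found (i , j , i<j , eq) = conclude ℤ.∣ δx ∣ ℤ.∣ δy ∣ refl refl
        where
        δx δy : ℤ
        δx = + X i ℤ.- + X j
        δy = + Y i ℤ.- + Y j
        pos-val : ∀ i → + val i ≡ + c ℤ.* + Y i ℤ.+ + n ℤ.* + X i
        pos-val i = trans (ℤₚ.pos-+ (c * Y i) (n * X i)) (cong₂ ℤ._+_ (ℤₚ.pos-* c (Y i)) (ℤₚ.pos-* n (X i)))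
        vals : + val i ≅ + val j ⟨ p ⟩
        vals = ≅-trans (≅-sym (%-≅ (val i))) (≅-trans (≅-reflexive (cong +_
          (trans (sym (Finₚ.toℕ-fromℕ< _)) (trans (cong toℕ eq) (Finₚ.toℕ-fromℕ< _))))) (%-≅ (val j)))
        ring : ∀ c n x y x′ y′ → c ℤ.* y ℤ.+ n ℤ.* x ℤ.- (c ℤ.* y′ ℤ.+ n ℤ.* x′) ℤ.- (x ℤ.- x′) ℤ.* (1ℤ ℤ.+ n)
               ≡ c ℤ.* (y ℤ.- y′) ℤ.- (x ℤ.- x′)
        ring = solve 6 (λ c n x y x′ y′ → c :* y :+ n :* x :- (c :* y′ :+ n :* x′) :- (x :- x′) :* (con 1ℤ :+ n)
               := c :* (y :- y′) :- (x :- x′)) refl where open +-*-Solver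
        main : + c ℤ.* δy ≅ δx ⟨ p ⟩
        main = mk≅ (subst (+ p ∣ᶻ_) (trans (cong (ℤ._- δx ℤ.* + p) (cong₂ ℤ._-_ (pos-val i) (pos-val j)))
            (ring (+ c) (+ n) (+ X i) (+ Y i) (+ X j) (+ Y j)))
          (ℤ∣.∣m∣n⇒∣m-n (divides-diff vals) (ℤ∣.∣n⇒∣m*n δx ℤ∣.∣-refl)))
        ∣-0 : ∀ a → + p ∣ᶻ a ℤ.- 0ℤ → + p ∣ᶻ a
        ∣-0 a = subst (+ p ∣ᶻ_) (ℤₚ.+-identityʳ a)
        p∣δx : ℤ.∣ δy ∣ ≡ 0 → p ∣ ℤ.∣ δx ∣
        p∣δx e = ∣ᶻ⇒∣ (∣-0 δx (divides-diff (≅-trans (≅-sym main)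
          (≅-reflexive (trans (cong (+ c ℤ.*_) (ℤₚ.∣i∣≡0⇒i≡0 e)) (ℤₚ.*-zeroʳ (+ c)))))))
        p∣δy : ℤ.∣ δx ∣ ≡ 0 → p ∣ ℤ.∣ δy ∣
        p∣δy e = ∣ᶻ⇒∣ (∣-0 δy (divides-diff (≅-cancelˡ (+ c) (small-coprime pr 0<c c<p)
          (≅-trans main (≅-reflexive (trans (ℤₚ.∣i∣≡0⇒i≡0 e) (sym (ℤₚ.*-zeroʳ (+ c)))))))))
        ∣-∣≡0 : ∀ a b → ℤ.∣ + a ℤ.- + b ∣ ≡ 0 → a ≡ b
        ∣-∣≡0 a b e = ℤₚ.+-injective (ℤₚ.i-j≡0⇒i≡j (+ a) (+ b) (ℤₚ.∣i∣≡0⇒i≡0 e))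
        conclude : ∀ a b → ℤ.∣ δx ∣ ≡ a → ℤ.∣ δy ∣ ≡ b → (+ c) ℤ.^ (2 * h) ≅ 1ℤ ⟨ p ⟩
        -- If exactly one difference vanishes, p divides the other, which is nonzero and at most B
        -- in absolute value. If both vanish, the two pairs coincide.
        conclude zero zero ex ey = ⊥-elim (Finₚ.<⇒≢ i<j (XY-injective (∣-∣≡0 (X i) (X j) ex) (∣-∣≡0 (Y i) (Y j) ey)))
        conclude (suc a) zero ex ey = ⊥-elim (small-∤ (subst (0 <_) (sym ex) z<s) (∣+-+∣≤ (X≤ i) (X≤ j)) (p∣δx ey))
        conclude zero (suc b) ex ey = ⊥-elim (small-∤ (subst (0 <_) (sym ey) z<s) (∣+-+∣≤ (Y≤ i) (Y≤ j)) (p∣δy ex))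
        conclude (suc a) (suc b) ex ey = ≅-trans (≅-sym (≅-absorb ((+ c) ℤ.^ (2 * h)) (signed-root δy (subst (0 <_) (sym ey) z<s) (∣+-+∣≤ (Y≤ i) (Y≤ j)))))
          (≅-trans (≅-reflexive (sym (^ᶻ-distribʳ-* (+ c) δy (2 * h)))) (≅-trans (≅-^ (2 * h) main)
            (signed-root δx (subst (0 <_) (sym ex) z<s) (∣+-+∣≤ (X≤ i) (X≤ j)))))

  -- x′ / y′ is x / y in lowest terms, and num / den is the g-th fraction after u₀ / v₀ among those of
  -- determinant 1 with x′ / y′.  It is reduced, and x′, y′ and g can be read off it; so K² pairs (x , y)
  -- with entries up to K give K² distinct fractions with entries up to 2 K.
  record Neighbour (x y : ℕ) : Set where
    field
      g x′ y′ u₀ v₀ : ℕ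
      x≡      : x ≡ x′ * g
      y≡      : y ≡ y′ * g
      0<g     : 0 < g
      0<x′    : 0 < x′
      0<u₀    : 0 < u₀
      u₀≤x′   : u₀ ≤ x′
      v₀≤y′   : v₀ ≤ y′
      det₀    : u₀ * y′ ≡ 1 + v₀ * x′

    num den : ℕ
    num = u₀ + x′ * g
    den = v₀ + y′ * g

    det : num * y′ ≡ 1 + den * x′
    det = trans (lem u₀ x′ g y′) (trans (cong (_+ x′ * g * y′) det₀) (lem₂ v₀ x′ g y′))
      where
      lem : ∀ u x g y → (u + x * g) * y ≡ u * y + x * g * y
      lem u x g y = *-distribʳ-+ y u (x * g)
      lem₂ : ∀ v x g y → 1 + v * x + x * g * y ≡ 1 + (v + y * g) * x
      lem₂ = ℕS.solve 4 (λ v x g y → ℕS.con 1 ℕS.:+ v ℕS.:* x ℕS.:+ x ℕS.:* g ℕS.:* y ℕS.:= ℕS.con 1 ℕS.:+ (v ℕS.:+ y ℕS.:* g) ℕS.:* x) refl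

    coprime-uv : Coprime num den
    coprime-uv {d} (d∣u , d∣v) = ∣1⇒≡1 (∣m+n∣m⇒∣n (subst (d ∣_) (trans det (+-comm 1 (den * x′))) (∣m⇒∣m*n y′ d∣u)) (∣m⇒∣m*n x′ d∣v))

    x′<u : x′ < num
    x′<u = ≤-trans (s≤s (m≤m*n x′ g {{>-nonZero 0<g}})) (+-monoˡ-≤ (x′ * g) 0<u₀)

  -- u is the inverse of y modulo x, obtained as a power of y. Modulo x = 1 the residue of `u * y`
  -- would be 0 instead of 1, so that case is treated by hand.
  bezout : ∀ x y → 0 < x → 0 < y → Coprime y x →
           ∃[ u ] ∃[ v ] 0 < u × u ≤ x × v ≤ y × u * y ≡ 1 + v * x
  bezout 1 (suc y) _ _ _ = 1 , y , z<s , ≤-refl , n≤1+n y , trans (*-identityˡ (suc y)) (cong suc (sym (*-identityʳ y)))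
  bezout x@(suc (suc _)) y _ 0<y cop = go (positive-power {x} y cop)
    where
    go : ∃[ k ] 0 < k × (+ y) ℤ.^ k ≅ 1ℤ ⟨ x ⟩ → ∃[ u ] ∃[ v ] 0 < u × u ≤ x × v ≤ y × u * y ≡ 1 + v * x
    go (suc k , _ , p) = u , u * y / x , 0<u , <⇒≤ u<x , v≤y , eq
      where
      u : ℕ
      u = y ^ k % x
      u<x : u < x
      u<x = m%n<n (y ^ k) x
      inverse : + (u * y % x) ≅ + 1 ⟨ x ⟩
      inverse = ≅-trans (%-≅ (u * y)) (≅-trans (≅-reflexive (trans (ℤₚ.pos-* u y) (ℤₚ.*-comm (+ u) (+ y))))
        (≅-trans (≅-* (≅-refl {a = + y}) (≅-trans (%-≅ (y ^ k)) (≅-reflexive (pos-^ y k)))) p))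
      eq : u * y ≡ 1 + u * y / x * x
      eq = trans (m≡m%n+[m/n]*n (u * y) x) (cong (_+ u * y / x * x) (≅⇒≡ inverse (m%n<n (u * y) x) (s<s z<s)))
      0<u : 0 < u
      0<u = n≢0⇒n>0 λ u≡0 → 0≢1+n (trans (sym (cong (_* y) u≡0)) eq)
      v≤y : u * y / x ≤ y
      v≤y = *-cancelʳ-≤ (u * y / x) y x (≤-trans (n≤1+n _) (≤-trans (≤-reflexive (sym eq))
        (≤-trans (*-monoˡ-≤ y (<⇒≤ u<x)) (≤-reflexive (*-comm x y)))))

  neighbour : ∀ x y → 0 < x → 0 < y → Neighbour x y
  neighbour x y 0<x 0<y = build (bezout (x / d) (y / d) 0<x′ 0<y′ (Cop.sym (Cop.coprime-/gcd x y)))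
    where
    d : ℕ
    d = gcd x y
    instance
      d≢0 : NonZero d
      d≢0 = ≢-nonZero λ e → <⇒≢ 0<x (sym (0∣⇒≡0 (subst (_∣ x) e (gcd[m,n]∣m x y))))
    0<x′ : 0 < x / d
    0<x′ = m≥n⇒m/n>0 (∣⇒≤ {{>-nonZero 0<x}} (gcd[m,n]∣m x y))
    0<y′ : 0 < y / d
    0<y′ = m≥n⇒m/n>0 (∣⇒≤ {{>-nonZero 0<y}} (gcd[m,n]∣n x y))
    build : ∃[ u ] ∃[ v ] 0 < u × u ≤ x / d × v ≤ y / d × u * (y / d) ≡ 1 + v * (x / d) → Neighbour x y
    build (u , v , 0<u , u≤ , v≤ , eq) = record
      { g = d ; x′ = x / d ; y′ = y / d ; u₀ = u ; v₀ = v
      ; x≡ = sym (m/n*n≡m (gcd[m,n]∣m x y)) ; y≡ = sym (m/n*n≡m (gcd[m,n]∣n x y))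
      ; 0<g = >-nonZero⁻¹ d ; 0<x′ = 0<x′ ; 0<u₀ = 0<u ; u₀≤x′ = u≤ ; v₀≤y′ = v≤ ; det₀ = eq }

  open Neighbour

  fraction-≡ : ∀ {u v u′ v′} → 0 < u → Coprime u v → Coprime u′ v′ → u * v′ ≡ u′ * v → u ≡ u′ × v ≡ v′
  fraction-≡ {suc u} {v} {u′} {v′} _ c c′ eq = u≡u′ , *-cancelˡ-≡ v v′ (suc u) (trans (cong (_* v) u≡u′) (sym eq))
    where
    u≡u′ : suc u ≡ u′
    u≡u′ = ∣-antisym (coprime-divisor c (divides v′ (trans (*-comm v u′) (trans (sym eq) (*-comm (suc u) v′)))))
      (coprime-divisor c′ (divides v (trans (*-comm v′ (suc u)) (trans eq (*-comm u′ v)))))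

  -- Both fractions are reduced, so numerators and denominators agree. By the determinant,
  -- `den * x′` is -1 modulo `num`; since x′ < num this determines x′, and then y′. Finally u₀ lies
  -- in [1, x′], so g is the quotient of num by x′, for remainders counted from 1.
  neighbour-injective : ∀ {x₁ y₁ x₂ y₂} (a : Neighbour x₁ y₁) (b : Neighbour x₂ y₂) →
                        num a * den b ≡ num b * den a → x₁ ≡ x₂ × y₁ ≡ y₂
  neighbour-injective {x₁} {y₁} {x₂} {y₂} a b cross = trans (x≡ a) (trans (cong₂ _*_ x′≡ g≡) (sym (x≡ b))) ,
      trans (y≡ a) (trans (cong₂ _*_ y′≡ g≡) (sym (y≡ b)))
    where
    0<u : 0 < num a
    0<u = ≤-trans (0<u₀ a) (m≤m+n _ _)
    uv≡ : num a ≡ num b × den a ≡ den b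
    uv≡ = fraction-≡ 0<u (coprime-uv a) (coprime-uv b) cross
    v*x′ : ∀ {x y} (a : Neighbour x y) → + den a ℤ.* + x′ a ≅ ℤ.- 1ℤ ⟨ num a ⟩
    v*x′ a = mk≅ (ℤ∣.divides (+ y′ a) (begin
      + den a ℤ.* + x′ a ℤ.- (ℤ.- 1ℤ)    ≡⟨ ℤₚ.+-comm (+ den a ℤ.* + x′ a) 1ℤ ⟩
      1ℤ ℤ.+ + den a ℤ.* + x′ a          ≡⟨ cong (λ z → 1ℤ ℤ.+ z) (ℤₚ.pos-* (den a) (x′ a)) ⟨
      1ℤ ℤ.+ + (den a * x′ a)            ≡⟨ ℤₚ.pos-+ 1 (den a * x′ a) ⟨
      + (1 + den a * x′ a)               ≡⟨ cong +_ (trans (sym (det a)) (*-comm (num a) (y′ a))) ⟩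
      + (y′ a * num a)                   ≡⟨ ℤₚ.pos-* (y′ a) (num a) ⟩
      + y′ a ℤ.* + num a                 ∎))
      where open ≡-Reasoning
    x′≡ : x′ a ≡ x′ b
    x′≡ = ≅⇒≡ {num a} (≅-cancelˡ (+ den a) (Cop.sym (coprime-uv a)) (≅-trans (v*x′ a) (≅-sym
        (subst₂ (λ z w → + z ℤ.* + x′ b ≅ ℤ.- 1ℤ ⟨ w ⟩) (sym (proj₂ uv≡)) (sym (proj₁ uv≡)) (v*x′ b)))))
      (x′<u a) (subst (x′ b <_) (sym (proj₁ uv≡)) (x′<u b))
    y′≡ : y′ a ≡ y′ b
    y′≡ = *-cancelˡ-≡ (y′ a) (y′ b) (num a) {{>-nonZero 0<u}} (trans (det a) (trans
      (cong₂ (λ v x → 1 + v * x) (proj₂ uv≡) x′≡) (trans (sym (det b)) (cong (_* y′ b) (sym (proj₁ uv≡))))))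
    g≮ : ∀ {x u₀ u₀′ g g′} → 0 < u₀′ → u₀ ≤ x → u₀ + x * g ≡ u₀′ + x * g′ → ¬ g < g′
    g≮ {x} {u₀} {u₀′} {g} {g′} 0<u′ u≤x eq g<g′ = <-irrefl eq (begin-strict
      u₀ + x * g      ≤⟨ +-monoˡ-≤ (x * g) u≤x ⟩
      x + x * g       ≡⟨ *-suc x g ⟨
      x * suc g       ≤⟨ *-monoʳ-≤ x g<g′ ⟩
      x * g′          <⟨ +-monoˡ-≤ (x * g′) 0<u′ ⟩
      u₀′ + x * g′    ∎)
      where open ≤-Reasoning
    u≡ : u₀ a + x′ a * g a ≡ u₀ b + x′ a * g b
    u≡ = trans (proj₁ uv≡) (cong (λ x → u₀ b + x * g b) (sym x′≡))
    g≡ : g a ≡ g b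
    g≡ = ≤-antisym (≮⇒≥ (g≮ (0<u₀ a) (≤-trans (u₀≤x′ b) (≤-reflexive (sym x′≡))) (sym u≡)))
                   (≮⇒≥ (g≮ (0<u₀ b) (u₀≤x′ a) u≡))

  module _ {n : ℕ} (pr : Prime (suc n)) {K M : ℕ} (0<M : 0 < M) (roots : SmallRoots (suc n) (2 * K) M) where
    private
      p : ℕ
      p = suc n

    fraction-roots : 2 * K * (2 * K) < p → K * K ≤ M
    fraction-roots B²<p = roots-of-unity pr 0<M elt root distinct
      where
      X Y : Fin (K * K) → ℕ
      X i = suc (toℕ (proj₁ (remQuot {K} K i)))
      Y i = suc (toℕ (proj₂ (remQuot {K} K i)))
      X≤ : ∀ i → X i ≤ K
      X≤ i = Finₚ.toℕ<n (proj₁ (remQuot {K} K i))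
      Y≤ : ∀ i → Y i ≤ K
      Y≤ i = Finₚ.toℕ<n (proj₂ (remQuot {K} K i))
      nb : ∀ i → Neighbour (X i) (Y i)
      nb i = neighbour (X i) (Y i) z<s z<s
      U V : Fin (K * K) → ℕ
      U i = num (nb i)
      V i = den (nb i)
      K+K : K + K ≡ 2 * K
      K+K = cong (λ z → K + z) (sym (+-identityʳ K))
      -- The origin of the factor 2: the offset is at most x′, hence at most x, and `x′ * g` is x
      -- itself.
      g-bound : ∀ {x x′ g u} → x ≡ x′ * g → 0 < g → u ≤ x′ → x ≤ K → u + x′ * g ≤ 2 * K
      g-bound {x} {x′} {g} refl 0<g u≤ x≤ = ≤-trans (+-mono-≤ (≤-trans u≤ (≤-trans (m≤m*n x′ g {{>-nonZero 0<g}}) x≤)) x≤) (≤-reflexive K+K)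
      U≤ : ∀ i → U i ≤ 2 * K
      U≤ i = g-bound (x≡ (nb i)) (0<g (nb i)) (u₀≤x′ (nb i)) (X≤ i)
      V≤ : ∀ i → V i ≤ 2 * K
      V≤ i = g-bound (y≡ (nb i)) (0<g (nb i)) (v₀≤y′ (nb i)) (Y≤ i)
      0<U : ∀ i → 0 < U i
      0<U i = ≤-trans (0<u₀ (nb i)) (m≤m+n _ _)
      0<V : ∀ i → 0 < V i
      0<V i = ≤-trans (subst (0 <_) (y≡ (nb i)) z<s) (m≤n+m _ (v₀ (nb i)))
      U-root : ∀ i → (+ U i) ℤ.^ M ≅ 1ℤ ⟨ p ⟩
      U-root i = roots (U i) (0<U i) (U≤ i)
      V-root : ∀ i → (+ V i) ℤ.^ M ≅ 1ℤ ⟨ p ⟩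
      V-root i = roots (V i) (0<V i) (V≤ i)
      -- The fraction U / V: as V ^ M is 1, the inverse of V is V ^ (M - 1).
      elt : Fin (K * K) → ℤ
      elt i = + U i ℤ.* (+ V i) ℤ.^ (M ∸ 1)
      root : ∀ i → elt i ℤ.^ M ≅ 1ℤ ⟨ p ⟩
      root i = ≅-trans (≅-reflexive (^ᶻ-distribʳ-* (+ U i) ((+ V i) ℤ.^ (M ∸ 1)) M)) (≅-* (U-root i)
        (≅-trans (≅-reflexive (ℤₚ.^-*-assoc (+ V i) (M ∸ 1) M)) (^∣-≅ (+ V i) M ((M ∸ 1) * M) (V-root i) (n∣m*n (M ∸ 1)))))
      V*elt : ∀ i → + V i ℤ.* elt i ≅ + U i ⟨ p ⟩
      V*elt i = ≅-trans (≅-reflexive (trans (lem (+ V i) (+ U i) ((+ V i) ℤ.^ (M ∸ 1)))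
          (cong (λ k → + U i ℤ.* (+ V i) ℤ.^ k) (m+[n∸m]≡n 0<M)))) (≅-absorb (+ U i) (V-root i))
        where
        lem : ∀ v u w → v ℤ.* (u ℤ.* w) ≡ u ℤ.* (v ℤ.* w)
        lem = solve 3 (λ v u w → v :* (u :* w) := u :* (v :* w)) refl where open +-*-Solver
      -- Both products are at most (2 K)², which is less than p, so their congruence is an equality.
      cross : ∀ {i j} → elt i ≅ elt j ⟨ p ⟩ → U i * V j ≡ U j * V i
      cross {i} {j} c = ≅⇒≡ (≅-trans (≅-reflexive (ℤₚ.pos-* (U i) (V j)))
          (≅-trans (≅-* (≅-sym (V*elt i)) (≅-refl {a = + V j})) (≅-trans (≅-* (≅-* (≅-refl {a = + V i}) c) (≅-refl {a = + V j}))
          (≅-trans (≅-reflexive (lem (+ V i) (elt j) (+ V j))) (≅-trans (≅-* (V*elt j) (≅-refl {a = + V i})) (≅-reflexive (sym (ℤₚ.pos-* (U j) (V i)))))))))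
          (≤-<-trans (*-mono-≤ (U≤ i) (V≤ j)) B²<p) (≤-<-trans (*-mono-≤ (U≤ j) (V≤ i)) B²<p)
        where
        lem : ∀ a e b → a ℤ.* e ℤ.* b ≡ b ℤ.* e ℤ.* a
        lem = solve 3 (λ a e b → a :* e :* b := b :* e :* a) refl where open +-*-Solver
      distinct : ∀ {i j} → i ≢ j → ¬ elt i ≅ elt j ⟨ p ⟩
      distinct {i} {j} i≢j c = i≢j (trans (sym (Finₚ.combine-remQuot {K} K i)) (trans
        (cong₂ combine (Finₚ.toℕ-injective (suc-injective (proj₁ xy≡))) (Finₚ.toℕ-injective (suc-injective (proj₂ xy≡))))
        (Finₚ.combine-remQuot {K} K j)))
        where
        xy≡ : X i ≡ X j × Y i ≡ Y j
        xy≡ = neighbour-injective (nb i) (nb j) (cross c)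

  prime-divisor-structure : ∀ {N n K h} → Prime (suc n) → suc n ∣ N → 0 < h → 2 * h < K * K →
                            SmallRoots N (2 * K) (2 * h) → n ∣ 2 * h
  prime-divisor-structure {N} {n} {K} {h} pr p∣N 0<h M<K² roots = exponent-divisible pr
      λ c 0<c c<p → thue-root pr 0<h roots-p p<B² c 0<c c<p
    where
    roots-p : SmallRoots (suc n) (2 * K) (2 * h)
    roots-p a 0<a a≤ = ≅-∣ p∣N (roots a 0<a a≤)
    p<B² : suc n < suc (2 * K) * suc (2 * K)
    -- The fractions give p ≤ B² with B = 2 K. Thue's lemma draws on the (B + 1)² pairs with entries
    -- from 0 to B and only needs p < (B + 1)².
    p<B² = ≤-<-trans (≮⇒≥ λ B²<p → <⇒≱ M<K² (fraction-roots pr {K} {2 * h} (*-mono-≤ (z<s {1}) 0<h) roots-p B²<p))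
      (*-mono-< (n<1+n (2 * K)) (n<1+n (2 * K)))

-- Baby steps and giant steps, and the final primality criterion.

module Arithmetic where

  open import Data.Integer.Base as ℤ using (ℤ; +_; 1ℤ)
  import Data.Integer.Properties as ℤₚ
  open import Data.List.Base using ([]; _∷_)
  open import Data.List.Relation.Unary.All using ([]; _∷_)
  open import Data.Nat.Base
  open import Data.Nat.Coprimality using (Coprime)
  open import Data.Nat.Divisibility
  open import Data.Nat.DivMod
  open import Data.Nat.Primality
  open import Data.Nat.Primality.Factorisation using (factorise; PrimeFactorisation)
  open import Data.Nat.Properties
  import Data.Integer.Divisibility.Signed as ℤ∣
  open Congruences
  open RootsOfUnity
  open PrimeDivisors using (SmallRoots; prime-divisor-structure)

  square-root : ∀ D → ∃[ K ] 0 < K × D < K * K × (K ∸ 1) * (K ∸ 1) ≤ D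
  square-root D = convert (least-positive (λ K → D <? K * K) (suc D) z<s (m≤m*n (suc D) (suc D)))
    where
    below : ∀ K → (∀ e → 0 < e → e < K → ¬ D < e * e) → (K ∸ 1) * (K ∸ 1) ≤ D
    below 0             _     = z≤n
    below 1             _     = z≤n
    below (suc (suc K)) least = ≮⇒≥ (least (suc K) z<s (n<1+n _))
    convert : ∃[ K ] 0 < K × D < K * K × (∀ e → 0 < e → e < K → ¬ D < e * e) → ∃[ K ] 0 < K × D < K * K × (K ∸ 1) * (K ∸ 1) ≤ D
    convert (K , 0<K , D<K² , least) = K , 0<K , D<K² , below K least

  -- If x ^ e = 1, then x ^ j = x ^ (i K): the baby step j meets the giant step i. Rounding up
  -- rather than down makes the powers of x positive on both sides, so no inverse of x is computed.
  round-up : ∀ e K .{{_ : NonZero K}} → 0 < e → ∃[ i ] ∃[ j ] 0 < i × j < K × e + j ≡ i * K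
  round-up e K 0<e with e % K in eq
  ... | zero  = e / K , 0 , m≥n⇒m/n>0 (∣⇒≤ {{>-nonZero 0<e}} (m%n≡0⇒n∣m e K eq)) , >-nonZero⁻¹ K ,
        trans (+-identityʳ e) (sym (m/n*n≡m (m%n≡0⇒n∣m e K eq)))
  ... | suc r = suc (e / K) , K ∸ suc r , z<s , ∸-monoʳ-< z<s (<⇒≤ r<K) , (begin
      e + (K ∸ suc r)                          ≡⟨ cong (_+ (K ∸ suc r)) (trans (m≡m%n+[m/n]*n e K) (trans (cong (_+ e / K * K) eq) (+-comm (suc r) (e / K * K)))) ⟩
      e / K * K + suc r + (K ∸ suc r)          ≡⟨ +-assoc (e / K * K) (suc r) (K ∸ suc r) ⟩
      e / K * K + (suc r + (K ∸ suc r))        ≡⟨ cong (λ z → e / K * K + z) (m+[n∸m]≡n (<⇒≤ r<K)) ⟩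
      e / K * K + K                            ≡⟨ +-comm (e / K * K) K ⟩
      suc (e / K) * K                          ∎)
    where
    open ≡-Reasoning
    r<K : suc r < K
    r<K = subst (_< K) eq (m%n<n e K)

  module BabyGiant (N x K : ℕ) .{{_ : NonZero N}} .{{_ : NonZero K}} (cop : Coprime x N) where

    pw : ℕ → ℕ
    pw j = x ^ j % N

    pw-suc : ∀ j → pw j * x % N ≡ pw (suc j)
    pw-suc j = trans (%-distribˡ-* (pw j) x N) (trans (cong (λ z → z * (x % N) % N) (m%n%n≡m%n (x ^ j) N))
      (trans (sym (%-distribˡ-* (x ^ j) x N)) (cong (_% N) (*-comm (x ^ j) x))))

    pw-+ : ∀ i j → pw i * pw j % N ≡ pw (i + j)
    pw-+ i j = trans (sym (%-distribˡ-* (x ^ i) (x ^ j) N)) (cong (_% N) (sym (^-distribˡ-+-* x i j)))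

    pw-≅ : ∀ j → + pw j ≅ (+ x) ℤ.^ j ⟨ N ⟩
    pw-≅ j = ≅-trans (%-≅ (x ^ j)) (≅-reflexive (pos-^ x j))

    pw≡ : ∀ {i j} → (+ x) ℤ.^ i ≅ (+ x) ℤ.^ j ⟨ N ⟩ → pw i ≡ pw j
    pw≡ {i} {j} c = ≅⇒≡ (≅-trans (pw-≅ i) (≅-trans c (≅-sym (pw-≅ j)))) (m%n<n (x ^ i) N) (m%n<n (x ^ j) N)

    -- The table holds j + 1 for the last j < i with pw j = v, and 0 if there is none.
    Entry : ℕ → ℕ → ℕ → Set
    Entry i v c = (c ≡ 0 × (∀ j → j < i → pw j ≢ v)) ⊎
                  (∃[ j ] c ≡ suc j × j < i × pw j ≡ v × (∀ j′ → j < j′ → j′ < i → pw j′ ≢ v))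

    entry-zero : ∀ {v} → Entry 0 v 0
    entry-zero = inj₁ (refl , λ j ())

    entry-hit : ∀ i → Entry (suc i) (pw i) (suc i)
    entry-hit i = inj₂ (i , refl , n<1+n i , refl , λ j′ i<j′ j′≤i → ⊥-elim (<⇒≱ i<j′ (s≤s⁻¹ j′≤i)))

    below-suc : ∀ {i} {Q : ℕ → Set} → (∀ j → j < i → Q j) → Q i → ∀ j → j < suc i → Q j
    below-suc {i} {Q} f q j j≤i = go (m≤n⇒m<n∨m≡n (s≤s⁻¹ j≤i))
      where
      go : j < i ⊎ j ≡ i → Q j
      go (inj₁ j<i)  = f j j<i
      go (inj₂ refl) = q

    entry-miss : ∀ {i v c} → pw i ≢ v → Entry i v c → Entry (suc i) v c
    entry-miss ne (inj₁ (c≡ , none)) = inj₁ (c≡ , below-suc none ne)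
    entry-miss ne (inj₂ (j , c≡ , j<i , eq , last)) =
      inj₂ (j , c≡ , m<n⇒m<1+n j<i , eq , λ j′ j<j′ j′≤i → below-suc {Q = λ k → j < k → pw k ≢ _} (λ k k<i j<k → last k j<k k<i) (λ _ → ne) j′ j′≤i j<j′)

    Missed : ℕ → Set
    Missed i = ∀ i′ → 0 < i′ → i′ < i → ∀ j → j < K → pw j ≢ pw (i′ * K)

    missed-one : Missed 1
    missed-one i′ 0<i′ i′<1 = ⊥-elim (<⇒≱ i′<1 0<i′)

    missed-suc : ∀ {i} → Missed i → (∀ j → j < K → pw j ≢ pw (i * K)) → Missed (suc i)
    missed-suc {i} ms new i′ 0<i′ i′≤i = below-suc {Q = λ k → 0 < k → ∀ j → j < K → pw j ≢ pw (k * K)}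
      (λ k k<i 0<k → ms k 0<k k<i) (λ _ → new) i′ i′≤i 0<i′

    collision : ∀ e i j → (+ x) ℤ.^ e ≅ 1ℤ ⟨ N ⟩ → e + j ≡ i * K → pw j ≡ pw (i * K)
    collision e i j p eq = pw≡ {j} {i * K} (≅-sym (≅-trans (≅-reflexive (trans (cong ((+ x) ℤ.^_) (trans (sym eq) (+-comm e j))) (ℤₚ.^-distribˡ-+-* (+ x) j e)))
      (≅-absorb ((+ x) ℤ.^ j) p)))

    -- An exponent e ≤ K² rounds up to a multiple i K with 1 ≤ i ≤ K, and these are exactly the
    -- giant steps that `Missed (suc K)` covers.
    no-small-order : Missed (suc K) → ∀ e → 0 < e → e ≤ K * K → ¬ (+ x) ℤ.^ e ≅ 1ℤ ⟨ N ⟩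
    no-small-order ms e 0<e e≤ p = go (round-up e K 0<e)
      where
      go : ¬ (∃[ i ] ∃[ j ] 0 < i × j < K × e + j ≡ i * K)
      go (i , j , 0<i , j<K , eq) = ms i 0<i (*-cancelʳ-< K i (suc K) (≤-<-trans (≤-reflexive (sym eq))
        (<-≤-trans (+-mono-≤-< e≤ j<K) (≤-reflexive (+-comm (K * K) K))))) j j<K (collision e i j p eq)

    -- The first giant step that hits and the last baby step that it hits make i K - j least. A
    -- smaller exponent would round up to an earlier giant step, excluded by `Missed`, or to the
    -- same one with a later baby step, excluded by the last hypothesis; it is too small for a later
    -- giant step.
    order : ∀ {i j} → 0 < i → Missed i → j < K → pw j ≡ pw (i * K) → (∀ j′ → j < j′ → j′ < K → pw j′ ≢ pw (i * K)) →
            Ord N (+ x) (i * K ∸ j)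
    order {i@(suc i₀)} {j} 0<i ms j<K hit last = least⇒ord (m<n⇒0<n∸m j<iK)
        (≅-sym (≅-cancelˡ ((+ x) ℤ.^ j) (coprime-^ᶻ {a = + x} j cop) (≅-trans (≅-reflexive (ℤₚ.*-identityʳ _))
          (≅-trans (≅-sym (pw-≅ j)) (≅-trans (≅-reflexive (cong +_ hit)) (≅-trans (pw-≅ (i * K))
          (≅-reflexive (trans (cong ((+ x) ℤ.^_) (sym (m+[n∸m]≡n (<⇒≤ j<iK)))) (ℤₚ.^-distribˡ-+-* (+ x) j (i * K ∸ j))))))))))
        λ e 0<e e<m p → least e e<m p (round-up e K 0<e)
      where
      j<iK : j < i * K
      j<iK = <-≤-trans j<K (m≤m+n K (i₀ * K))
      least : ∀ e → e < i * K ∸ j → (+ x) ℤ.^ e ≅ 1ℤ ⟨ N ⟩ → ¬ (∃[ i ] ∃[ j ] 0 < i × j < K × e + j ≡ i * K)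
      least e e<m p (i′ , j′ , 0<i′ , j′<K , eq) = go (<-cmp i′ i)
        where
        open import Relation.Binary.Definitions using (Tri; tri<; tri≈; tri>)
        e+j< : e + j < i * K
        e+j< = <-≤-trans (+-monoˡ-< j e<m) (≤-reflexive (m∸n+n≡m (<⇒≤ j<iK)))
        go : ¬ Tri (i′ < i) (i′ ≡ i) (i′ > i)
        go (tri< i′<i _ _) = ms i′ 0<i′ i′<i j′ j′<K (collision e i′ j′ p eq)
        go (tri≈ _ refl _) = last j′ (+-cancelˡ-< e j j′ (<-≤-trans e+j< (≤-reflexive (sym eq)))) j′<K (collision e i j′ p eq)
        go (tri> _ _ i<i′) = <⇒≱ (+-mono-≤-< (<⇒≤ (≤-<-trans (m≤m+n e j) e+j<)) j′<K) (begin
          i * K + K       ≡⟨ +-comm (i * K) K ⟩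
          suc i * K       ≤⟨ *-monoˡ-≤ K i<i′ ⟩
          i′ * K          ≡⟨ eq ⟨
          e + j′          ∎)
          where open ≤-Reasoning

  prime-divisor : ∀ N → 1 < N → ∃[ p ] Prime p × p ∣ N
  prime-divisor N@(suc _) 1<N = go (factorise N)
    where
    go : PrimeFactorisation N → ∃[ p ] Prime p × p ∣ N
    go record { factors = []     ; isFactorisation = eq } = ⊥-elim (<⇒≢ 1<N (sym eq))
    go record { factors = p ∷ ps ; isFactorisation = eq ; factorsPrime = pr ∷ _ } =
      p , pr , subst (p ∣_) (sym eq) (m∣m*n _)

  no-divisor⇒prime : ∀ {N} → 1 < N → (∀ b → 2 ≤ b → b < N → ¬ b ∣ N) → Prime N
  no-divisor⇒prime {N} 1<N none = go (prime-divisor N 1<N)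
    where
    go : (∃[ p ] Prime p × p ∣ N) → Prime N
    go (p , pr , p∣N) with m≤n⇒m<n∨m≡n (∣⇒≤ {{>-nonZero (<-trans z<s 1<N)}} p∣N)
    ... | inj₁ p<N = ⊥-elim (none p (nonTrivial⇒n>1 p {{prime⇒nonTrivial pr}}) p<N p∣N)
    ... | inj₂ refl = pr

  no-divisor⇒coprime : ∀ {N a} → 0 < a → (∀ b → 2 ≤ b → b ≤ a → ¬ b ∣ N) → Coprime a N
  no-divisor⇒coprime {N} 0<a none {0}           (d∣a , _) = ⊥-elim (<⇒≢ 0<a (sym (0∣⇒≡0 d∣a)))
  no-divisor⇒coprime     0<a none {1}           _         = refl
  no-divisor⇒coprime     0<a none {suc (suc d)} (d∣a , d∣N) = ⊥-elim (none _ (s≤s (s≤s z≤n)) (∣⇒≤ {{>-nonZero 0<a}} d∣a) d∣N)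

  -- Let p = n + 1 be a prime divisor of N and 2 h = k n. Since 2 h < K², one of k and n is at most
  -- K, so p was among the candidates; as it is no proper divisor, it equals N.
  no-candidate⇒prime : ∀ {N K h} → 1 < N → 0 < h → 2 * h < K * K → SmallRoots N (2 * K) (2 * h) →
                       (∀ i j → 0 < i → i ≤ K → i * j ≡ 2 * h → ¬ (suc i ∣ N × suc i < N) × ¬ (suc j ∣ N × suc j < N)) →
                       Prime N
  no-candidate⇒prime {N} {K} {h} 1<N 0<h M<K² roots none = go (prime-divisor N 1<N)
    where
    not-proper : ∀ {p} → p ∣ N → ¬ (p ∣ N × p < N) → p ≡ N
    not-proper p∣N ¬proper = ≤-antisym (∣⇒≤ {{>-nonZero (<-trans z<s 1<N)}} p∣N) (≮⇒≥ λ p<N → ¬proper (p∣N , p<N))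
    0<M : 0 < 2 * h
    0<M = *-mono-≤ (z<s {1}) 0<h
    cofactors : ∀ {n k} → Prime (suc n) → suc n ∣ N → 2 * h ≡ k * n → Dec (k ≤ K) → Dec (n ≤ K) → Prime N
    cofactors {n} {k} pr p∣N eq (yes k≤K) _ = subst Prime (not-proper p∣N (proj₂ (none k n (0<k k eq) k≤K (sym eq)))) pr
      where
      0<k : ∀ k → 2 * h ≡ k * n → 0 < k
      0<k zero    e = ⊥-elim (<⇒≢ 0<M (sym e))
      0<k (suc _) _ = z<s
    cofactors {n} {k} pr p∣N eq (no _) (yes n≤K) =
      subst Prime (not-proper p∣N (proj₁ (none n k (0<n n eq) n≤K (trans (*-comm n k) (sym eq))))) pr
      where
      0<n : ∀ n → 2 * h ≡ k * n → 0 < n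
      0<n zero    e = ⊥-elim (<⇒≢ 0<M (sym (trans e (*-zeroʳ k))))
      0<n (suc _) _ = z<s
    cofactors _ _ eq (no k≰K) (no n≰K) = ⊥-elim (<⇒≱ M<K² (≤-trans (*-mono-≤ (<⇒≤ (≰⇒> k≰K)) (<⇒≤ (≰⇒> n≰K))) (≤-reflexive (sym eq))))
    divided : ∀ {n} → Prime (suc n) → suc n ∣ N → n ∣ 2 * h → Prime N
    divided {n} pr p∣N (divides k eq) = cofactors pr p∣N eq (k ≤? K) (n ≤? K)
    go : (∃[ p ] Prime p × p ∣ N) → Prime N
    go (zero  , pr , _)   = ⊥-elim (¬prime[0] pr)
    go (suc n , pr , p∣N) = divided pr p∣N (prime-divisor-structure {K = K} pr p∣N 0<h M<K² roots)

  ord-minus-one : ∀ {N} → 3 ≤ N → Ord N (+ (N ∸ 1)) 2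
  ord-minus-one {suc n} (s≤s 2≤n) = least⇒ord z<s (≅-trans (≅-^ 2 n≅-1) (≅-reflexive refl)) least
    where
    n≅-1 : + n ≅ ℤ.- 1ℤ ⟨ suc n ⟩
    n≅-1 = mk≅ (subst (+ suc n ℤ∣.∣_) (trans (cong +_ (+-comm 1 n)) (ℤₚ.pos-+ n 1)) ℤ∣.∣-refl)
    least : ∀ e → 0 < e → e < 2 → ¬ (+ n) ℤ.^ e ≅ 1ℤ ⟨ suc n ⟩
    -- N ≥ 3 keeps -1 and 1 apart.
    least (suc zero) _ _ p = <⇒≢ 2≤n (sym (≅⇒≡ (≅-trans (≅-reflexive (sym (ℤₚ.^-identityʳ (+ n)))) p) (n<1+n n) (<-trans 2≤n (n<1+n n))))
    least (suc (suc e)) _ e<2 = ⊥-elim (<⇒≱ e<2 (s≤s (s≤s z≤n)))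

-- A while language and its compilation to the random access machine.

module Compiler where

  open import Defs
  open import Data.Bool.Base using (Bool; true; false; T; _∧_; if_then_else_)

  open import Data.List.Base using ([]; _∷_; _++_; length)
  open import Data.List.Properties using (length-++)
  open import Data.Nat.Base
  open import Data.Nat.Induction using (<-rec)
  open import Data.Nat.Logarithm using (⌊log₂⌋-mono-≤)
  open import Data.Nat.DivMod using (m/n≤m)
  open import Data.Nat.Properties
  open import Data.Unit.Base using (⊤; tt)

  ≔-same : ∀ (m : Memory) i v → (m [ i ≔ v ]) i ≡ v
  ≔-same m i v with i ≡ᵇ i in eq
  ... | true  = refl
  ... | false = ⊥-elim (subst T eq (≡⇒≡ᵇ i i refl))

  ≔-other : ∀ (m : Memory) {i j} v → i ≢ j → (m [ i ≔ v ]) j ≡ m j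
  ≔-other m {i} {j} v i≢j with i ≡ᵇ j in eq
  ... | true  = ⊥-elim (i≢j (≡ᵇ⇒≡ i j (subst T (sym eq) tt)))
  ... | false = refl

  ≔-≤ : ∀ {m : Memory} {n} i {v} → (∀ j → m j ≤ n) → v ≤ n → ∀ j → (m [ i ≔ v ]) j ≤ n
  ≔-≤ i b v≤ j with i ≡ᵇ j
  ... | true  = v≤
  ... | false = b j

  Store : Set
  Store = ℕ → ℕ

  data BinOp : Set where
    plus minus times over : BinOp

  data Exp : Set where
    con var : ℕ → Exp
    cell    : Exp → Exp
    bin     : BinOp → Exp → Exp → Exp

  infixl 6 _⊞_ _⊟_
  infixl 7 _⊠_ _⊘_ _⊘%_
  pattern _⊞_ a b = bin plus a b
  pattern _⊟_ a b = bin minus a b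
  pattern _⊠_ a b = bin times a b
  pattern _⊘_ a b = bin over a b

  _⊘%_ : Exp → Exp → Exp
  a ⊘% b = a ⊟ a ⊘ b ⊠ b

  ⟦_⟧ᵒ : BinOp → ℕ → ℕ → ℕ
  ⟦ plus  ⟧ᵒ = _+_
  ⟦ minus ⟧ᵒ = _∸_
  ⟦ times ⟧ᵒ = _*_
  ⟦ over  ⟧ᵒ = _div₀_

  ⟦_⟧ : Exp → Store → ℕ
  ⟦ con n ⟧     σ = n
  ⟦ var r ⟧     σ = σ r
  ⟦ cell e ⟧    σ = σ (⟦ e ⟧ σ)
  ⟦ bin o a b ⟧ σ = ⟦ o ⟧ᵒ (⟦ a ⟧ σ) (⟦ b ⟧ σ)

  infix  4 _←_
  infixr 3 _⨾_

  data Stmt : Set where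
    skip     : Stmt
    _←_      : ℕ → Exp → Stmt
    put      : Exp → Exp → Stmt
    _⨾_      : Stmt → Stmt → Stmt
    cond     : Exp → Stmt → Stmt → Stmt
    while    : Exp → Stmt → Stmt
    ret      : ℕ → Exp → Stmt

  -- Cell k of the store lives in register phys k; the registers tmp d hold intermediate results.
  phys tmp : ℕ → ℕ
  phys k = suc (k + k)
  tmp  d = suc (suc (d + d))

  instr : BinOp → Operand → Instr
  instr plus  = add
  instr minus = sub
  instr times = mult
  instr over  = div

  lenE : Exp → ℕ
  lenE (con _)     = 1
  lenE (var _)     = 1
  lenE (cell e)    = lenE e + 5
  lenE (bin _ a b) = lenE b + suc (lenE a + 1)

  -- The right operand is evaluated first and saved, so that the left one is in the accumulator when
  -- a non-commutative instruction is reached. The argument d is the height of the stack of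
  -- temporaries.
  compE : Exp → ℕ → Program
  compE (con n)     d = load (lit n) ∷ []
  compE (var r)     d = load (dir (phys r)) ∷ []
  compE (cell e)    d = compE e d ++ store (tmp d) ∷ add (dir (tmp d)) ∷ add (lit 1) ∷ store (tmp d) ∷ load (ind (tmp d)) ∷ []
  compE (bin o a b) d = compE b d ++ store (tmp d) ∷ compE a (suc d) ++ instr o (dir (tmp d)) ∷ []

  len : Stmt → ℕ
  len skip          = 0
  len (r ← e)      = lenE e + 1
  len (put a e) = lenE a + suc (suc (suc (suc (lenE e + 1))))
  len (s ⨾ t)       = len s + len t
  len (cond e s t)  = lenE e + suc (len s + suc (len t))
  len (while e s)   = lenE e + suc (len s + 1)
  len (ret k e)     = lenE e + 3

  -- Jumps of the machine are absolute, hence the argument o, the address of the first instruction.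
  comp : Stmt → ℕ → Program
  comp skip          o = []
  comp (r ← e)      o = compE e 0 ++ store (phys r) ∷ []
  comp (put a e) o = compE a 0 ++ store (tmp 0) ∷ add (dir (tmp 0)) ∷ add (lit 1) ∷ store (tmp 0) ∷
                         compE e 1 ++ storeInd (tmp 0) ∷ []
  comp (s ⨾ t)       o = comp s o ++ comp t (o + len s)
  comp (cond e s t)  o = compE e 0 ++ jzero (suc (suc (o + lenE e) + len s)) ∷ comp s (suc (o + lenE e)) ++
                         jump (suc (suc (o + lenE e) + len s) + len t) ∷ comp t (suc (suc (o + lenE e) + len s))
  comp (while e s)   o = compE e 0 ++ jzero (suc (suc (o + lenE e) + len s)) ∷ comp s (suc (o + lenE e)) ++ jump o ∷ []
  comp (ret k e)     o = compE e 0 ++ store 1 ∷ load (lit k) ∷ halt ∷ []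

  length-compE : ∀ e d → length (compE e d) ≡ lenE e
  length-compE (con n)     d = refl
  length-compE (var r)     d = refl
  length-compE (cell e)    d = trans (length-++ (compE e d)) (cong (_+ 5) (length-compE e d))
  length-compE (bin o a b) d = trans (length-++ (compE b d)) (cong₂ _+_ (length-compE b d)
    (cong suc (trans (length-++ (compE a (suc d))) (cong (_+ 1) (length-compE a (suc d))))))

  length-comp : ∀ s o → length (comp s o) ≡ len s
  length-comp skip          o = refl
  length-comp (r ← e)      o = trans (length-++ (compE e 0)) (cong (_+ 1) (length-compE e 0))
  length-comp (put a e) o = trans (length-++ (compE a 0)) (cong₂ _+_ (length-compE a 0)
    (cong (4 +_) (trans (length-++ (compE e 1)) (cong (_+ 1) (length-compE e 1)))))
  length-comp (s ⨾ t)       o = trans (length-++ (comp s o)) (cong₂ _+_ (length-comp s o) (length-comp t _))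
  length-comp (cond e s t)  o = trans (length-++ (compE e 0)) (cong₂ _+_ (length-compE e 0)
    (cong suc (trans (length-++ (comp s _)) (cong₂ _+_ (length-comp s _) (cong suc (length-comp t _))))))
  length-comp (while e s)   o = trans (length-++ (compE e 0)) (cong₂ _+_ (length-compE e 0)
    (cong suc (trans (length-++ (comp s _)) (cong (_+ 1) (length-comp s _)))))
  length-comp (ret k e)     o = trans (length-++ (compE e 0)) (cong (_+ 3) (length-compE e 0))

  At : Program → ℕ → Program → Set
  At P o []      = ⊤
  At P o (i ∷ c) = fetch P o ≡ just i × At P (suc o) c

  At-++ˡ : ∀ {P} o c {c′} → At P o (c ++ c′) → At P o c
  At-++ˡ o []      _       = tt
  At-++ˡ o (i ∷ c) (f , a) = f , At-++ˡ (suc o) c a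

  At-++ʳ : ∀ {P} o c {c′} → At P o (c ++ c′) → At P (o + length c) c′
  At-++ʳ {P} o []      {c′} a       = subst (λ k → At P k c′) (sym (+-identityʳ o)) a
  At-++ʳ {P} o (i ∷ c) {c′} (_ , a) = subst (λ k → At P k c′) (sym (+-suc o (length c))) (At-++ʳ (suc o) c a)

  At-self : ∀ P → At P 0 P
  At-self P = go [] P
    where
    fetch-++ : ∀ Q i c → fetch (Q ++ i ∷ c) (length Q) ≡ just i
    fetch-++ []      i c = refl
    fetch-++ (_ ∷ Q) i c = fetch-++ Q i c
    snoc : ∀ (Q : Program) i c → (Q ++ i ∷ []) ++ c ≡ Q ++ i ∷ c
    snoc []      i c = refl
    snoc (q ∷ Q) i c = cong (q ∷_) (snoc Q i c)
    go : ∀ Q c → At (Q ++ c) (length Q) c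
    go Q []      = tt
    go Q (i ∷ c) = fetch-++ Q i c , subst₂ (λ R k → At R k c) (snoc Q i c)
      (trans (length-++ Q) (+-comm (length Q) 1)) (go (Q ++ i ∷ []) c)

  module _ {P : Program} where

    At-E : ∀ o e d {c} → At P o (compE e d ++ c) → At P o (compE e d) × At P (o + lenE e) c
    At-E o e d a = At-++ˡ o (compE e d) a , subst (λ k → At P (o + k) _) (length-compE e d) (At-++ʳ o (compE e d) a)

    At-S : ∀ o s p {c} → At P o (comp s p ++ c) → At P o (comp s p) × At P (o + len s) c
    At-S o s p a = At-++ˡ o (comp s p) a , subst (λ k → At P (o + k) _) (length-comp s p) (At-++ʳ o (comp s p) a)

  -- Sizes of intermediate values, and a program logic that counts instructions.

  limit : ℕ
  limit = 16

  -- `X ^ leaves e` bounds the value of `e`, since sums and products of values up to `X ^ a` and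
  -- `X ^ b` are at most `X ^ (a + b)`. The 2 added for a cell makes room for the register number 2
  -- v + 1.
  leaves : Exp → ℕ
  leaves (con _)     = 1
  leaves (var _)     = 1
  leaves (cell e)    = leaves e + 2
  leaves (bin _ a b) = leaves a + leaves b

  -- The side conditions are Boolean, so that for the concrete program they hold by computation.
  -- Constants and register numbers up to 99 are below X.
  ok : Exp → ℕ → Bool
  ok (con n)     d = n ≤ᵇ 99
  ok (var r)     d = phys r ≤ᵇ 99
  ok (cell e)    d = ok e d ∧ (tmp d ≤ᵇ 99) ∧ (leaves e + 2 ≤ᵇ limit)
  ok (bin o a b) d = ok a (suc d) ∧ ok b d ∧ (tmp d ≤ᵇ 99) ∧ (leaves a + leaves b ≤ᵇ limit)

  T-∧₁ : ∀ {a b} → T (a ∧ b) → T a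
  T-∧₁ {true} _ = tt

  T-∧₂ : ∀ {a b} → T (a ∧ b) → T b
  T-∧₂ {true} p = p

  phys≢tmp : ∀ k d → phys k ≢ tmp d
  phys≢tmp k d eq = odd k d (suc-injective eq)
    where
    odd : ∀ k d → k + k ≢ suc (d + d)
    odd (suc k) zero eq = 0≢1+n (sym (trans (sym (+-suc k k)) (suc-injective eq)))
    odd (suc k) (suc d) eq = odd k d (suc-injective (trans (sym (+-suc k k)) (trans (suc-injective eq) (cong suc (+-suc d d)))))

  double-injective : ∀ {j k} → j + j ≡ k + k → j ≡ k
  double-injective {zero}  {zero}  _  = refl
  double-injective {suc j} {suc k} eq = cong suc (double-injective (suc-injective (trans (sym (+-suc j j)) (trans (suc-injective eq) (+-suc k k)))))

  phys-injective : ∀ {j k} → phys j ≡ phys k → j ≡ k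
  phys-injective eq = double-injective (suc-injective eq)

  tmp-injective : ∀ {j k} → tmp j ≡ tmp k → j ≡ k
  tmp-injective eq = double-injective (suc-injective (suc-injective eq))

  size-mono : ∀ {a b} → a ≤ b → size a ≤ size b
  size-mono a≤b = s≤s (⌊log₂⌋-mono-≤ a≤b)

  -- X bounds the cells of the store, V all registers, and ℓ the cost of an instruction.
  module Logic (P : Program) (Good : Memory → Set) {X V ℓ : ℕ} (99<X : 99 < X)
               (X^limit≤V : X ^ limit ≤ V) (3*size≤ℓ : 3 * size V ≤ ℓ) where

    private
      instance
        X≢0 : NonZero X
        X≢0 = >-nonZero (≤-<-trans z≤n 99<X)

    record Halts (s : State) (n : ℕ) : Set where
      constructor halts
      field
        {time}  : ℕ
        {final} : Memory
        run     : Run P s time final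
        good    : Good final
        time≤   : time ≤ n * ℓ

    Halts-≤ : ∀ {s n n′} → n ≤ n′ → Halts s n → Halts s n′
    Halts-≤ n≤ (halts r g t≤) = halts r g (≤-trans t≤ (*-monoˡ-≤ ℓ n≤))

    -- Only the odd registers represent the store; the accumulator and the temporaries are merely
    -- bounded.
    record _≈_ (m : Memory) (σ : Store) : Set where
      field
        agrees  : ∀ k → m (phys k) ≡ σ k
        bounded : ∀ i → m i ≤ V
    open _≈_

    Bounded : Store → Set
    Bounded σ = ∀ k → σ k ≤ X

    X≤V : X ≤ V
    X≤V = ≤-trans (≤-reflexive (sym (^-identityʳ X))) (≤-trans (^-monoʳ-≤ X {1} {limit} (s≤s z≤n)) X^limit≤V)

    99≤V : ∀ {n} → T (n ≤ᵇ 99) → n ≤ V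
    99≤V {n} p = ≤-trans (≤ᵇ⇒≤ n 99 p) (≤-trans (<⇒≤ 99<X) X≤V)

    ≈-acc : ∀ {m σ v} → m ≈ σ → v ≤ V → (m [ 0 ≔ v ]) ≈ σ
    ≈-acc s v≤ = record { agrees = agrees s ; bounded = ≔-≤ 0 (bounded s) v≤ }

    ≈-tmp : ∀ {m σ v} d → m ≈ σ → v ≤ V → (m [ tmp d ≔ v ]) ≈ σ
    ≈-tmp {m} {v = v} d s v≤ = record
      { agrees = λ k → trans (≔-other m v (λ eq → phys≢tmp k d (sym eq))) (agrees s k)
      ; bounded = ≔-≤ (tmp d) (bounded s) v≤ }

    ≈-cell : ∀ {m σ v} k → m ≈ σ → v ≤ V → (m [ phys k ≔ v ]) ≈ (σ [ k ≔ v ])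
    ≈-cell {m} {σ} {v} k s v≤ = record { agrees = agr ; bounded = ≔-≤ (phys k) (bounded s) v≤ }
      where
      agr : ∀ j → (m [ phys k ≔ v ]) (phys j) ≡ (σ [ k ≔ v ]) j
      agr j with k ≟ j
      ... | yes refl = trans (≔-same m (phys k) v) (sym (≔-same σ k v))
      ... | no k≢j = trans (≔-other m v (λ eq → k≢j (phys-injective eq))) (trans (agrees s j) (sym (≔-other σ v k≢j)))

    -- No instruction emitted by the compiler is charged for more than three numbers.
    sizes : ∀ {a b c} → a ≤ V → b ≤ V → c ≤ V → size a + size b + size c ≤ ℓ
    sizes {a} {b} {c} a≤ b≤ c≤ = ≤-trans (+-mono-≤ (+-mono-≤ (size-mono a≤) (size-mono b≤)) (size-mono c≤))
      (≤-trans (≤-reflexive (trans (+-assoc (size V) (size V) (size V)) (cong (λ z → size V + (size V + z)) (sym (+-identityʳ (size V)))))) 3*size≤ℓ)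

    sizes₂ : ∀ {a b} → a ≤ V → b ≤ V → size a + size b ≤ ℓ
    sizes₂ {a} {b} a≤ b≤ = ≤-trans (m≤m+n (size a + size b) (size 0)) (sizes {a} {b} {0} a≤ b≤ z≤n)

    sizes₁ : ∀ {a} → a ≤ V → size a ≤ ℓ
    sizes₁ {a} a≤ = ≤-trans (m≤m+n (size a) (size 0)) (sizes₂ {a} {0} a≤ z≤n)

    1≤ℓ : 1 ≤ ℓ
    1≤ℓ = ≤-trans (s≤s z≤n) 3*size≤ℓ

    step! : ∀ {p m s n} i → fetch P p ≡ just i → next i ⟨ p , m ⟩ ≡ just s → cost i m ≤ ℓ → Halts s n → Halts ⟨ p , m ⟩ (suc n)
    step! i f nx c (halts r g t≤) = halts (step f nx r) g (+-mono-≤ c t≤)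

    cost-op : ∀ o {m a} → (∀ i → m i ≤ V) → a ≤ V → cost (instr o (dir a)) m ≤ ℓ
    cost-op plus  {m} {a} b a≤ = ≤-trans (≤-reflexive (sym (+-assoc (size (m 0)) (size a) (size (m a))))) (sizes (b 0) a≤ (b a))
    cost-op minus {m} {a} b a≤ = ≤-trans (≤-reflexive (sym (+-assoc (size (m 0)) (size a) (size (m a))))) (sizes (b 0) a≤ (b a))
    cost-op times {m} {a} b a≤ = ≤-trans (≤-reflexive (sym (+-assoc (size (m 0)) (size a) (size (m a))))) (sizes (b 0) a≤ (b a))
    cost-op over  {m} {a} b a≤ = ≤-trans (≤-reflexive (sym (+-assoc (size (m 0)) (size a) (size (m a))))) (sizes (b 0) a≤ (b a))

    next-op : ∀ o a {p m} → next (instr o (dir a)) ⟨ p , m ⟩ ≡ just ⟨ suc p , m [ 0 ≔ ⟦ o ⟧ᵒ (m 0) (m a) ] ⟩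
    next-op plus  a = refl
    next-op minus a = refl
    next-op times a = refl
    next-op over  a = refl

    leaves>0 : ∀ e → 0 < leaves e
    leaves>0 (con _) = z<s
    leaves>0 (var _) = z<s
    leaves>0 (cell e) = ≤-trans (leaves>0 e) (m≤m+n _ 2)
    leaves>0 (bin _ a b) = ≤-trans (leaves>0 a) (m≤m+n _ _)

    X≤X^ : ∀ {n} → 0 < n → X ≤ X ^ n
    X≤X^ {n} 0<n = ≤-trans (≤-reflexive (sym (^-identityʳ X))) (^-monoʳ-≤ X {1} {n} 0<n)

    X^+ : ∀ a b {u v} → u ≤ X ^ a → v ≤ X ^ b → u * v ≤ X ^ (a + b)
    X^+ a b p q = ≤-trans (*-mono-≤ p q) (≤-reflexive (sym (^-distribˡ-+-* X a b)))

    a+b≤a*b : ∀ {a b} → 2 ≤ a → 2 ≤ b → a + b ≤ a * b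
    a+b≤a*b {a} {b} 2≤a 2≤b with ≤-total a b
    ... | inj₁ a≤b = ≤-trans (+-monoˡ-≤ b a≤b) (≤-trans (≤-reflexive (cong (λ z → b + z) (sym (+-identityʳ b)))) (*-monoˡ-≤ b 2≤a))
    ... | inj₂ b≤a = ≤-trans (+-monoʳ-≤ a b≤a) (≤-trans (≤-reflexive (trans (cong (λ z → a + z) (sym (+-identityʳ a))) (*-comm 2 a))) (*-monoʳ-≤ a 2≤b))

    2≤X^ : ∀ {n} → 0 < n → 2 ≤ X ^ n
    2≤X^ 0<n = ≤-trans (≤-trans (s≤s (s≤s z≤n)) 99<X) (X≤X^ 0<n)

    div₀≤ : ∀ a b → a div₀ b ≤ a
    div₀≤ a zero    = z≤n
    div₀≤ a (suc b) = m/n≤m a (suc b)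

    ⟦⟧ᵒ≤ : ∀ o a b {u v} → 0 < a → 0 < b → u ≤ X ^ a → v ≤ X ^ b → ⟦ o ⟧ᵒ u v ≤ X ^ (a + b)
    ⟦⟧ᵒ≤ plus a b 0<a 0<b p q = ≤-trans (+-mono-≤ p q) (≤-trans (a+b≤a*b (2≤X^ 0<a) (2≤X^ 0<b)) (≤-reflexive (sym (^-distribˡ-+-* X a b))))
    ⟦⟧ᵒ≤ minus a b {u} {v} _ _ p q = ≤-trans (m∸n≤m u v) (≤-trans p (^-monoʳ-≤ X (m≤m+n a b)))
    ⟦⟧ᵒ≤ times a b _ _ p q = X^+ a b p q
    ⟦⟧ᵒ≤ over a b {u} {v} _ _ p q = ≤-trans (div₀≤ u v) (≤-trans p (^-monoʳ-≤ X (m≤m+n a b)))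

    ⟦⟧≤ : ∀ e d {σ} → T (ok e d) → Bounded σ → ⟦ e ⟧ σ ≤ X ^ leaves e
    ⟦⟧≤ (con n) d p b = ≤-trans (≤ᵇ⇒≤ n 99 p) (≤-trans (<⇒≤ 99<X) (X≤X^ {1} z<s))
    ⟦⟧≤ (var r) d p b = ≤-trans (b r) (X≤X^ {1} z<s)
    ⟦⟧≤ (cell e) d p b = ≤-trans (b _) (X≤X^ (leaves>0 (cell e)))
    ⟦⟧≤ (bin o e f) d p b = ⟦⟧ᵒ≤ o (leaves e) (leaves f) (leaves>0 e) (leaves>0 f)
      (⟦⟧≤ e (suc d) (T-∧₁ p) b) (⟦⟧≤ f d (T-∧₁ (T-∧₂ {ok e (suc d)} p)) b)

    leaves≤ : ∀ e d → T (ok e d) → leaves e ≤ limit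
    leaves≤ (con n) d p = s≤s z≤n
    leaves≤ (var r) d p = s≤s z≤n
    leaves≤ (cell e) d p = ≤ᵇ⇒≤ _ _ (T-∧₂ {tmp d ≤ᵇ 99} (T-∧₂ {ok e d} p))
    leaves≤ (bin o e f) d p = ≤ᵇ⇒≤ _ _ (T-∧₂ {tmp d ≤ᵇ 99} (T-∧₂ {ok f d} (T-∧₂ {ok e (suc d)} p)))

    ⟦⟧≤V : ∀ e d {σ} → T (ok e d) → Bounded σ → ⟦ e ⟧ σ ≤ V
    ⟦⟧≤V e d p b = ≤-trans (⟦⟧≤ e d p b) (≤-trans (^-monoʳ-≤ X (leaves≤ e d p)) X^limit≤V)

    double≤ : ∀ {v} a → v ≤ X ^ a → suc (v + v) ≤ X ^ (a + 2)
    double≤ {v} a v≤ = begin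
      suc (v + v)              ≤⟨ s≤s (+-mono-≤ v≤ v≤) ⟩
      suc (X ^ a + X ^ a)      ≤⟨ +-mono-≤ (m^n>0 X a) ≤-refl ⟩
      X ^ a + (X ^ a + X ^ a)  ≡⟨ cong (λ z → X ^ a + (X ^ a + z)) (+-identityʳ (X ^ a)) ⟨
      3 * X ^ a                ≤⟨ *-monoˡ-≤ (X ^ a) (≤-trans (s≤s (s≤s (s≤s z≤n))) 99<X) ⟩
      X * X ^ a                ≤⟨ ^-monoʳ-≤ X (≤-trans (n≤1+n (suc a)) (≤-reflexive (+-comm 2 a))) ⟩
      X ^ (a + 2)              ∎
      where open ≤-Reasoning

    module _ {σ : Store} (bσ : Bounded σ) where

      -- Evaluation at height d may overwrite the temporaries from d on; those below hold operands
      -- of enclosing expressions and must survive.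
      eval : ∀ e d {o m n} → T (ok e d) → At P o (compE e d) → m ≈ σ →
             (∀ m′ → m′ ≈ σ → m′ 0 ≡ ⟦ e ⟧ σ → (∀ j → j < d → m′ (tmp j) ≡ m (tmp j)) → Halts ⟨ o + lenE e , m′ ⟩ n) →
             Halts ⟨ o , m ⟩ (lenE e + n)
      eval (con c) d {o} {m} {n} p (f , _) s k = step! (load (lit c)) f refl (sizes₁ (99≤V {c} p))
        (subst (λ z → Halts ⟨ z , m [ 0 ≔ c ] ⟩ n) (+-comm o 1) (k (m [ 0 ≔ c ]) (≈-acc s (99≤V {c} p)) refl (λ _ _ → refl)))
      eval (var r) d {o} {m} {n} p (f , _) s k = step! (load (dir (phys r))) f refl (sizes₂ (99≤V {phys r} p) (bounded s (phys r)))
        (subst (λ z → Halts ⟨ z , m [ 0 ≔ m (phys r) ] ⟩ n) (+-comm o 1) (k (m [ 0 ≔ m (phys r) ]) (≈-acc s (bounded s (phys r))) (agrees s r) (λ _ _ → refl)))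
      eval (cell e) d {o} {m} {n} p a s k = subst (Halts ⟨ o , m ⟩) (sym (+-assoc (lenE e) 5 n))
        (eval e d (T-∧₁ p) (proj₁ (At-E o e d a)) s rest)
        where
        p₁ : ℕ
        p₁ = o + lenE e
        v : ℕ
        v = ⟦ e ⟧ σ
        tmp≤ : tmp d ≤ V
        tmp≤ = 99≤V (T-∧₁ (T-∧₂ {ok e d} p))
        dv≤ : suc (v + v) ≤ V
        dv≤ = ≤-trans (double≤ (leaves e) (⟦⟧≤ e d (T-∧₁ p) bσ)) (≤-trans (^-monoʳ-≤ X (leaves≤ (cell e) d p)) X^limit≤V)
        -- The five instructions turn v into its register `phys v`, which is 2 v + 1, by adding v to
        -- itself, and load from there.
        rest : ∀ m′ → m′ ≈ σ → m′ 0 ≡ v → (∀ j → j < d → m′ (tmp j) ≡ m (tmp j)) → Halts ⟨ p₁ , m′ ⟩ (5 + n)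
        rest m′ s′ m′0 old with proj₂ (At-E o e d a)
        ... | f₁ , f₂ , f₃ , f₄ , f₅ , _ =
          step! _ f₁ refl (sizes₂ (bounded s′ 0) tmp≤)
          (step! _ f₂ refl (cost-op plus (bounded s₁) tmp≤)
          (step! _ f₃ refl (sizes₂ {m₂ 0} {1} (bounded s₂ 0) (99≤V {1} _))
          (step! _ f₄ refl (sizes₂ (bounded s₃ 0) tmp≤)
          (step! _ f₅ refl (sizes {tmp d} {m₄ (tmp d)} {m₄ (m₄ (tmp d))} tmp≤ (bounded s₄ (tmp d)) (bounded s₄ (m₄ (tmp d))))
            (subst (λ z → Halts ⟨ z , m₅ ⟩ n) pos (k m₅ s₅ value≡ old₅))))))
          where
          m₁ m₂ m₃ m₄ m₅ : Memory
          m₁ = m′ [ tmp d ≔ m′ 0 ]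
          m₂ = m₁ [ 0 ≔ m₁ 0 + m₁ (tmp d) ]
          m₃ = m₂ [ 0 ≔ m₂ 0 + 1 ]
          m₄ = m₃ [ tmp d ≔ m₃ 0 ]
          m₅ = m₄ [ 0 ≔ m₄ (m₄ (tmp d)) ]
          e₂ : m₂ 0 ≡ v + v
          e₂ = cong₂ _+_ m′0 (trans (≔-same m′ (tmp d) (m′ 0)) m′0)
          e₃ : m₃ 0 ≡ suc (v + v)
          e₃ = trans (+-comm (m₂ 0) 1) (cong suc e₂)
          e₄ : m₄ (tmp d) ≡ suc (v + v)
          e₄ = trans (≔-same m₃ (tmp d) (m₃ 0)) e₃
          s₁ : m₁ ≈ σ
          s₁ = ≈-tmp d s′ (bounded s′ 0)
          s₂ : m₂ ≈ σ
          s₂ = ≈-acc s₁ (subst (_≤ V) (sym e₂) (≤-trans (n≤1+n _) dv≤))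
          s₃ : m₃ ≈ σ
          s₃ = ≈-acc s₂ (subst (_≤ V) (sym e₃) dv≤)
          s₄ : m₄ ≈ σ
          s₄ = ≈-tmp d s₃ (bounded s₃ 0)
          s₅ : m₅ ≈ σ
          s₅ = ≈-acc s₄ (bounded s₄ (m₄ (tmp d)))
          value≡ : m₄ (m₄ (tmp d)) ≡ σ v
          value≡ = trans (cong m₄ e₄) (agrees s₄ v)
          keep : ∀ j → j < d → ∀ (m : Memory) u → (m [ tmp d ≔ u ]) (tmp j) ≡ m (tmp j)
          keep j j<d m u = ≔-other m u (λ eq → <⇒≢ j<d (sym (tmp-injective eq)))
          old₅ : ∀ j → j < d → m₅ (tmp j) ≡ m (tmp j)
          old₅ j j<d = trans (keep j j<d m₃ (m₃ 0)) (trans (keep j j<d m′ (m′ 0)) (old j j<d))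
          pos : o + (lenE e + 5) ≡ 5 + p₁
          pos = trans (sym (+-assoc o (lenE e) 5)) (+-comm p₁ 5)
      eval (bin op e f) d {o} {m} {n} p a s k = subst (Halts ⟨ o , m ⟩) cnt
        (eval f d okf (proj₁ (At-E o f d a)) s rest)
        where
        oke : T (ok e (suc d))
        oke = T-∧₁ p
        okf : T (ok f d)
        okf = T-∧₁ (T-∧₂ {ok e (suc d)} p)
        tmp≤ : tmp d ≤ V
        tmp≤ = 99≤V (T-∧₁ (T-∧₂ {ok f d} (T-∧₂ {ok e (suc d)} p)))
        cnt : lenE f + suc (lenE e + suc n) ≡ lenE f + suc (lenE e + 1) + n
        cnt = trans (cong (λ z → lenE f + suc z) (sym (+-assoc (lenE e) 1 n))) (sym (+-assoc (lenE f) (suc (lenE e + 1)) n))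
        rest : ∀ m′ → m′ ≈ σ → m′ 0 ≡ ⟦ f ⟧ σ → (∀ j → j < d → m′ (tmp j) ≡ m (tmp j)) →
               Halts ⟨ o + lenE f , m′ ⟩ (suc (lenE e + suc n))
        rest m′ s′ m′0 old with proj₂ (At-E o f d a)
        ... | f₁ , a₁ = step! _ f₁ refl (sizes₂ (bounded s′ 0) tmp≤)
            (eval e (suc d) oke (proj₁ (At-E (suc (o + lenE f)) e (suc d) a₁)) s₁ rest₂)
          where
          m₁ : Memory
          m₁ = m′ [ tmp d ≔ m′ 0 ]
          s₁ : m₁ ≈ σ
          s₁ = ≈-tmp d s′ (bounded s′ 0)
          rest₂ : ∀ m″ → m″ ≈ σ → m″ 0 ≡ ⟦ e ⟧ σ → (∀ j → j < suc d → m″ (tmp j) ≡ m₁ (tmp j)) →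
                  Halts ⟨ suc (o + lenE f) + lenE e , m″ ⟩ (suc n)
          rest₂ m″ s″ m″0 old″ = step! _ (proj₁ (proj₂ (At-E (suc (o + lenE f)) e (suc d) a₁))) (next-op op (tmp d))
              (cost-op op (bounded s″) tmp≤)
              (subst (λ z → Halts ⟨ z , m‴ ⟩ n) pos (k m‴ (≈-acc s″ (subst (_≤ V) (sym val) (⟦⟧≤V (bin op e f) d p bσ))) val old₂))
            where
            m‴ : Memory
            m‴ = m″ [ 0 ≔ ⟦ op ⟧ᵒ (m″ 0) (m″ (tmp d)) ]
            val : ⟦ op ⟧ᵒ (m″ 0) (m″ (tmp d)) ≡ ⟦ op ⟧ᵒ (⟦ e ⟧ σ) (⟦ f ⟧ σ)
            val = cong₂ ⟦ op ⟧ᵒ m″0 (trans (old″ d ≤-refl) (trans (≔-same m′ (tmp d) (m′ 0)) m′0))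
            old₂ : ∀ j → j < d → m″ (tmp j) ≡ m (tmp j)
            old₂ j j<d = trans (old″ j (m<n⇒m<1+n j<d)) (trans (≔-other m′ (m′ 0) (λ eq → <⇒≢ j<d (sym (tmp-injective eq)))) (old j j<d))
            pos : o + (lenE f + suc (lenE e + 1)) ≡ suc (suc (o + lenE f) + lenE e)
            pos = trans (sym (+-assoc o (lenE f) _)) (trans (+-suc (o + lenE f) (lenE e + 1)) (cong suc
              (trans (sym (+-assoc (o + lenE f) (lenE e) 1)) (+-comm (o + lenE f + lenE e) 1))))

    okStmt : Exp → Bool
    okStmt e = ok e 0 ∧ (lenE e ≤ᵇ 60)

    -- Total correctness within n instructions, in continuation-passing style: a statement that halts
    -- the machine ignores its continuation.
    record Tri (s : Stmt) (σ : Store) (n : ℕ) (Q : Store → Set) : Set where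
      field
        continue : ∀ {o m k} → At P o (comp s o) → Bounded σ → m ≈ σ →
          (∀ {σ′ m′} → Q σ′ → Bounded σ′ → m′ ≈ σ′ → Halts ⟨ o + len s , m′ ⟩ k) → Halts ⟨ o , m ⟩ (n + k)
    open Tri public

    Tri-≤ : ∀ {s σ a b Q} → a ≤ b → Tri s σ a Q → Tri s σ b Q
    continue (Tri-≤ a≤b t) {k = k} at bσ sim cont = Halts-≤ (+-monoˡ-≤ k a≤b) (continue t at bσ sim cont)

    Tri-conseq : ∀ {s σ n Q R} → (∀ {σ′} → Q σ′ → R σ′) → Tri s σ n Q → Tri s σ n R
    continue (Tri-conseq f t) at bσ sim cont = continue t at bσ sim (λ q → cont (f q))

    -- A statement is charged 64 instructions: at most 60 for evaluating its expression, 4 for the rest.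
    evalFirst : ∀ {σ} e {o m n c} → T (okStmt e) → Bounded σ → At P o (compE e 0 ++ c) → m ≈ σ →
            (At P (o + lenE e) c → ∀ m′ → m′ ≈ σ → m′ 0 ≡ ⟦ e ⟧ σ → Halts ⟨ o + lenE e , m′ ⟩ (4 + n)) → Halts ⟨ o , m ⟩ (64 + n)
    evalFirst e {o} {m} {n} p b at sim k = Halts-≤
      (≤-trans (+-monoˡ-≤ (4 + n) (≤ᵇ⇒≤ (lenE e) 60 (T-∧₂ {ok e 0} p))) ≤-refl)
      (eval b e 0 {n = 4 + n} (T-∧₁ p) (proj₁ (At-E o e 0 at)) sim (λ m′ sim′ eq _ → k (proj₂ (At-E o e 0 at)) m′ sim′ eq))

    tri-skip : ∀ {σ Q} → Q σ → Tri skip σ 0 Q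
    continue (tri-skip q) {o} {m} {k} _ bσ sim cont = subst (λ z → Halts ⟨ z , m ⟩ k) (+-identityʳ o) (cont q bσ sim)

    tri-← : ∀ {r e σ Q} {_ : T (okStmt e)} {_ : T (phys r ≤ᵇ 99)} → ⟦ e ⟧ σ ≤ X → Q (σ [ r ≔ ⟦ e ⟧ σ ]) → Tri (r ← e) σ 64 Q
    continue (tri-← {r} {e} {σ} {_} {p} {pr} v≤ q) {o} {m} {k} at bσ sim cont = evalFirst e {n = k} p bσ at sim λ where
      (f , _) m′ sim′ eq → Halts-≤ (m≤n+m (suc k) 3) (step! _ f refl (sizes₂ (bounded sim′ 0) (99≤V {phys r} pr))
        (subst₂ (λ z v → Halts ⟨ z , m′ [ phys r ≔ v ] ⟩ k) (trans (sym (+-assoc o (lenE e) 1)) (+-comm (o + lenE e) 1)) (sym eq)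
          (cont q (≔-≤ r bσ v≤) (≈-cell r sim′ (≤-trans v≤ X≤V)))))

    tri-⨾ : ∀ {s t σ a b R Q} → Tri s σ a R → (∀ {σ′} → R σ′ → Bounded σ′ → Tri t σ′ b Q) → Tri (s ⨾ t) σ (a + b) Q
    continue (tri-⨾ {s} {t} {σ} {a} {b} {R} ts tt′) {o} {m} {k} at bσ sim cont = subst (Halts ⟨ o , m ⟩) (sym (+-assoc a b k))
      (continue ts (proj₁ split) bσ sim λ {σ′} {m′} r bσ′ sim′ → continue (tt′ r bσ′) (proj₂ split) bσ′ sim′
        λ {_} {m″} q bσ″ sim″ → subst (λ z → Halts ⟨ z , m″ ⟩ k) (sym (+-assoc o (len s) (len t))) (cont q bσ″ sim″))
      where
      split : At P o (comp s o) × At P (o + len s) (comp t (o + len s))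
      split = At-S o s o at

    tri-cond : ∀ {e s t σ n Q} {_ : T (okStmt e)} → (⟦ e ⟧ σ ≢ 0 → Tri s σ n Q) → (⟦ e ⟧ σ ≡ 0 → Tri t σ n Q) →
               Tri (cond e s t) σ (64 + n) Q
    continue (tri-cond {e} {s} {t} {σ} {n} {Q} {p} ts tt′) {o} {m} {k} at bσ sim cont = evalFirst e {n = n + k} p bσ at sim go
      where
      p₁ p₂ : ℕ
      p₁ = suc (o + lenE e)
      p₂ = suc (p₁ + len s)
      end : p₂ + len t ≡ o + len (cond e s t)
      end = trans (cong suc (cong suc (trans (+-assoc (o + lenE e) (len s) (len t)) (+-assoc o (lenE e) (len s + len t)))))
        (sym (trans (cong (λ z → o + z) (trans (+-suc (lenE e) _) (cong suc (trans (cong (λ z → lenE e + z) (+-suc (len s) (len t))) (+-suc (lenE e) _)))))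
          (trans (+-suc o _) (cong suc (+-suc o _)))))
      go : At P (o + lenE e) (jzero p₂ ∷ comp s p₁ ++ jump (p₂ + len t) ∷ comp t p₂) → ∀ m′ → m′ ≈ σ → m′ 0 ≡ ⟦ e ⟧ σ →
           Halts ⟨ o + lenE e , m′ ⟩ (4 + (n + k))
      go (f , at₁) m′ sim′ eq = jump-on (⟦ e ⟧ σ) refl
        where
        at-s : At P p₁ (comp s p₁)
        at-s = proj₁ (At-S p₁ s p₁ at₁)
        at-t : fetch P (p₁ + len s) ≡ just (jump (p₂ + len t)) × At P p₂ (comp t p₂)
        at-t = proj₂ (At-S p₁ s p₁ at₁)
        branch : ∀ v → m′ 0 ≡ v → next (jzero p₂) ⟨ o + lenE e , m′ ⟩ ≡ just ⟨ (if v ≡ᵇ 0 then p₂ else p₁) , m′ ⟩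
        branch v refl = refl
        jump-on : ∀ v → ⟦ e ⟧ σ ≡ v → Halts ⟨ o + lenE e , m′ ⟩ (4 + (n + k))
        jump-on zero ev = Halts-≤ (m≤n+m (1 + (n + k)) 3) (step! _ f (branch 0 (trans eq ev)) (sizes₁ (bounded sim′ 0))
          (continue (tt′ ev) (proj₂ at-t) bσ sim′ λ {_} {m″} q b″ sim″ → subst (λ z → Halts ⟨ z , m″ ⟩ k) (sym end) (cont q b″ sim″)))
        jump-on (suc v) ev = Halts-≤ (≤-trans (≤-reflexive (cong suc (+-suc n k))) (m≤n+m (2 + (n + k)) 2))
          (step! _ f (branch (suc v) (trans eq ev)) (sizes₁ (bounded sim′ 0))
          (continue (ts (λ z → 0≢1+n (trans (sym z) ev))) at-s bσ sim′ λ {_} {m″} q b″ sim″ →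
            step! _ (proj₁ at-t) refl 1≤ℓ (subst (λ z → Halts ⟨ z , m″ ⟩ k) (sym end) (cont q b″ sim″))))

    tri-put : ∀ {a e σ Q} {_ : T (okStmt a)} {_ : T (ok e 1 ∧ (lenE e ≤ᵇ 60))} {_ : T (leaves a + 2 ≤ᵇ limit)} →
              ⟦ e ⟧ σ ≤ X → Q (σ [ ⟦ a ⟧ σ ≔ ⟦ e ⟧ σ ]) → Tri (put a e) σ 128 Q
    continue (tri-put {a} {e} {σ} {Q} {p} {q} {l} v≤ post) {o} {m} {k} at bσ sim cont = evalFirst a {n = 64 + k} p bσ at sim go
      where
      v w : ℕ
      v = ⟦ a ⟧ σ
      w = ⟦ e ⟧ σ
      p₁ : ℕ
      p₁ = o + lenE a
      dv≤ : suc (v + v) ≤ V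
      dv≤ = ≤-trans (double≤ (leaves a) (⟦⟧≤ a 0 (T-∧₁ p) bσ)) (≤-trans (^-monoʳ-≤ X {leaves a + 2} {limit} (≤ᵇ⇒≤ (leaves a + 2) limit l)) X^limit≤V)
      tmp≤ : tmp 0 ≤ V
      tmp≤ = 99≤V {2} _
      end : suc (4 + p₁ + lenE e) ≡ o + len (put a e)
      end = trans (cong (5 +_) (+-assoc o (lenE a) (lenE e))) (sym (trans (cong (λ z → o + (lenE a + (4 + z))) (+-comm (lenE e) 1))
        (trans (cong (λ z → o + z) (trans (+-comm (lenE a) (5 + lenE e)) (cong (5 +_) (+-comm (lenE e) (lenE a)))))
          (trans (+-comm o (5 + (lenE a + lenE e))) (cong (5 +_) (+-comm (lenE a + lenE e) o))))))
      go : At P p₁ (store (tmp 0) ∷ add (dir (tmp 0)) ∷ add (lit 1) ∷ store (tmp 0) ∷ compE e 1 ++ storeInd (tmp 0) ∷ []) →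
           ∀ m′ → m′ ≈ σ → m′ 0 ≡ v → Halts ⟨ p₁ , m′ ⟩ (4 + (64 + k))
      go (f₁ , f₂ , f₃ , f₄ , at₅) m′ s′ m′0 =
        step! _ f₁ refl (sizes₂ (bounded s′ 0) tmp≤)
        (step! _ f₂ refl (cost-op plus (bounded s₁) tmp≤)
        (step! _ f₃ refl (sizes₂ {m₂ 0} {1} (bounded s₂ 0) (99≤V {1} _))
        (step! _ f₄ refl (sizes₂ (bounded s₃ 0) tmp≤)
        (Halts-≤ (≤-trans (+-monoˡ-≤ (4 + k) (≤ᵇ⇒≤ (lenE e) 60 (T-∧₂ {ok e 1} q))) ≤-refl)
          (eval bσ e 1 {n = 4 + k} (T-∧₁ q) (proj₁ (At-E _ e 1 at₅)) s₄ last)))))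
        where
        m₁ m₂ m₃ m₄ : Memory
        m₁ = m′ [ tmp 0 ≔ m′ 0 ]
        m₂ = m₁ [ 0 ≔ m₁ 0 + m₁ (tmp 0) ]
        m₃ = m₂ [ 0 ≔ m₂ 0 + 1 ]
        m₄ = m₃ [ tmp 0 ≔ m₃ 0 ]
        e₂ : m₂ 0 ≡ v + v
        e₂ = cong₂ _+_ m′0 m′0
        e₃ : m₃ 0 ≡ suc (v + v)
        e₃ = trans (+-comm (m₂ 0) 1) (cong suc e₂)
        s₁ : m₁ ≈ σ
        s₁ = ≈-tmp 0 s′ (bounded s′ 0)
        s₂ : m₂ ≈ σ
        s₂ = ≈-acc s₁ (subst (_≤ V) (sym e₂) (≤-trans (n≤1+n _) dv≤))
        s₃ : m₃ ≈ σ
        s₃ = ≈-acc s₂ (subst (_≤ V) (sym e₃) dv≤)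
        s₄ : m₄ ≈ σ
        s₄ = ≈-tmp 0 s₃ (bounded s₃ 0)
        last : ∀ m″ → m″ ≈ σ → m″ 0 ≡ w → (∀ j → j < 1 → m″ (tmp j) ≡ m₄ (tmp j)) →
               Halts ⟨ suc (suc (suc (suc p₁))) + lenE e , m″ ⟩ (4 + k)
        last m″ s″ m″0 old = Halts-≤ (m≤n+m (suc k) 3) (step! _ (proj₁ (proj₂ (At-E _ e 1 at₅))) refl
          (sizes {m″ 0} {tmp 0} {m″ (tmp 0)} (bounded s″ 0) tmp≤ (bounded s″ (tmp 0)))
          (subst₂ (λ z u → Halts ⟨ z , m″ [ u ≔ m″ 0 ] ⟩ k) (sym end) (sym (trans (old 0 z<s) e₃))
            (subst (λ u → Halts ⟨ o + len (put a e) , m″ [ phys v ≔ u ] ⟩ k) (sym m″0)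
              (cont post (≔-≤ v bσ v≤) (≈-cell v s″ (≤-trans v≤ X≤V))))))

    -- The index of the invariant is the time that is left.
    tri-while : ∀ {e s Q} (I : ℕ → Store → Set) {_ : T (okStmt e)} →
                (∀ n σ → I n σ → Bounded σ →
                  (⟦ e ⟧ σ ≡ 0 × 64 ≤ n × Q σ) ⊎
                  (⟦ e ⟧ σ ≢ 0 × (∃[ b ] ∃[ n′ ] 64 + b + n′ ≤ n × Tri s σ b (I n′)))) →
                ∀ {n σ} → I n σ → Tri (while e s) σ n Q
    tri-while {e} {s} {Q} I {p} body {n₀} {σ₀} i₀ = <-rec (λ n → ∀ σ → I n σ → Tri (while e s) σ n Q) loop n₀ σ₀ i₀
      where
      loop : ∀ n → (∀ {n′} → n′ < n → ∀ σ → I n′ σ → Tri (while e s) σ n′ Q) → ∀ σ → I n σ → Tri (while e s) σ n Q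
      continue (loop n rec σ i) {o} {m} {k} at bσ sim cont = go (body n σ i bσ)
        where
        p₁ p₂ : ℕ
        p₁ = suc (o + lenE e)
        p₂ = suc (p₁ + len s)
        end : p₂ ≡ o + len (while e s)
        end = trans (cong suc (cong suc (+-assoc o (lenE e) (len s)))) (sym (trans (cong (λ z → o + (lenE e + suc z)) (+-comm (len s) 1))
          (trans (cong (λ z → o + z) (trans (+-suc (lenE e) _) (cong suc (+-suc (lenE e) _)))) (trans (+-suc o _) (cong suc (+-suc o _))))))
        branch : ∀ m′ v → m′ 0 ≡ v → next (jzero p₂) ⟨ o + lenE e , m′ ⟩ ≡ just ⟨ (if v ≡ᵇ 0 then p₂ else p₁) , m′ ⟩
        branch m′ v refl = refl
        go : (⟦ e ⟧ σ ≡ 0 × 64 ≤ n × Q σ) ⊎ (⟦ e ⟧ σ ≢ 0 × (∃[ b ] ∃[ n′ ] 64 + b + n′ ≤ n × Tri s σ b (I n′))) → Halts ⟨ o , m ⟩ (n + k)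
        go (inj₁ (ev , 64≤n , q)) = Halts-≤ (+-monoˡ-≤ k 64≤n) (evalFirst e {n = k} p bσ at sim λ where
          (f , _) m′ sim′ eq → Halts-≤ (m≤n+m (suc k) 3) (step! _ f (branch m′ 0 (trans eq ev)) (sizes₁ (bounded sim′ 0))
            (subst (λ z → Halts ⟨ z , m′ ⟩ k) (sym end) (cont q bσ sim′))))
        go (inj₂ (ev , b , n′ , le , t)) = Halts-≤ (≤-trans (≤-reflexive (sym (+-assoc (64 + b) n′ k))) (+-monoˡ-≤ k le))
          (evalFirst e {n = b + (n′ + k)} p bσ at sim run-body)
          where
          run-body : At P (o + lenE e) (jzero p₂ ∷ comp s p₁ ++ jump o ∷ []) → ∀ m′ → m′ ≈ σ → m′ 0 ≡ ⟦ e ⟧ σ →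
                     Halts ⟨ o + lenE e , m′ ⟩ (4 + (b + (n′ + k)))
          run-body (f , at₁) m′ sim′ eq = nonzero (⟦ e ⟧ σ) refl
            where
            nonzero : ∀ v → ⟦ e ⟧ σ ≡ v → Halts ⟨ o + lenE e , m′ ⟩ (4 + (b + (n′ + k)))
            nonzero zero    e0 = ⊥-elim (ev e0)
            nonzero (suc v) es = Halts-≤ (≤-trans (≤-reflexive (cong suc (+-suc b (n′ + k)))) (m≤n+m (2 + (b + (n′ + k))) 2))
              (step! _ f (branch m′ (suc v) (trans eq es)) (sizes₁ (bounded sim′ 0))
              (continue t (proj₁ (At-S p₁ s p₁ at₁)) bσ sim′ λ {σ″} {m″} i″ b″ sim″ →
                step! _ (proj₁ (proj₂ (At-S p₁ s p₁ at₁))) refl 1≤ℓ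
                  (continue (rec (≤-trans (s≤s (m≤n+m n′ (63 + b))) le) σ″ i″) at b″ sim″ cont)))

    -- Each of the n rounds pays for a test and the body; the extra 64 is the test that fails.
    tri-for : ∀ {e s Q} (I : ℕ → Store → Set) b {_ : T (okStmt e)} →
              (∀ n σ → I n σ → Bounded σ →
                (⟦ e ⟧ σ ≡ 0 × Q σ) ⊎ (⟦ e ⟧ σ ≢ 0 × (∃[ n′ ] n ≡ suc n′ × Tri s σ b (I n′)))) →
              ∀ {n σ} → I n σ → Tri (while e s) σ (n * (64 + b) + 64) Q
    tri-for {e} {s} {Q} I b {p} body {n} {σ} i = tri-while (λ t σ → ∃[ n ] t ≡ n * (64 + b) + 64 × I n σ) {p} step′ (n , refl , i)
      where
      step′ : ∀ t σ → (∃[ n ] t ≡ n * (64 + b) + 64 × I n σ) → Bounded σ →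
              (⟦ e ⟧ σ ≡ 0 × 64 ≤ t × Q σ) ⊎
              (⟦ e ⟧ σ ≢ 0 × (∃[ c ] ∃[ t′ ] 64 + c + t′ ≤ t × Tri s σ c (λ σ → ∃[ n ] t′ ≡ n * (64 + b) + 64 × I n σ)))
      step′ t σ (n , refl , i) bσ with body n σ i bσ
      ... | inj₁ (ev , q) = inj₁ (ev , m≤n+m 64 (n * (64 + b)) , q)
      ... | inj₂ (ev , n′ , refl , t) = inj₂ (ev , b , n′ * (64 + b) + 64 , ≤-reflexive (sym (+-assoc (64 + b) (n′ * (64 + b)) 64)) ,
              Tri-conseq (λ i′ → n′ , refl , i′) t)

    -- Q is arbitrary, since the machine halts and no later store is reached.
    tri-ret : ∀ {c e σ Q} {_ : T (okStmt e)} {_ : T (c ≤ᵇ 99)} →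
              (∀ {m} → m 0 ≡ c → m 1 ≡ ⟦ e ⟧ σ → Good m) → Tri (ret c e) σ 64 Q
    continue (tri-ret {c} {e} {σ} {Q} {p} {pc} g) {o} {m} {k} at bσ sim cont = evalFirst e {n = k} p bσ at sim λ where
      (f₁ , f₂ , f₃ , _) m′ sim′ eq → Halts-≤ (m≤n+m (3 + k) 1) (
        step! _ f₁ refl (sizes₂ (bounded sim′ 0) (99≤V {1} _))
        (step! _ f₂ refl (sizes₁ (99≤V {c} pc))
          (halts (stop f₃) (g refl eq) (≤-trans 1≤ℓ (m≤m+n ℓ (k * ℓ))))))

-- The algorithm as a program of the while language.

module Algorithm where

  open import Defs using (Program; Run; input; load; store; dir; Memory; Output; element; factor; isPrime; decode; Correct; size; _div₀_; _[_≔_])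
  open import Data.Bool.Base using (true; false; T; _∧_; _∨_)
  open import Data.Integer.Base as ℤ using (ℤ; +_; 1ℤ)
  import Data.Integer.Properties as ℤₚ
  open import Data.List.Base using (_∷_)
  open import Data.Nat.Base
  open import Data.Nat.Coprimality as Cop using (Coprime)
  open import Data.Nat.Divisibility
  open import Data.Nat.DivMod
  open import Data.Nat.Primality
  open import Data.Nat.Properties

  open Congruences
  open RootsOfUnity

  open Arithmetic
  open Compiler

  -- The cells of the store: 0 D, 1 N, 2 K, 3 M, 4 g (an element of order M), 5 a, 6 x = a ^ M,
  -- 7-9 base, exponent and result of powmod, 10 and 11 loop variables, 12 giant stride x ^ K,
  -- 13 m (the order of x), 14 q (a prime factor of m), 15 M₀ and 16 q ^ α, where M = M₀ * q ^ α.
  -- The table of baby steps starts at 20 + M * N; as M grows, every table lies in fresh cells.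
  powmod : Stmt
  powmod = 9 ← con 1 ⨾ while (var 8)
    ( cond (var 8 ⊘% con 2) (9 ← var 9 ⊠ var 7 ⊘% var 1) skip
    ⨾ 7 ← var 7 ⊠ var 7 ⊘% var 1
    ⨾ 8 ← var 8 ⊘ con 2 )

  slot : Exp
  slot = con 20 ⊞ var 3 ⊠ var 1 ⊞ var 11

  -- Conditions are numbers: a truncated difference is nonzero exactly for a strict inequality,
  -- `con 1 ⊟ c` tests for 0, and a product is a conjunction. The giant steps thus go on while the
  -- index is at most K and the slot is empty.
  babySteps giantSteps babyGiant : Stmt
  babySteps = while (var 2 ⊟ var 10)
    ( put slot (var 10 ⊞ con 1)
    ⨾ 11 ← var 11 ⊠ var 6 ⊘% var 1
    ⨾ 10 ← var 10 ⊞ con 1 )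
  giantSteps = while ((var 2 ⊞ con 1 ⊟ var 10) ⊠ (con 1 ⊟ cell slot))
    ( 10 ← var 10 ⊞ con 1
    ⨾ 11 ← var 11 ⊠ var 12 ⊘% var 1 )
  babyGiant = 10 ← con 0 ⨾ 11 ← con 1 ⨾ babySteps ⨾
    12 ← var 11 ⨾ 10 ← con 1 ⨾ giantSteps ⨾
    cond (var 10 ⊟ var 2) (ret 1 (var 6)) skip ⨾
    -- The slot holds j + 1, so this is i K - j.
    13 ← var 10 ⊠ var 2 ⊞ con 1 ⊟ cell slot

  -- Trial division ends at a divisor of m or once q² exceeds m; in the latter case, if q does not
  -- divide m, then m itself is prime.
  primeFactor : Stmt
  primeFactor = 14 ← con 2 ⨾
    while ((var 13 ⊞ con 1 ⊟ var 14 ⊠ var 14) ⊠ (var 13 ⊘% var 14)) (14 ← var 14 ⊞ con 1) ⨾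
    cond (var 13 ⊘% var 14) (14 ← var 13) skip

  split extend heavy : Stmt
  split = 15 ← var 3 ⨾ 16 ← con 1 ⨾
    while (con 1 ⊟ var 15 ⊘% var 14) (15 ← var 15 ⊘ var 14 ⨾ 16 ← var 16 ⊠ var 14)
  extend = 7 ← var 5 ⨾ 8 ← var 13 ⊘ var 14 ⨾ powmod ⨾ 6 ← var 9 ⨾
    split ⨾
    7 ← var 6 ⨾ 8 ← var 15 ⨾ powmod ⨾ 11 ← var 9 ⨾
    7 ← var 4 ⨾ 8 ← var 16 ⨾ powmod ⨾ 4 ← var 9 ⊠ var 11 ⊘% var 1 ⨾
    3 ← var 3 ⊠ var 14 ⨾
    cond (var 3 ⊟ var 0) (ret 1 (var 4)) skip
  heavy = 6 ← var 9 ⨾ babyGiant ⨾ primeFactor ⨾ extend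

  -- After `heavy` the same a is examined again, because M has gained only one prime factor and a ^
  -- M need not be 1 yet.
  scan-body scan : Stmt
  scan-body =
    -- For small N the scan can reach a = N before it reaches 2 K. No smaller a has divided N by
    -- then, so N is prime.
    cond (var 1 ⊘% var 5) skip (cond (var 1 ⊟ var 5) (ret 2 (var 5)) (ret 3 (con 0))) ⨾
    7 ← var 5 ⨾ 8 ← var 3 ⨾ powmod ⨾
    cond (var 9 ⊟ con 1) heavy (5 ← var 5 ⊞ con 1)
  scan = 3 ← con 2 ⨾ 4 ← var 1 ⊟ con 1 ⨾ 5 ← con 2 ⨾
    while (var 2 ⊞ var 2 ⊞ con 1 ⊟ var 5) scan-body

  -- The sum vanishes exactly if both summands do, that is, if j + 1 divides N and j + 2 ≤ N, with j
  -- in cell 11.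
  candidate candidates : Stmt
  candidate = cond ((var 1 ⊘% (var 11 ⊞ con 1)) ⊞ (var 11 ⊞ con 2 ⊟ var 1)) skip (ret 2 (var 11 ⊞ con 1))
  candidates = 10 ← con 1 ⨾
    while (var 2 ⊞ con 1 ⊟ var 10)
      ( cond (var 3 ⊘% var 10) skip (11 ← var 10 ⨾ candidate ⨾ 11 ← var 3 ⊘ var 10 ⨾ candidate)
      ⨾ 10 ← var 10 ⊞ con 1 )

  root : Stmt
  root = 2 ← con 1 ⨾ while (var 0 ⊞ con 1 ⊟ var 2 ⊠ var 2) (2 ← var 2 ⊞ con 1)

  algorithm : Stmt
  algorithm = root ⨾ scan ⨾ candidates ⨾ ret 3 (con 0)

  -- The input D is already in register 1, which is `phys 0`. But N arrives in register 2, a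
  -- temporary, and is moved to register 3, which is `phys 1`.
  loader : Stmt → Program
  loader s = load (dir 2) ∷ store 3 ∷ comp s 2

  Good : ℕ → ℕ → Memory → Set
  Good D N m = Σ[ o ∈ Output ] decode m ≡ just o × Correct D N o

  good-element : ∀ {D N v m} → Correct D N (element v) → m 0 ≡ 1 → m 1 ≡ v → Good D N m
  good-element {m = m} c e₀ refl = element (m 1) , dec (m 0) refl e₀ , c
    where
    dec : ∀ k → m 0 ≡ k → k ≡ 1 → decode m ≡ just (element (m 1))
    dec k eq refl rewrite eq = refl

  good-factor : ∀ {D N v m} → Correct D N (factor v) → m 0 ≡ 2 → m 1 ≡ v → Good D N m
  good-factor {m = m} c e₀ refl = factor (m 1) , dec (m 0) refl e₀ , c
    where
    dec : ∀ k → m 0 ≡ k → k ≡ 2 → decode m ≡ just (factor (m 1))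
    dec k eq refl rewrite eq = refl

  good-prime : ∀ {D N m} → Prime N → m 0 ≡ 3 → Good D N m
  good-prime {m = m} c e₀ = isPrime , dec (m 0) refl e₀ , c
    where
    dec : ∀ k → m 0 ≡ k → k ≡ 3 → decode m ≡ just isPrime
    dec k eq refl rewrite eq = refl

  div₀≡/ : ∀ x y .{{_ : NonZero y}} → x div₀ y ≡ x / y
  div₀≡/ x (suc y) = refl

  mod≡% : ∀ x y .{{_ : NonZero y}} → x ∸ (x div₀ y) * y ≡ x % y
  mod≡% x y@(suc _) = sym (m%n≡m∸m/n*n x y)

  Outside : ℕ → ℕ → Store → Store → Set
  Outside lo hi σ σ′ = ∀ k → T ((k <ᵇ lo) ∨ (hi <ᵇ k)) → σ′ k ≡ σ k

  -- The sums are nested as the rules of the logic produce them, so that they match without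
  -- rearrangement.
  module Costs (K S : ℕ) where

    powerCost : ℕ
    powerCost = 64 + (S * (64 + (128 + (64 + 64))) + 64)

    babyGiantCost : ℕ
    babyGiantCost = 64 + (64 + ((K * (64 + 256) + 64) + (64 + (64 + ((K * (64 + 128) + 64) + ((64 + 64) + 64))))))

    trialCost : ℕ
    trialCost = 64 + (((K ∸ 1) * (64 + 64) + 64) + (64 + 64))

    splitCost : ℕ
    splitCost = 64 + (64 + (S * (64 + 128) + 64))

    extendCost : ℕ
    extendCost = 64 + (64 + (powerCost + (64 + (splitCost + (64 + (64 + (powerCost + (64 + (64 + (64 + (powerCost + (64 + (64 + (64 + 64))))))))))))))

    heavyCost : ℕ
    heavyCost = 64 + (babyGiantCost + (trialCost + extendCost))

    bodyCost : ℕ → ℕ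
    bodyCost c = (64 + 128) + (64 + (64 + (powerCost + c)))

    lightCost heavyStep : ℕ
    lightCost = 64 + bodyCost (64 + 64)
    heavyStep = 64 + bodyCost (64 + heavyCost)

    scanCost : ℕ
    scanCost = 64 + (64 + (64 + ((2 * K ∸ 1) * lightCost + S * heavyStep + 64)))

    candidatesCost : ℕ
    candidatesCost = 64 + (K * (64 + ((64 + (64 + (128 + (64 + 128)))) + 64)) + 64)

    rootCost : ℕ
    rootCost = 64 + (K * (64 + 64) + 64)

    totalCost : ℕ
    totalCost = rootCost + (scanCost + (candidatesCost + 64))

  -- Correctness and running time of the program.

  module Verify {D N K : ℕ} (2≤D : 2 ≤ D) (D<N : D < N) (0<K : 0 < K) (D<K² : D < K * K) ([K-1]²≤D : (K ∸ 1) * (K ∸ 1) ≤ D)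
                (P : Program) {X V ℓ S : ℕ} (99<X : 99 < X) (X^limit≤V : X ^ limit ≤ V) (3*size≤ℓ : 3 * size V ≤ ℓ)
                (cube≤X : (100 + N) * ((100 + N) * (100 + N)) ≤ X) (X<2^S : X < 2 ^ S) where

    open Logic P (Good D N) {X} {V} {ℓ} 99<X X^limit≤V 3*size≤ℓ

    open Costs K S

    private
      Y : ℕ
      Y = 100 + N

    instance
      N≢0 : NonZero N
      N≢0 = >-nonZero (≤-<-trans z≤n D<N)
      K≢0 : NonZero K
      K≢0 = >-nonZero 0<K

    3≤N : 3 ≤ N
    3≤N = ≤-<-trans 2≤D D<N

    1<N : 1 < N
    1<N = <-trans (n<1+n 1) 3≤N

    N≤Y : N ≤ Y
    N≤Y = m≤n+m N 100

    Y²≤X : ∀ {v} → v ≤ Y * Y → v ≤ X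
    Y²≤X v≤ = ≤-trans v≤ (≤-trans (m≤n*m (Y * Y) Y) cube≤X)

    Y≤X : ∀ {v} → v ≤ Y → v ≤ X
    Y≤X v≤ = Y²≤X (≤-trans v≤ (m≤m*n Y Y))

    <N⇒≤X : ∀ {v} → v < N → v ≤ X
    <N⇒≤X v<N = Y≤X (≤-trans (<⇒≤ v<N) N≤Y)

    con≤X : ∀ n {_ : T (n ≤ᵇ 99)} → n ≤ X
    con≤X n {p} = Y≤X (≤-trans (≤ᵇ⇒≤ n 99 p) (≤-trans (n≤1+n 99) (m≤m+n 100 N)))

    asg : ∀ {r e t σ b Q} {_ : T (okStmt e)} {_ : T (phys r ≤ᵇ 99)} → ⟦ e ⟧ σ ≤ X →
          Tri t (σ [ r ≔ ⟦ e ⟧ σ ]) b Q → Tri (r ← e ⨾ t) σ (64 + b) Q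
    asg {r} {e} {t} {σ} {b} {Q} {p} {q} v≤ k = tri-⨾ {R = λ σ′ → σ′ ≡ σ [ r ≔ ⟦ e ⟧ σ ]} (tri-← {r} {e} {_} {_} {p} {q} v≤ refl) λ where refl _ → k

    mod-N≡% : ∀ {x} (q : ℕ) → x ≡ N → (q ∸ (q div₀ x) * x) ≡ q % N
    mod-N≡% q refl = mod≡% q N

    mod<N : ∀ {x} q → x ≡ N → (q ∸ (q div₀ x) * x) < N
    mod<N q eq = subst (_< N) (sym (mod-N≡% q eq)) (m%n<n q N)

    mod≤X : ∀ {x} q → x ≡ N → (q ∸ (q div₀ x) * x) ≤ X
    mod≤X q eq = <N⇒≤X (mod<N q eq)

    modᶜ : ∀ {x} q → x ≡ N → + (q ∸ (q div₀ x) * x) ≅ + q ⟨ N ⟩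
    modᶜ q eq = ≅-trans (≅-reflexive (cong +_ (mod-N≡% q eq))) (%-≅ q)

    -- Square and multiply; n bounds the number of binary digits of the exponent that are left.
    record PowerInv (σ₀ : Store) (n : ℕ) (σ : Store) : Set where
      field
        exponent : σ 8 < 2 ^ n
        below    : σ 9 < N
        value≅   : + σ 9 ℤ.* (+ σ 7) ℤ.^ σ 8 ≅ (+ σ₀ 7) ℤ.^ σ₀ 8 ⟨ N ⟩
        same     : Outside 7 9 σ₀ σ

    tri-power : ∀ {σ} → σ 1 ≡ N → Bounded σ →
                Tri powmod σ powerCost (λ σ′ → σ′ 9 < N × + σ′ 9 ≅ (+ σ 7) ℤ.^ σ 8 ⟨ N ⟩ × Outside 7 9 σ σ′)
    tri-power {σ₀} σ₁≡N bσ₀ = asg (con≤X 1) (tri-for (PowerInv σ₀) (128 + (64 + 64)) step {S} (record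
        { exponent = ≤-<-trans (bσ₀ 8) X<2^S
        ; below    = 1<N
        ; value≅   = ≅-reflexive (ℤₚ.*-identityˡ _)
        ; same     = init }))
      where
      init : Outside 7 9 σ₀ (σ₀ [ 9 ≔ 1 ])
      init k o = ≔-other σ₀ {9} {k} 1 λ where refl → o
      step : ∀ n σ → PowerInv σ₀ n σ → Bounded σ →
             (σ 8 ≡ 0 × (σ 9 < N × + σ 9 ≅ (+ σ₀ 7) ℤ.^ σ₀ 8 ⟨ N ⟩ × Outside 7 9 σ₀ σ)) ⊎
             (σ 8 ≢ 0 × (∃[ n′ ] n ≡ suc n′ × Tri _ σ (128 + (64 + 64)) (PowerInv σ₀ n′)))
      step n σ inv bσ = go n (σ 8) refl refl
        where
        open PowerInv inv
        σ1 : σ 1 ≡ N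
        σ1 = trans (same 1 _) σ₁≡N
        b e r : ℕ
        b = σ 7
        e = σ 8
        r = σ 9
        -- The state between multiplication and squaring: the lowest digit of the exponent has been
        -- transferred to the result, and b² remains to be raised to e / 2.
        Half : Store → Set
        Half σ′ = σ′ 7 ≡ b × σ′ 8 ≡ e × σ′ 9 < N × + σ′ 9 ℤ.* (+ b ℤ.* + b) ℤ.^ (e / 2) ≅ + r ℤ.* (+ b) ℤ.^ e ⟨ N ⟩ × Outside 7 9 σ₀ σ′
        halves : ∀ k → (+ b ℤ.* + b) ℤ.^ k ≡ (+ b) ℤ.^ (k * 2)
        halves k = trans (cong (λ z → (+ b ℤ.* z) ℤ.^ k) (sym (ℤₚ.*-identityʳ (+ b)))) (trans (ℤₚ.^-*-assoc (+ b) 2 k) (cong ((+ b) ℤ.^_) (*-comm 2 k)))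
        e≡ : e ≡ e % 2 + e / 2 * 2
        e≡ = m≡m%n+[m/n]*n e 2
        odd≡1 : e % 2 ≢ 0 → e % 2 ≡ 1
        odd≡1 ne = ≤-antisym (s≤s⁻¹ (m%n<n e 2)) (n≢0⇒n>0 ne)
        outside-9 : ∀ {v} {σ : Store} → Outside 7 9 σ₀ σ → Outside 7 9 σ₀ (σ [ 9 ≔ v ])
        outside-9 {v} {σ} s k o = trans (≔-other σ {9} {k} v λ where refl → o) (s k o)
        outside-78 : ∀ {v w} {σ : Store} → Outside 7 9 σ₀ σ → Outside 7 9 σ₀ (σ [ 7 ≔ v ] [ 8 ≔ w ])
        outside-78 {v} {w} {σ} s k o = trans (≔-other (σ [ 7 ≔ v ]) {8} {k} w λ where refl → o) (trans (≔-other σ {7} {k} v λ where refl → o) (s k o))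
        multiply : e ∸ e / 2 * 2 ≢ 0 → Tri (9 ← var 9 ⊠ var 7 ⊘% var 1) σ 64 Half
        multiply ne = tri-← (mod≤X (r * b) σ1) (refl , refl , mod<N (r * b) σ1 ,
            ≅-trans (≅-* (≅-trans (modᶜ (r * b) σ1) (≅-reflexive (ℤₚ.pos-* r b))) (≅-refl {a = (+ b ℤ.* + b) ℤ.^ (e / 2)}))
              (≅-reflexive (trans (ℤₚ.*-assoc (+ r) (+ b) _) (cong (λ z → + r ℤ.* z) (trans (cong (λ z → + b ℤ.* z) (halves (e / 2)))
                (cong ((+ b) ℤ.^_) (sym (trans e≡ (cong (_+ e / 2 * 2) (odd≡1 (λ z → ne (trans (mod≡% e 2) z))))))))))) , outside-9 same)
        even : e ∸ e / 2 * 2 ≡ 0 → Half σ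
        even ev = refl , refl , below , ≅-reflexive (cong (λ z → + r ℤ.* z) (trans (halves (e / 2))
            (cong ((+ b) ℤ.^_) (sym (trans e≡ (cong (_+ e / 2 * 2) (trans (sym (mod≡% e 2)) ev)))))))  , same
        square : ∀ n′ → n ≡ suc n′ → ∀ {σ′} → Half σ′ → Bounded σ′ →
                 Tri (7 ← var 7 ⊠ var 7 ⊘% var 1 ⨾ 8 ← var 8 ⊘ con 2) σ′ (64 + 64) (PowerInv σ₀ n′)
        square n′ n≡ {σ′} (b≡ , e≡ , r<N , val , same′) bσ′ = asg (mod≤X (σ′ 7 * σ′ 7) σ′1)
            (tri-← (≤-trans (m/n≤m (σ′ 8) 2) (bσ′ 8)) (record
              { exponent = m<n*o⇒m/o<n (subst₂ _<_ (sym e≡) (trans (cong (2 ^_) n≡) (*-comm 2 (2 ^ n′))) exponent)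
              ; below = r<N
              ; value≅ = ≅-trans (≅-* (≅-refl {a = + σ′ 9}) (≅-trans (≅-^ (σ′ 8 / 2) (≅-trans (modᶜ (σ′ 7 * σ′ 7) σ′1) (≅-reflexive (ℤₚ.pos-* (σ′ 7) (σ′ 7)))))
                    (≅-reflexive (cong₂ (λ x y → (+ x ℤ.* + x) ℤ.^ (y / 2)) b≡ e≡)))) (≅-trans val value≅)
              ; same = outside-78 same′ }))
          where
          σ′1 : σ′ 1 ≡ N
          σ′1 = trans (same′ 1 _) σ₁≡N
        go : ∀ n′ e′ → n ≡ n′ → e ≡ e′ →
             (e ≡ 0 × (σ 9 < N × + σ 9 ≅ (+ σ₀ 7) ℤ.^ σ₀ 8 ⟨ N ⟩ × Outside 7 9 σ₀ σ)) ⊎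
             (e ≢ 0 × (∃[ n′ ] n ≡ suc n′ × Tri _ σ (128 + (64 + 64)) (PowerInv σ₀ n′)))
        go _ zero _ e≡0 = inj₁ (e≡0 , below , ≅-trans (≅-reflexive (sym (trans (cong (λ z → + r ℤ.* (+ b) ℤ.^ z) e≡0) (ℤₚ.*-identityʳ (+ r))))) value≅ , same)
        go zero (suc _) n≡ e≡s = ⊥-elim (<⇒≱ (subst (λ z → e < 2 ^ z) n≡ exponent) (subst (1 ≤_) (sym e≡s) z<s))
        go (suc n′) (suc _) n≡ e≡s = inj₂ ((λ z → 0≢1+n (trans (sym z) e≡s)) , n′ , n≡ ,
          tri-⨾ {R = Half} (tri-cond multiply (λ ev → Tri-≤ z≤n (tri-skip (even ev)))) (square n′ n≡))

    K≤N : K ≤ N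
    K≤N = ≤-trans (K≤1+D K [K-1]²≤D) D<N
      where
      K≤1+D : ∀ K → (K ∸ 1) * (K ∸ 1) ≤ D → K ≤ suc D
      K≤1+D zero    _ = z≤n
      K≤1+D (suc zero) _ = s≤s z≤n
      K≤1+D (suc (suc k)) le = s≤s (≤-trans (m≤m*n (suc k) (suc k)) le)

    Below10 : Store → Store → Set
    Below10 σ σ′ = ∀ k → T (k <ᵇ 10) → σ′ k ≡ σ k

    -- A table entry 0 means that no baby step was recorded, so untouched cells already form an
    -- empty table.
    ZeroFrom : ℕ → Store → Set
    ZeroFrom b σ = ∀ t → b ≤ t → σ (20 + t) ≡ 0

    module _ {σ₀ : Store} (σ₀1 : σ₀ 1 ≡ N) (σ₀2 : σ₀ 2 ≡ K) (x<N : σ₀ 6 < N) (cop : Coprime (σ₀ 6) N)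
             (zeros₀ : ZeroFrom (σ₀ 3 * N) σ₀) where

      open BabyGiant N (σ₀ 6) K cop

      private
        x base : ℕ
        x = σ₀ 6
        base = σ₀ 3 * N

      record Table (i : ℕ) (σ : Store) : Set where
        field
          entries : ∀ v → v < N → Entry i v (σ (20 + (base + v)))
          zeros   : ZeroFrom (base + N) σ
          same    : Below10 σ₀ σ
      open Table

      slot≡ : ∀ {i σ} → Table i σ → ⟦ slot ⟧ σ ≡ 20 + (base + σ 11)
      slot≡ {σ = σ} t = trans (cong₂ (λ a b → 20 + a * b + σ 11) (same t 3 _) (trans (same t 1 _) σ₀1)) (+-assoc 20 base (σ 11))

      record Baby (n : ℕ) (σ : Store) : Set where
        field
          left  : n + σ 10 ≡ K
          baby  : σ 11 ≡ pw (σ 10)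
          table : Table (σ 10) σ

      tri-babySteps : ∀ {n σ} → Baby n σ → Tri babySteps σ (n * (64 + 256) + 64) (Baby 0)
      tri-babySteps = tri-for Baby 256 step
        where
        step : ∀ n σ → Baby n σ → Bounded σ → (σ 2 ∸ σ 10 ≡ 0 × Baby 0 σ) ⊎ (σ 2 ∸ σ 10 ≢ 0 × (∃[ n′ ] n ≡ suc n′ × Tri _ σ 256 (Baby n′)))
        step zero σ inv bσ = inj₁ (trans (cong₂ _∸_ (trans (same table 2 _) σ₀2) left) (n∸n≡0 K) , inv)
          where open Baby inv
        step (suc n) σ inv bσ = inj₂ (m>n⇒m∸n≢0 (<-≤-trans i<K (≤-reflexive (sym σ2))) , n , refl ,
            tri-⨾ {R = λ σ′ → σ′ ≡ τ₁} (tri-put i+1≤X refl) λ where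
              refl _ → asg (mod≤X (σ 11 * σ 6) σ1) (tri-← i+1≤X (record { left = trans (cong (λ z → n + z) (+-comm (σ 10) 1)) (trans (+-suc n (σ 10)) left)
                                                                        ; baby = baby′ ; table = table′ })))
          where
          open Baby inv
          i : ℕ
          i = σ 10
          σ1 : σ 1 ≡ N
          σ1 = trans (same table 1 _) σ₀1
          σ2 : σ 2 ≡ K
          σ2 = trans (same table 2 _) σ₀2
          i<K : i < K
          i<K = subst (i <_) left (s≤s (m≤n+m i n))
          i+1≤X : i + 1 ≤ X
          i+1≤X = ≤-trans (≤-reflexive (+-comm i 1)) (Y≤X (≤-trans i<K (≤-trans K≤N N≤Y)))
          τ₁ τ : Store
          τ₁ = σ [ ⟦ slot ⟧ σ ≔ i + 1 ]
          τ = τ₁ [ 11 ≔ σ 11 * σ 6 ∸ (σ 11 * σ 6) div₀ σ 1 * σ 1 ] [ 10 ≔ i + 1 ]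
          i+1 : suc i ≡ i + 1
          i+1 = +-comm 1 i
          baby′ : σ 11 * σ 6 ∸ (σ 11 * σ 6) div₀ σ 1 * σ 1 ≡ pw (i + 1)
          baby′ = trans (mod-N≡% (σ 11 * σ 6) σ1) (trans (cong₂ (λ a b → a * b % N) baby (same table 6 _)) (trans (pw-suc i) (cong pw i+1)))
          addr : ⟦ slot ⟧ σ ≡ 20 + (base + pw i)
          addr = trans (slot≡ table) (cong (λ z → 20 + (base + z)) baby)
          entry : ∀ v → v < N → Dec (pw i ≡ v) → Entry (suc i) v (τ₁ (20 + (base + v)))
          entry v v<N (yes refl) = subst (Entry (suc i) v) (sym (trans (cong (λ a → (σ [ a ≔ i + 1 ]) (20 + (base + pw i))) addr)
            (trans (≔-same σ (20 + (base + pw i)) (i + 1)) (sym i+1)))) (entry-hit i)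
          entry v v<N (no ne) = subst (Entry (suc i) v) (sym (trans (cong (λ a → (σ [ a ≔ i + 1 ]) (20 + (base + v))) addr)
            (≔-other σ {20 + (base + pw i)} {20 + (base + v)} (i + 1) λ eq → ne (+-cancelˡ-≡ base _ _ (+-cancelˡ-≡ 20 _ _ eq))))) (entry-miss ne (entries table v v<N))
          table′ : Table (i + 1) τ
          table′ = record
            { entries = λ v v<N → subst (λ k → Entry k v (τ₁ (20 + (base + v)))) i+1 (entry v v<N (pw i ≟ v))
            ; zeros = λ t le → trans (trans (cong (λ a → (σ [ a ≔ i + 1 ]) (20 + t)) addr)
                (≔-other σ {20 + (base + pw i)} {20 + t} (i + 1) λ eq → <⇒≢ (<-≤-trans (+-monoʳ-< base (m%n<n (x ^ i) N)) le) (+-cancelˡ-≡ 20 _ _ eq)))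
                (zeros table t le)
            ; same = λ k o → trans (low k o) (same table k o) }
            where
            low : ∀ k → T (k <ᵇ 10) → τ k ≡ σ k
            low k o = trans (≔-other (τ₁ [ 11 ≔ _ ]) {10} {k} _ λ where refl → o) (trans (≔-other τ₁ {11} {k} _ λ where refl → o)
              (trans (cong (λ a → (σ [ a ≔ i + 1 ]) k) addr) (≔-other σ {20 + (base + pw i)} {k} (i + 1) λ where refl → o)))

      record Giant (n : ℕ) (σ : Store) : Set where
        field
          left   : n + σ 10 ≡ suc K
          0<i    : 0 < σ 10
          giant  : σ 11 ≡ pw (σ 10 * K)
          stride : σ 12 ≡ pw K
          missed : Missed (σ 10)
          table  : Table K σ

      Stopped : Store → Set
      Stopped σ = (∃[ n ] Giant n σ) × (σ 10 ≡ suc K ⊎ σ (⟦ slot ⟧ σ) ≢ 0)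

      giant-entry : ∀ {n σ} → Giant n σ → Entry K (pw (σ 10 * K)) (σ (⟦ slot ⟧ σ))
      giant-entry {σ = σ} inv = subst (λ a → Entry K (pw (σ 10 * K)) (σ a)) (sym (trans (slot≡ table) (cong (λ z → 20 + (base + z)) giant)))
          (entries table _ (m%n<n _ N))
        where open Giant inv

      tri-giantSteps : ∀ {n σ} → Giant n σ → Tri giantSteps σ (n * (64 + 128) + 64) Stopped
      tri-giantSteps = tri-for Giant 128 step
        where
        Result : ℕ → Store → Set
        Result n σ = ((σ 2 + 1 ∸ σ 10) * (1 ∸ σ (⟦ slot ⟧ σ)) ≡ 0 × Stopped σ) ⊎
                     ((σ 2 + 1 ∸ σ 10) * (1 ∸ σ (⟦ slot ⟧ σ)) ≢ 0 × (∃[ n′ ] n ≡ suc n′ × Tri _ σ 128 (Giant n′)))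
        step : ∀ n σ → Giant n σ → Bounded σ → Result n σ
        step zero σ inv bσ = inj₁ (cong (_* (1 ∸ σ (⟦ slot ⟧ σ))) (trans (cong₂ _∸_ (trans (+-comm (σ 2) 1) (cong suc σ2)) left) (n∸n≡0 (suc K))) , (0 , inv) , inj₁ left)
          where
          open Giant inv
          σ2 : σ 2 ≡ K
          σ2 = trans (same table 2 _) σ₀2
        step (suc n) σ inv bσ = go (σ (⟦ slot ⟧ σ)) refl
          where
          open Giant inv
          i : ℕ
          i = σ 10
          σ1 : σ 1 ≡ N
          σ1 = trans (same table 1 _) σ₀1
          σ2 : σ 2 ≡ K
          σ2 = trans (same table 2 _) σ₀2
          i≤K : i ≤ K
          i≤K = s≤s⁻¹ (subst (i <_) left (s≤s (m≤n+m i n)))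
          i+1 : suc i ≡ i + 1
          i+1 = +-comm 1 i
          i+1≤X : i + 1 ≤ X
          i+1≤X = ≤-trans (≤-reflexive (sym i+1)) (Y≤X (s≤s (≤-trans i≤K (≤-trans K≤N (m≤n+m N 99)))))
          τ : Store
          τ = σ [ 10 ≔ i + 1 ] [ 11 ≔ σ 11 * σ 12 ∸ (σ 11 * σ 12) div₀ σ 1 * σ 1 ]
          giant′ : σ 11 * σ 12 ∸ (σ 11 * σ 12) div₀ σ 1 * σ 1 ≡ pw ((i + 1) * K)
          giant′ = trans (mod-N≡% (σ 11 * σ 12) σ1) (trans (cong₂ (λ a b → a * b % N) giant stride)
            (trans (pw-+ (i * K) K) (cong pw (trans (+-comm (i * K) K) (cong (_* K) i+1)))))
          advance : (∀ j → j < K → pw j ≢ pw (i * K)) → Giant n τ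
          advance none = record
            { left = trans (cong (λ z → n + z) (sym i+1)) (trans (+-suc n i) left)
            ; 0<i = ≤-trans 0<i (m≤m+n i 1)
            ; giant = giant′
            ; stride = stride
            ; missed = subst Missed i+1 (missed-suc missed none)
            ; table = record
                { entries = λ v v<N → entries table v v<N
                ; zeros = λ t le → zeros table t le
                ; same = λ k o → trans (≔-other (σ [ 10 ≔ i + 1 ]) {11} {k} _ λ where refl → o)
                                   (trans (≔-other σ {10} {k} _ λ where refl → o) (same table k o)) } }
          go : ∀ c → σ (⟦ slot ⟧ σ) ≡ c → Result (suc n) σ
          go (suc c) c≡ = inj₁ (trans (cong (λ z → (σ 2 + 1 ∸ i) * (1 ∸ z)) c≡) (trans (cong ((σ 2 + 1 ∸ i) *_) (0∸n≡0 c)) (*-zeroʳ (σ 2 + 1 ∸ i))) ,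
            (suc n , inv) , inj₂ λ z → 0≢1+n (trans (sym z) c≡))
          go zero c≡ = inj₂ ((λ z → m>n⇒m∸n≢0 (≤-trans (s≤s i≤K) (≤-reflexive (trans (cong suc (sym σ2)) (+-comm 1 (σ 2)))))
              (trans (sym (trans (cong (λ u → (σ 2 + 1 ∸ i) * (1 ∸ u)) c≡) (*-identityʳ _))) z)) , n , refl ,
            asg i+1≤X (tri-← (mod≤X (σ 11 * σ 12) σ1) (advance (none (giant-entry inv)))))
            where
            none : Entry K (pw (i * K)) (σ (⟦ slot ⟧ σ)) → ∀ j → j < K → pw j ≢ pw (i * K)
            none (inj₁ (_ , f)) = f
            none (inj₂ (j , e , _)) = ⊥-elim (0≢1+n (trans (sym c≡) e))

      record OrderFound (σ : Store) : Set where
        field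
          order-x : Ord N (+ x) (σ 13)
          small   : σ 13 ≤ K * K
          zeros   : ZeroFrom (base + N) σ
          same    : Below10 σ₀ σ

      tri-babyGiant : Bounded σ₀ → Tri babyGiant σ₀ babyGiantCost OrderFound
      tri-babyGiant bσ₀ = asg (con≤X 0) (asg (con≤X 1) (tri-⨾ (tri-babySteps start-baby) giants))
        where
        start-baby : Baby K (σ₀ [ 10 ≔ 0 ] [ 11 ≔ 1 ])
        start-baby = record
          { left = +-identityʳ K
          ; baby = sym (m<n⇒m%n≡m 1<N)
          ; table = record
              { entries = λ v _ → subst (Entry 0 v) (sym (zeros₀ (base + v) (m≤m+n base v))) entry-zero
              ; zeros = λ t le → zeros₀ t (≤-trans (m≤m+n base N) le)
              ; same = λ k o → trans (≔-other (σ₀ [ 10 ≔ 0 ]) {11} {k} 1 λ where refl → o) (≔-other σ₀ {10} {k} 0 λ where refl → o) } }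
        start-giant : ∀ {σ} → Baby 0 σ → Giant K (σ [ 12 ≔ σ 11 ] [ 10 ≔ 1 ])
        start-giant {σ} inv = record
          { left = +-comm K 1
          ; 0<i = z<s
          ; giant = trans baby (cong pw (trans left (sym (+-identityʳ K))))
          ; stride = trans baby (cong pw left)
          ; missed = missed-one
          ; table = record
              { entries = λ v v<N → subst (λ k → Entry k v (σ (20 + (base + v)))) left (entries table v v<N)
              ; zeros = λ t le → Table.zeros table t le
              ; same = λ k o → trans (≔-other (σ [ 12 ≔ σ 11 ]) {10} {k} 1 λ where refl → o)
                  (trans (≔-other σ {12} {k} (σ 11) λ where refl → o) (Table.same table k o)) } }
          where open Baby inv
        finish : ∀ {σ} → Stopped σ → Tri (cond (var 10 ⊟ var 2) (ret 1 (var 6)) skip ⨾ 13 ← var 10 ⊠ var 2 ⊞ con 1 ⊟ cell slot) σ ((64 + 64) + 64) OrderFound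
        finish {σ} ((n , inv) , stop) = tri-⨾ {R = λ σ′ → σ′ ≡ σ × σ 10 ∸ σ 2 ≡ 0}
            (tri-cond (λ ne → tri-ret λ e₀ e₁ → good-element (fail ne stop) e₀ (trans e₁ (Table.same table 6 _)))
              (λ z → Tri-≤ z≤n (tri-skip (refl , z))))
            λ where (refl , z) bσ → read z bσ (hit z stop)
          where
          open Giant inv
          i : ℕ
          i = σ 10
          σ2 : σ 2 ≡ K
          σ2 = trans (Table.same table 2 _) σ₀2
          fail : i ∸ σ 2 ≢ 0 → i ≡ suc K ⊎ σ (⟦ slot ⟧ σ) ≢ 0 → Correct D N (element x)
          -- The index exceeds K, so the giant steps 1, ..., K have all missed and every exponent up
          -- to K², hence up to D, is excluded.
          fail ne _ = element-correct x<N cop λ e 0<e e≤D → no-small-order (subst Missed i≡ missed) e 0<e (≤-trans e≤D (<⇒≤ D<K²))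
            where
            i≡ : i ≡ suc K
            i≡ = ≤-antisym (≤-trans (m≤n+m i n) (≤-reflexive left)) (subst (_< i) σ2 (≰⇒> λ le → ne (m≤n⇒m∸n≡0 le)))
          i≤K : i ∸ σ 2 ≡ 0 → i ≤ K
          i≤K z = subst (i ≤_) σ2 (m∸n≡0⇒m≤n z)
          Hit : Set
          Hit = ∃[ j ] σ (⟦ slot ⟧ σ) ≡ suc j × j < K × pw j ≡ pw (i * K) × (∀ j′ → j < j′ → j′ < K → pw j′ ≢ pw (i * K))
          hit : i ∸ σ 2 ≡ 0 → i ≡ suc K ⊎ σ (⟦ slot ⟧ σ) ≢ 0 → Hit
          hit z (inj₁ i≡) = ⊥-elim (<⇒≱ (n<1+n K) (subst (_≤ K) i≡ (i≤K z)))
          hit z (inj₂ ne) = from (giant-entry inv)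
            where
            from : Entry K (pw (i * K)) (σ (⟦ slot ⟧ σ)) → Hit
            from (inj₁ (e , _)) = ⊥-elim (ne e)
            from (inj₂ h) = h
          read : i ∸ σ 2 ≡ 0 → Bounded σ → Hit → Tri (13 ← var 10 ⊠ var 2 ⊞ con 1 ⊟ cell slot) σ 64 OrderFound
          read z bσ (j , c≡ , j<K , eq , last) = tri-← (≤-trans m≤ (Y²≤X (*-mono-≤ (≤-trans K≤N N≤Y) (≤-trans K≤N N≤Y)))) (record
            { order-x = subst (Ord N (+ x)) (sym m≡) (order 0<i missed j<K eq last)
            ; small = m≤
            ; zeros = λ t le → Table.zeros table t le
            ; same = λ k o → trans (≔-other σ {13} {k} _ λ where refl → o) (Table.same table k o) })
            where
            m≡ : i * σ 2 + 1 ∸ σ (⟦ slot ⟧ σ) ≡ i * K ∸ j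
            m≡ = cong₂ _∸_ (trans (+-comm (i * σ 2) 1) (cong (λ z → suc (i * z)) σ2)) c≡
            m≤ : i * σ 2 + 1 ∸ σ (⟦ slot ⟧ σ) ≤ K * K
            m≤ = ≤-trans (≤-reflexive m≡) (≤-trans (m∸n≤m (i * K) j) (*-monoˡ-≤ K (i≤K z)))
        giants : ∀ {σ} → Baby 0 σ → Bounded σ → Tri _ σ (64 + (64 + ((K * (64 + 128) + 64) + ((64 + 64) + 64)))) OrderFound
        giants {σ} inv bσ = asg (bσ 11) (asg (con≤X 1) (tri-⨾ (tri-giantSteps (start-giant inv)) λ s _ → finish s))

    tri-bounded : ∀ {s σ n Q} → (Bounded σ → Tri s σ n Q) → Tri s σ n Q
    continue (tri-bounded f) at bσ = continue (f bσ) at bσ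

    tri-primeFactor : ∀ {σ} → 1 < σ 13 → σ 13 ≤ K * K →
                      Tri primeFactor σ trialCost (λ σ′ → Prime (σ′ 14) × σ′ 14 ∣ σ 13 × Outside 14 14 σ σ′)
    tri-primeFactor {σ₀} 1<m m≤K² = asg (con≤X 2) (tri-⨾ (tri-for Trial 64 step start) λ e _ → finish e)
      where
      m : ℕ
      m = σ₀ 13
      instance
        m-nonTrivial : NonTrivial m
        m-nonTrivial = n>1⇒nonTrivial 1<m
      record Trial (n : ℕ) (σ : Store) : Set where
        field
          left  : n + σ 14 ≡ suc K
          2≤q   : 2 ≤ σ 14
          rough : σ 14 Rough m
          same  : Outside 14 14 σ₀ σ
      Done : Store → Set
      Done σ = (∃[ n ] Trial n σ) × (m < σ 14 * σ 14 ⊎ σ 14 ∣ m)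
      update : ∀ {σ v} → Outside 14 14 σ₀ σ → Outside 14 14 σ₀ (σ [ 14 ≔ v ])
      update {σ} {v} same k o = trans (≔-other σ {14} {k} v λ where refl → o) (same k o)
      start : Trial (K ∸ 1) (σ₀ [ 14 ≔ 2 ])
      start = record { left = trans (+-suc (K ∸ 1) 1) (cong suc (m∸n+n≡m 0<K)) ; 2≤q = ≤-refl ; rough = 2-rough ; same = update (λ _ _ → refl) }
      step : ∀ n σ → Trial n σ → Bounded σ →
             ((σ 13 + 1 ∸ σ 14 * σ 14) * (σ 13 ∸ σ 13 div₀ σ 14 * σ 14) ≡ 0 × Done σ) ⊎
             ((σ 13 + 1 ∸ σ 14 * σ 14) * (σ 13 ∸ σ 13 div₀ σ 14 * σ 14) ≢ 0 × (∃[ n′ ] n ≡ suc n′ × Tri (14 ← var 14 ⊞ con 1) σ 64 (Trial n′)))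
      step n σ inv bσ = go (m <? q * q) (q ∣? m)
        where
        open Trial inv
        q : ℕ
        q = σ 14
        instance
          q≢0 : NonZero q
          q≢0 = >-nonZero (<-trans z<s 2≤q)
        m≡ : σ 13 ≡ m
        m≡ = same 13 _
        mod≡ : σ 13 ∸ σ 13 div₀ q * q ≡ m % q
        mod≡ = trans (mod≡% (σ 13) q) (cong (_% q) m≡)
        go : Dec (m < q * q) → Dec (q ∣ m) → _
        go (yes m<q²) _ = inj₁ (cong (_* (σ 13 ∸ σ 13 div₀ q * q)) (m≤n⇒m∸n≡0 (≤-trans (≤-reflexive (trans (+-comm (σ 13) 1) (cong suc m≡))) m<q²)) ,
          (n , inv) , inj₁ m<q²)
        go (no _) (yes q∣m) = inj₁ (trans (cong ((σ 13 + 1 ∸ q * q) *_) (trans mod≡ (n∣m⇒m%n≡0 m q q∣m))) (*-zeroʳ (σ 13 + 1 ∸ q * q)) , (n , inv) , inj₂ q∣m)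
        go (no m≮q²) (no q∤m) = inj₂ (nonzero , advance n refl)
          where
          q²≤m : q * q ≤ m
          q²≤m = ≮⇒≥ m≮q²
          -- While the loop runs, q² ≤ m ≤ K²; this limits the trials to K - 1.
          q≤K : q ≤ K
          q≤K = ≮⇒≥ λ K<q → <⇒≱ (*-mono-< K<q K<q) (≤-trans q²≤m m≤K²)
          nonzero : (σ 13 + 1 ∸ q * q) * (σ 13 ∸ σ 13 div₀ q * q) ≢ 0
          nonzero z with m*n≡0⇒m≡0∨n≡0 (σ 13 + 1 ∸ q * q) z
          ... | inj₁ e = m>n⇒m∸n≢0 (≤-trans (s≤s q²≤m) (≤-reflexive (trans (cong suc (sym m≡)) (+-comm 1 (σ 13))))) e
          ... | inj₂ e = q∤m (m%n≡0⇒n∣m m q (trans (sym mod≡) e))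
          advance : ∀ n₁ → n ≡ n₁ → ∃[ n′ ] n ≡ suc n′ × Tri (14 ← var 14 ⊞ con 1) σ 64 (Trial n′)
          advance zero n≡ = ⊥-elim (<⇒≱ (s≤s q≤K) (≤-reflexive (trans (sym left) (cong (_+ q) n≡))))
          advance (suc n′) n≡ = n′ , n≡ , tri-← (Y≤X (≤-trans (≤-reflexive (+-comm q 1)) (s≤s (≤-trans q≤K (≤-trans K≤N (m≤n+m N 99)))))) (record
            { left = trans (cong (λ z → n′ + z) (+-comm q 1)) (trans (+-suc n′ q) (trans (cong (_+ q) (sym n≡)) left))
            ; 2≤q = ≤-trans 2≤q (m≤m+n q 1)
            ; rough = subst (_Rough m) (+-comm 1 q) (∤⇒rough-suc q∤m rough)
            ; same = update same })
      finish : ∀ {σ} → Done σ → Tri (cond (var 13 ⊘% var 14) (14 ← var 13) skip) σ (64 + 64) (λ σ′ → Prime (σ′ 14) × σ′ 14 ∣ m × Outside 14 14 σ₀ σ′)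
      finish {σ} ((n , inv) , d) = tri-bounded λ bσ → tri-cond
          (λ ne → tri-← (bσ 13) (subst Prime (sym m≡) (prime-m ne d) , ∣-reflexive m≡ , update same))
          (λ z → Tri-≤ z≤n (tri-skip (rough∧∣⇒prime {{n>1⇒nonTrivial 2≤q}} rough (div z) , div z , same)))
        where
        open Trial inv
        instance
          q≢0 : NonZero (σ 14)
          q≢0 = >-nonZero (<-trans z<s 2≤q)
        m≡ : σ 13 ≡ m
        m≡ = same 13 _
        mod≡ : σ 13 ∸ σ 13 div₀ σ 14 * σ 14 ≡ m % σ 14
        mod≡ = trans (mod≡% (σ 13) (σ 14)) (cong (_% σ 14) m≡)
        div : σ 13 ∸ σ 13 div₀ σ 14 * σ 14 ≡ 0 → σ 14 ∣ m
        div z = m%n≡0⇒n∣m m (σ 14) (trans (sym mod≡) z)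
        prime-m : σ 13 ∸ σ 13 div₀ σ 14 * σ 14 ≢ 0 → m < σ 14 * σ 14 ⊎ σ 14 ∣ m → Prime m
        prime-m ne (inj₁ m<q²) = rough∧square>⇒prime rough m<q²
        prime-m ne (inj₂ q∣m)  = ⊥-elim (ne (trans mod≡ (n∣m⇒m%n≡0 m (σ 14) q∣m)))

    tri-split : ∀ {σ M q} → σ 3 ≡ M → σ 14 ≡ q → 0 < M → Prime q →
                Tri split σ splitCost (λ σ′ → Outside 15 16 σ σ′ × (∃[ α ] σ′ 16 ≡ q ^ α × σ′ 15 * q ^ α ≡ M × ¬ q ∣ σ′ 15))
    tri-split {σ₀} {M} {q} refl refl 0<M pr = tri-bounded λ bσ₀ → asg (bσ₀ 3) (asg (con≤X 1) (tri-for Split 128 step {S} (start bσ₀)))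
      where
      instance
        q≢0 : NonZero q
        q≢0 = prime⇒nonZero pr
      2≤q : 2 ≤ q
      2≤q = nonTrivial⇒n>1 q {{prime⇒nonTrivial pr}}
      -- Each division by q ≥ 2 at least halves cell 15, so n, a bound for its number of digits,
      -- counts the rounds.
      record Split (n : ℕ) (σ : Store) : Set where
        field
          same  : Outside 15 16 σ₀ σ
          below : σ 15 < 2 ^ n
          0<M₀  : 0 < σ 15
          {α}   : ℕ
          M₂≡   : σ 16 ≡ q ^ α
          M≡    : σ 15 * σ 16 ≡ M
      update : ∀ {σ v w} → Outside 15 16 σ₀ σ → Outside 15 16 σ₀ (σ [ 15 ≔ v ] [ 16 ≔ w ])
      update {σ} {v} {w} same k o = trans (≔-other (σ [ 15 ≔ v ]) {16} {k} w λ where refl → o) (trans (≔-other σ {15} {k} v λ where refl → o) (same k o))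
      start : Bounded σ₀ → Split S (σ₀ [ 15 ≔ M ] [ 16 ≔ 1 ])
      start bσ₀ = record { same = update (λ _ _ → refl) ; below = ≤-<-trans (bσ₀ 3) X<2^S ; 0<M₀ = 0<M ; α = 0 ; M₂≡ = refl ; M≡ = *-identityʳ M }
      Done : Store → Set
      Done σ = Outside 15 16 σ₀ σ × (∃[ α ] σ 16 ≡ q ^ α × σ 15 * q ^ α ≡ M × ¬ q ∣ σ 15)
      step : ∀ n σ → Split n σ → Bounded σ →
             (1 ∸ (σ 15 ∸ σ 15 div₀ σ 14 * σ 14) ≡ 0 × Done σ) ⊎
             (1 ∸ (σ 15 ∸ σ 15 div₀ σ 14 * σ 14) ≢ 0 × (∃[ n′ ] n ≡ suc n′ × Tri (15 ← var 15 ⊘ var 14 ⨾ 16 ← var 16 ⊠ var 14) σ 128 (Split n′)))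
      step n σ inv bσ = go (q ∣? M₀)
        where
        open Split inv
        M₀ : ℕ
        M₀ = σ 15
        q≡ : σ 14 ≡ q
        q≡ = same 14 _
        mod≡ : M₀ ∸ M₀ div₀ σ 14 * σ 14 ≡ M₀ % q
        mod≡ = trans (cong (λ z → M₀ ∸ M₀ div₀ z * z) q≡) (mod≡% M₀ q)
        quot≡ : M₀ div₀ σ 14 ≡ M₀ / q
        quot≡ = trans (cong (M₀ div₀_) q≡) (div₀≡/ M₀ q)
        go : Dec (q ∣ M₀) → _
        go (no q∤M₀) = inj₁ (m≤n⇒m∸n≡0 (≤-trans (n≢0⇒n>0 λ e → q∤M₀ (m%n≡0⇒n∣m M₀ q e)) (≤-reflexive (sym mod≡))) , same , α , M₂≡ ,
          trans (cong (M₀ *_) (sym M₂≡)) M≡ , q∤M₀)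
        go (yes q∣M₀) = inj₂ ((λ z → 0≢1+n (trans (sym z) (cong (1 ∸_) (trans mod≡ (n∣m⇒m%n≡0 M₀ q q∣M₀))))) , advance n refl)
          where
          M≡′ : M₀ div₀ σ 14 * (σ 16 * σ 14) ≡ M
          M≡′ = trans (cong₂ (λ a b → a * (σ 16 * b)) quot≡ q≡) (trans (cong (M₀ / q *_) (*-comm (σ 16) q))
            (trans (sym (*-assoc (M₀ / q) q (σ 16))) (trans (cong (_* σ 16) (m/n*n≡m q∣M₀)) M≡)))
          0<quot : 0 < M₀ div₀ σ 14
          0<quot = subst (0 <_) (sym quot≡) (m≥n⇒m/n>0 (∣⇒≤ {{>-nonZero 0<M₀}} q∣M₀))
          M₂q≤M : σ 16 * σ 14 ≤ M
          M₂q≤M = ≤-trans (m≤n*m (σ 16 * σ 14) (M₀ div₀ σ 14) {{>-nonZero 0<quot}}) (≤-reflexive M≡′)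
          advance : ∀ n₁ → n ≡ n₁ → ∃[ n′ ] n ≡ suc n′ × Tri (15 ← var 15 ⊘ var 14 ⨾ 16 ← var 16 ⊠ var 14) σ 128 (Split n′)
          advance zero n≡ = ⊥-elim (<⇒≱ below (≤-trans (≤-reflexive (cong (2 ^_) n≡)) 0<M₀))
          advance (suc n′) n≡ = n′ , n≡ , asg (≤-trans (≤-reflexive quot≡) (≤-trans (m/n≤m M₀ q) (bσ 15)))
            (tri-← (≤-trans M₂q≤M (≤-trans (≤-reflexive (sym (same 3 _))) (bσ 3))) (record
              { same = update same
              ; below = subst (_< 2 ^ n′) (sym quot≡) (m<n*o⇒m/o<n (<-≤-trans below (≤-trans (≤-reflexive (trans (cong (2 ^_) n≡) (*-comm 2 (2 ^ n′))))
                          (*-monoʳ-≤ (2 ^ n′) 2≤q))))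
              ; 0<M₀ = 0<quot
              ; α = suc α
              ; M₂≡ = trans (cong₂ _*_ M₂≡ q≡) (*-comm (q ^ α) q)
              ; M≡ = M≡′ }))

    -- The reason for the cube in the bound X: the new M is stored before it is compared with D, and
    -- may be as large as D K².
    M*q≤X : ∀ {M q} → M ≤ D → q ≤ K * K → M * q ≤ X
    M*q≤X M≤D q≤ = ≤-trans (*-mono-≤ (≤-trans M≤D (≤-trans (<⇒≤ D<N) N≤Y)) (≤-trans q≤ (*-mono-≤ (≤-trans K≤N N≤Y) (≤-trans K≤N N≤Y)))) cube≤X

    module _ {a M g m q x : ℕ} (ord-g : Ord N (+ g) M) (M≤D : M ≤ D) (x≅ : + x ≅ (+ a) ℤ.^ M ⟨ N ⟩)
             (ord-x : Ord N (+ x) m) (pr : Prime q) (q∣m : q ∣ m) (m≤K² : m ≤ K * K) where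
      private
        instance
          q≢0 : NonZero q
          q≢0 = prime⇒nonZero pr

      -- A product rather than a record, so that it carries over definitionally to stores in which other cells were assigned.
      Core : Store → Set
      Core σ = σ 0 ≡ D × σ 1 ≡ N × σ 2 ≡ K × σ 3 ≡ M × σ 4 ≡ g × σ 5 ≡ a × σ 13 ≡ m × σ 14 ≡ q × ZeroFrom (M * N + N) σ

      core-powmod : ∀ {σ σ′} → Outside 7 9 σ σ′ → Core σ → Core σ′
      core-powmod s (c0 , c1 , c2 , c3 , c4 , c5 , c13 , c14 , z) =
        trans (s 0 _) c0 , trans (s 1 _) c1 , trans (s 2 _) c2 , trans (s 3 _) c3 , trans (s 4 _) c4 , trans (s 5 _) c5 ,
        trans (s 13 _) c13 , trans (s 14 _) c14 , λ t le → trans (s (20 + t) _) (z t le)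

      core-split : ∀ {σ σ′} → Outside 15 16 σ σ′ → Core σ → Core σ′
      core-split s (c0 , c1 , c2 , c3 , c4 , c5 , c13 , c14 , z) =
        trans (s 0 _) c0 , trans (s 1 _) c1 , trans (s 2 _) c2 , trans (s 3 _) c3 , trans (s 4 _) c4 , trans (s 5 _) c5 ,
        trans (s 13 _) c13 , trans (s 14 _) c14 , λ t le → trans (s (20 + t) _) (z t le)

      core1 : ∀ σ → Core σ → σ 1 ≡ N
      core1 σ (_ , c1 , _) = c1

      Extended : Store → Set
      Extended σ = σ 0 ≡ D × σ 1 ≡ N × σ 2 ≡ K × σ 3 ≡ M * q × σ 5 ≡ a × σ 4 < N × Ord N (+ σ 4) (M * q) × M * q ≤ D × ZeroFrom (M * N + N) σ

      -- With x = a ^ M and c = a ^ (m / q), the power c ^ M equals x ^ (m / q). As m is the order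
      -- of x, it differs from 1 while its q-th power is 1, as `ord-extend` requires.
      extended-order : ∀ {c y z M₀ α} → M₀ * q ^ α ≡ M → ¬ q ∣ M₀ → + c ≅ (+ a) ℤ.^ (m / q) ⟨ N ⟩ →
                       + y ≅ (+ c) ℤ.^ M₀ ⟨ N ⟩ → + z ≅ (+ g) ℤ.^ (q ^ α) ⟨ N ⟩ → ∀ {g′} → + g′ ≅ + (z * y) ⟨ N ⟩ → Ord N (+ g′) (M * q)
      extended-order {c} {y} {z} {M₀} {α} eq q∤M₀ c≅ y≅ z≅ g′≅ = ord-≅
        (≅-sym (≅-trans g′≅ (≅-trans (≅-reflexive (ℤₚ.pos-* z y)) (≅-* z≅ y≅))))
        (subst (λ k → Ord N _ (k * q)) eq (ord-extend {g = + g} {+ c} {q} {M₀} {α} pr q∤M₀ (subst (Ord N (+ g)) (sym eq) ord-g)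
          (λ e → proj₁ order-q (≅-trans (≅-sym c^M) e)) (≅-trans (≅-^ q c^M) (proj₂ order-q))))
        where
        order-q : (¬ (+ x) ℤ.^ (m / q) ≅ 1ℤ ⟨ N ⟩) × (((+ x) ℤ.^ (m / q)) ℤ.^ q ≅ 1ℤ ⟨ N ⟩)
        order-q = prime-quotient {m = m / q} (nonTrivial⇒n>1 q {{prime⇒nonTrivial pr}}) (subst (Ord N (+ x)) (sym (m/n*n≡m q∣m)) ord-x)
        c^M : (+ c) ℤ.^ (M₀ * q ^ α) ≅ (+ x) ℤ.^ (m / q) ⟨ N ⟩
        c^M = ≅-trans (≅-^ (M₀ * q ^ α) c≅) (≅-trans (≅-reflexive (trans (ℤₚ.^-*-assoc (+ a) (m / q) (M₀ * q ^ α))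
            (trans (cong ((+ a) ℤ.^_) (trans (*-comm (m / q) (M₀ * q ^ α)) (cong (_* (m / q)) eq))) (sym (ℤₚ.^-*-assoc (+ a) M (m / q))))))
          (≅-sym (≅-^ (m / q) x≅)))

      tri-extend : ∀ {σ} → Core σ → Tri extend σ extendCost Extended
      tri-extend {σ} core@(_ , c1 , _ , _ , _ , c5 , c13 , c14 , _) = tri-bounded λ bσ →
        asg (bσ 5) (asg (≤-trans (≤-reflexive quot≡) (≤-trans (m/n≤m m q) (≤-trans (≤-reflexive (sym c13)) (bσ 13))))
          (tri-⨾ (tri-bounded (tri-power c1)) λ (c<N , c≅ , s) bσ′ → phase₂ (core-powmod s core)
            (≅-trans c≅ (≅-reflexive (cong₂ (λ b e → (+ b) ℤ.^ e) c5 quot≡))) bσ′))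
        where
        quot≡ : σ 13 div₀ σ 14 ≡ m / q
        quot≡ = trans (cong₂ _div₀_ c13 c14) (div₀≡/ m q)
        phase₄ : ∀ {σ c M₀ α} → Core σ → + c ≅ (+ a) ℤ.^ (m / q) ⟨ N ⟩ → σ 16 ≡ q ^ α → M₀ * q ^ α ≡ M → ¬ q ∣ M₀ →
                 + σ 9 ≅ (+ c) ℤ.^ M₀ ⟨ N ⟩ → Bounded σ → Tri (11 ← var 9 ⨾ _) σ _ Extended
        phase₄ {σ} {c} {M₀} {α} core c≅ M₂≡ eq q∤M₀ y≅ bσ = asg (bσ 9) (asg (bσ 4) (asg (bσ 16)
            (tri-⨾ (tri-bounded (tri-power (core1 σ core))) λ (z<N , z≅ , s) bσ′ → phase₅ (core-powmod s core) (trans (s 11 _) refl) bσ′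
              (≅-trans z≅ (≅-reflexive (cong₂ (λ b e → (+ b) ℤ.^ e) (g≡ core) M₂≡))))))
          where
          g≡ : Core σ → σ 4 ≡ g
          g≡ (_ , _ , _ , _ , c4 , _) = c4
          phase₅ : ∀ {τ} → Core τ → τ 11 ≡ σ 9 → Bounded τ → + τ 9 ≅ (+ g) ℤ.^ (q ^ α) ⟨ N ⟩ →
                   Tri (4 ← var 9 ⊠ var 11 ⊘% var 1 ⨾ _) τ _ Extended
          phase₅ {τ} (d0 , d1 , d2 , d3 , d4 , d5 , d13 , d14 , zs) y≡ bτ z≅ =
            asg (mod≤X (τ 9 * τ 11) d1) (asg (≤-trans (≤-reflexive M′≡) (M*q≤X M≤D (≤-trans (∣⇒≤ {{>-nonZero (positive ord-x)}} q∣m) m≤K²)))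
              (tri-cond (λ ne → tri-ret λ e₀ e₁ → good-element (subst (λ v → Correct D N (element v)) refl
                  (ord⇒element-correct g′<N ord′ (subst₂ _<_ d0 M′≡ (m∸n≢0⇒n<m {τ 3 * τ 14} {τ 0} ne)))) e₀ e₁)
                (λ z → Tri-≤ z≤n (tri-skip (d0 , d1 , d2 , M′≡ , d5 , g′<N , ord′ , subst₂ _≤_ M′≡ d0 (m∸n≡0⇒m≤n z) , zs)))))
            where
            M′≡ : τ 3 * τ 14 ≡ M * q
            M′≡ = cong₂ _*_ d3 d14
            g′ : ℕ
            g′ = τ 9 * τ 11 ∸ (τ 9 * τ 11) div₀ τ 1 * τ 1
            g′<N : g′ < N
            g′<N = mod<N (τ 9 * τ 11) d1
            ord′ : Ord N (+ g′) (M * q)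
            ord′ = extended-order {c} {τ 11} {τ 9} {M₀} {α} eq q∤M₀ c≅ (≅-trans (≅-reflexive (cong +_ y≡)) y≅) z≅ (modᶜ (τ 9 * τ 11) d1)
        phase₃ : ∀ {σ c} → Core σ → + c ≅ (+ a) ℤ.^ (m / q) ⟨ N ⟩ → σ 6 ≡ c →
                 (∃[ α ] σ 16 ≡ q ^ α × σ 15 * q ^ α ≡ M × ¬ q ∣ σ 15) → Bounded σ → Tri (7 ← var 6 ⨾ _) σ _ Extended
        phase₃ {σ} {c} core c≅ c≡ (α , M₂≡ , eq , q∤M₀) bσ = asg (bσ 6) (asg (bσ 15)
          (tri-⨾ (tri-bounded (tri-power (core1 σ core))) λ (y<N , y≅ , s) bσ′ → phase₄ {α = α} (core-powmod s core) c≅ (trans (s 16 _) M₂≡) eq q∤M₀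
            (≅-trans y≅ (≅-reflexive (cong (λ b → (+ b) ℤ.^ σ 15) c≡))) bσ′))
        phase₂ : ∀ {σ} → Core σ → + σ 9 ≅ (+ a) ℤ.^ (m / q) ⟨ N ⟩ → Bounded σ → Tri (6 ← var 9 ⨾ _) σ _ Extended
        phase₂ {σ} core@(_ , _ , _ , d3 , _ , _ , _ , d14 , _) c≅ bσ = asg (bσ 9) (tri-⨾ (tri-split d3 d14 (positive ord-g) pr)
          λ (s , r) bσ′ → phase₃ (core-split s core) c≅ (s 6 _) r bσ′)

    record Scan (σ : Store) : Set where
      field
        σ0    : σ 0 ≡ D
        σ1    : σ 1 ≡ N
        σ2    : σ 2 ≡ K
        {h}   : ℕ
        M≡    : σ 3 ≡ 2 * h
        M≤D   : σ 3 ≤ D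
        ord-g : Ord N (+ σ 4) (σ 3)
        2≤a   : 2 ≤ σ 5
        a≤    : σ 5 ≤ suc (2 * K)
        tried : ∀ b → 2 ≤ b → b < σ 5 → ¬ b ∣ N
        roots : ∀ b → 0 < b → b < σ 5 → (+ b) ℤ.^ σ 3 ≅ 1ℤ ⟨ N ⟩
        zeros : ZeroFrom (σ 3 * N) σ

    Raised : Store → Store → Set
    Raised σ σ′ = Scan σ′ × σ′ 5 ≡ σ 5 × σ 3 * 2 ≤ σ′ 3

    tri-heavy : ∀ {σ} → Scan σ → Coprime (σ 5) N → σ 9 < N → + σ 9 ≅ (+ σ 5) ℤ.^ σ 3 ⟨ N ⟩ →
                ¬ (+ σ 5) ℤ.^ σ 3 ≅ 1ℤ ⟨ N ⟩ → Tri heavy σ heavyCost (Raised σ)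
    tri-heavy {σ} inv cop x<N x≅ x≇1 = tri-bounded λ bσ → asg (bσ 9)
        (tri-⨾ (tri-bounded (tri-babyGiant {σ [ 6 ≔ x ]} σ1 σ2 x<N cop-x zeros)) λ found _ → factor-order found)
      where
      open Scan inv
      x : ℕ
      x = σ 9
      cop-x : Coprime x N
      cop-x = coprime-≅ ((+ σ 5) ℤ.^ σ 3) (+ x) (≅-sym x≅) (coprime-^ᶻ {a = + σ 5} (σ 3) cop)
      module _ {τ : Store} (found : OrderFound {σ [ 6 ≔ x ]} σ1 σ2 x<N cop-x zeros τ) where
        open OrderFound found renaming (zeros to zerosτ)
        1<m : 1 < τ 13
        1<m = ≤∧≢⇒< (positive order-x) λ 1≡m → x≇1 (≅-trans (≅-sym x≅) (≅-trans (≅-reflexive (sym (ℤₚ.^-identityʳ (+ x))))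
          (subst (λ k → (+ x) ℤ.^ k ≅ 1ℤ ⟨ N ⟩) (sym 1≡m) (power order-x))))
        raise : ∀ {υ} → Prime (υ 14) × υ 14 ∣ τ 13 × Outside 14 14 τ υ → Tri extend υ extendCost (Raised σ)
        raise {υ} (pr , q∣m , s) = Tri-conseq conclude (tri-extend ord-g M≤D x≅ order-x pr q∣m small
            ( trans (s 0 _) (trans (same 0 _) σ0) , trans (s 1 _) (trans (same 1 _) σ1) , trans (s 2 _) (trans (same 2 _) σ2)
            , trans (s 3 _) (same 3 _) , trans (s 4 _) (same 4 _) , trans (s 5 _) (same 5 _) , s 13 _ , refl
            , λ t le → trans (s (20 + t) _) (zerosτ t le)))
          where
          q : ℕ
          q = υ 14
          2≤q : 2 ≤ q
          2≤q = nonTrivial⇒n>1 q {{prime⇒nonTrivial pr}}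
          conclude : ∀ {σ′} → σ′ 0 ≡ D × σ′ 1 ≡ N × σ′ 2 ≡ K × σ′ 3 ≡ σ 3 * q × σ′ 5 ≡ σ 5 × σ′ 4 < N × Ord N (+ σ′ 4) (σ 3 * q) ×
                     σ 3 * q ≤ D × ZeroFrom (σ 3 * N + N) σ′ → Raised σ σ′
          conclude {σ′} (e0 , e1 , e2 , e3 , e5 , _ , o , M≤ , z) = record
            { σ0 = e0 ; σ1 = e1 ; σ2 = e2
            ; h = h * q
            ; M≡ = trans e3 (trans (cong (_* q) M≡) (*-assoc 2 h q))
            ; M≤D = ≤-trans (≤-reflexive e3) M≤
            ; ord-g = subst (Ord N (+ σ′ 4)) (sym e3) o
            ; 2≤a = ≤-trans 2≤a (≤-reflexive (sym e5))
            ; a≤ = ≤-trans (≤-reflexive e5) a≤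
            ; tried = λ b 2≤b b<a → tried b 2≤b (<-≤-trans b<a (≤-reflexive e5))
            ; roots = λ b 0<b b<a → subst (λ k → (+ b) ℤ.^ k ≅ 1ℤ ⟨ N ⟩) (sym e3)
                (^∣-≅ (+ b) (σ 3) (σ 3 * q) (roots b 0<b (<-≤-trans b<a (≤-reflexive e5))) (m∣m*n q))
            ; zeros = λ t le → z t (≤-trans M*N+N≤ (≤-trans (≤-reflexive (cong (_* N) (sym e3))) le))
            } , e5 , ≤-trans (*-monoʳ-≤ (σ 3) 2≤q) (≤-reflexive (sym e3))
            where
            -- As q ≥ 2, the next table begins no earlier than the previous one ends.
            M*N+N≤ : σ 3 * N + N ≤ σ 3 * q * N
            M*N+N≤ = ≤-trans (≤-reflexive (+-comm (σ 3 * N) N)) (*-monoˡ-≤ N {suc (σ 3)} {σ 3 * q}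
              (≤-trans (m<m*n (σ 3) 2 {{>-nonZero (positive ord-g)}} ≤-refl) (*-monoʳ-≤ (σ 3) 2≤q)))
        factor-order : Tri (primeFactor ⨾ extend) τ (trialCost + extendCost) (Raised σ)
        factor-order = tri-⨾ (tri-primeFactor 1<m small) λ r _ → raise r

    light-ledger : ∀ l k j d → l + (j * l + d * k + 64) ≡ suc j * l + d * k + 64
    light-ledger l k j d = trans (sym (+-assoc l (j * l + d * k) 64)) (cong (_+ 64) (sym (+-assoc l (j * l) (d * k))))

    heavy-ledger : ∀ l k j d → k + (j * l + d * k + 64) ≡ j * l + suc d * k + 64
    heavy-ledger l k j d = trans (sym (+-assoc k (j * l + d * k) 64)) (cong (_+ 64) (trans (sym (+-assoc k (j * l) (d * k)))
      (trans (cong (_+ d * k) (+-comm k (j * l))) (+-assoc (j * l) k (d * k)))))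

    -- Amortised accounting. A round either advances a, and there are j such rounds left, or raises
    -- M. Since `D < M * 2 ^ d`, M ≤ D and each raise at least doubles M, at most d raises can
    -- follow.
    Budget : ℕ → Store → Set
    Budget t σ = Scan σ × (∃[ j ] ∃[ d ] j + σ 5 ≡ suc (2 * K) × D < σ 3 * 2 ^ d × t ≡ j * lightCost + d * heavyStep + 64)

    Scanned : Store → Set
    Scanned σ = Scan σ × 2 * K < σ 5

    tri-scan-loop : ∀ {t σ} → Budget t σ → Tri (while (var 2 ⊞ var 2 ⊞ con 1 ⊟ var 5) scan-body) σ t Scanned
    tri-scan-loop = tri-while Budget step
      where
      Result : ℕ → Store → Set
      Result t σ = (σ 2 + σ 2 + 1 ∸ σ 5 ≡ 0 × 64 ≤ t × Scanned σ) ⊎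
                   (σ 2 + σ 2 + 1 ∸ σ 5 ≢ 0 × (∃[ b ] ∃[ t′ ] 64 + b + t′ ≤ t × Tri scan-body σ b (Budget t′)))
      step : ∀ t σ → Budget t σ → Bounded σ → Result t σ
      step t σ (inv , j , d , j≡ , D< , t≡) bσ = go j refl
        where
        open Scan inv
        a M : ℕ
        a = σ 5
        M = σ 3
        limit≡ : σ 2 + σ 2 + 1 ≡ suc (2 * K)
        limit≡ = trans (+-comm (σ 2 + σ 2) 1) (cong suc (trans (cong (λ k → k + k) σ2) (cong (λ z → K + z) (sym (+-identityʳ K)))))
        0<a : 0 < a
        0<a = <-trans z<s 2≤a
        a≢0 : NonZero a
        a≢0 = >-nonZero 0<a
        mod≡ : σ 1 ∸ σ 1 div₀ a * a ≡ (N % a) {{a≢0}}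
        mod≡ = trans (cong (λ n → n ∸ n div₀ a * a) σ1) (mod≡% N a {{a≢0}})
        stop : σ 1 ∸ σ 1 div₀ a * a ≡ 0 → Tri (cond (var 1 ⊟ var 5) (ret 2 (var 5)) (ret 3 (con 0))) σ 128 (λ σ′ → σ′ ≡ σ × ¬ a ∣ N)
        stop z = tri-cond (λ ne → tri-ret λ e₀ e₁ → good-factor (a∣N , 2≤a , subst (a <_) σ1 (m∸n≢0⇒n<m {σ 1} {a} ne)) e₀ e₁)
            (λ N≤a → tri-ret λ e₀ _ → good-prime (no-divisor⇒prime 1<N λ b 2≤b b<N → tried b 2≤b
              (<-≤-trans b<N (≤-trans (≤-reflexive (sym σ1)) (m∸n≡0⇒m≤n N≤a)))) e₀)
          where
          a∣N : a ∣ N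
          a∣N = m%n≡0⇒n∣m N a {{a≢0}} (trans (sym mod≡) z)
        tried′ : ¬ a ∣ N → ∀ b → 2 ≤ b → b < suc a → ¬ b ∣ N
        tried′ a∤N b 2≤b b≤a with m≤n⇒m<n∨m≡n (s≤s⁻¹ b≤a)
        ... | inj₁ b<a  = tried b 2≤b b<a
        ... | inj₂ refl = a∤N
        entering : ∀ {v w σ′} → Outside 7 9 (σ [ 7 ≔ v ] [ 8 ≔ w ]) σ′ → Outside 7 9 σ σ′
        entering {v} {w} s k o = trans (s k o) (trans (≔-other (σ [ 7 ≔ v ]) {8} {k} w λ where refl → o) (≔-other σ {7} {k} v λ where refl → o))
        scan-powmod : ∀ {σ′} → Outside 7 9 σ σ′ → Scan σ′
        scan-powmod {σ′} s = record
          { σ0 = trans (s 0 _) σ0 ; σ1 = trans (s 1 _) σ1 ; σ2 = trans (s 2 _) σ2 ; h = h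
          ; M≡ = trans (s 3 _) M≡ ; M≤D = subst (_≤ D) (sym (s 3 _)) M≤D
          ; ord-g = subst₂ (λ g k → Ord N (+ g) k) (sym (s 4 _)) (sym (s 3 _)) ord-g
          ; 2≤a = subst (2 ≤_) (sym (s 5 _)) 2≤a
          ; a≤ = subst (_≤ suc (2 * K)) (sym (s 5 _)) a≤
          ; tried = λ b 2≤b b<a → tried b 2≤b (subst (b <_) (s 5 _) b<a)
          ; roots = λ b 0<b b<a → subst (λ k → (+ b) ℤ.^ k ≅ 1ℤ ⟨ N ⟩) (sym (s 3 _)) (roots b 0<b (subst (b <_) (s 5 _) b<a))
          ; zeros = λ t le → trans (s (20 + t) _) (zeros t (subst (λ k → k * N ≤ t) (s 3 _) le)) }
        body : ∀ {t′} c → (∀ {σ′} → ¬ a ∣ N → Outside 7 9 σ σ′ → σ′ 9 < N → + σ′ 9 ≅ (+ a) ℤ.^ M ⟨ N ⟩ →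
                         Tri (cond (var 9 ⊟ con 1) heavy (5 ← var 5 ⊞ con 1)) σ′ c (Budget t′)) →
               Tri scan-body σ (bodyCost c) (Budget t′)
        body c k = tri-⨾ (tri-cond (λ ne → Tri-≤ z≤n (tri-skip (refl , λ a∣N → ne (trans mod≡ (n∣m⇒m%n≡0 N a {{a≢0}} a∣N))))) stop) λ where
          (refl , a∤N) _ → asg (bσ 5) (asg (bσ 3) (tri-⨾ (tri-bounded (tri-power σ1)) λ (r<N , r≅ , s) _ → k a∤N (entering s) r<N r≅))
        go : ∀ j′ → j ≡ j′ → Result t σ
        go zero j≡0 = inj₁ (trans (cong₂ _∸_ limit≡ a≡) (n∸n≡0 (suc (2 * K))) , ≤-trans (m≤n+m 64 _) (≤-reflexive (sym t≡)) , inv , ≤-reflexive (sym a≡))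
          where
          a≡ : a ≡ suc (2 * K)
          a≡ = trans (cong (_+ a) (sym j≡0)) j≡
        go (suc j′) j≡s = inj₂ ((λ z → m>n⇒m∸n≢0 {σ 2 + σ 2 + 1} {a} (<-≤-trans a<limit (≤-reflexive (sym limit≡))) z) , decide (≅? ((+ a) ℤ.^ M) 1ℤ))
          where
          j′≡ : j′ + suc a ≡ suc (2 * K)
          j′≡ = trans (+-suc j′ a) (trans (cong (_+ a) (sym j≡s)) j≡)
          a<limit : a < suc (2 * K)
          a<limit = ≤-trans (m≤n+m (suc a) j′) (≤-reflexive j′≡)
          decide : Dec ((+ a) ℤ.^ M ≅ 1ℤ ⟨ N ⟩) → ∃[ b ] ∃[ t′ ] 64 + b + t′ ≤ t × Tri scan-body σ b (Budget t′)
          decide (yes root-a) = bodyCost (64 + 64) , j′ * lightCost + d * heavyStep + 64 , ≤-reflexive (trans (light-ledger lightCost heavyStep j′ d) (sym (trans t≡ (cong (λ j → j * lightCost + d * heavyStep + 64) {j} {suc j′} j≡s)))) ,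
              body (64 + 64) light
            where
            light : ∀ {σ′} → ¬ a ∣ N → Outside 7 9 σ σ′ → σ′ 9 < N → + σ′ 9 ≅ (+ a) ℤ.^ M ⟨ N ⟩ →
                    Tri (cond (var 9 ⊟ con 1) heavy (5 ← var 5 ⊞ con 1)) σ′ (64 + 64) (Budget (j′ * lightCost + d * heavyStep + 64))
            light {σ′} a∤N s r<N r≅ = tri-cond (λ ne → ⊥-elim (ne (cong (_∸ 1) r≡1)))
                (λ _ → tri-← (≤-trans (≤-reflexive a+1) (Y²≤X (≤-trans a<limit′ 2K<Y²)))
                  (inv′ , j′ , d , trans (cong (λ z → j′ + z) a+1) j′≡ , subst (λ k → D < k * 2 ^ d) (sym (s 3 _)) D< , refl))
              where
              open Scan (scan-powmod s) using () renaming (σ0 to s0; σ1 to s1; σ2 to s2; M≡ to sM≡; M≤D to sM≤D; ord-g to s-ord; zeros to s-zeros)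
              r≡1 : σ′ 9 ≡ 1
              r≡1 = ≅⇒≡ (≅-trans r≅ root-a) r<N 1<N
              a+1 : σ′ 5 + 1 ≡ suc a
              a+1 = trans (+-comm (σ′ 5) 1) (cong suc (s 5 _))
              a<limit′ : suc a ≤ suc (2 * K)
              a<limit′ = a<limit
              2K<Y² : suc (2 * K) ≤ Y * Y
              2K<Y² = ≤-trans (s≤s (*-monoʳ-≤ 2 (≤-trans K≤N N≤Y))) (≤-trans (+-monoˡ-≤ (2 * Y) {1} {Y} z<s) (*-monoˡ-≤ Y {3} {Y} (s≤s (s≤s (s≤s z≤n)))))
              roots′ : ∀ b → 0 < b → b < suc a → (+ b) ℤ.^ M ≅ 1ℤ ⟨ N ⟩
              roots′ b 0<b b≤a with m≤n⇒m<n∨m≡n (s≤s⁻¹ b≤a)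
              ... | inj₁ b<a  = roots b 0<b b<a
              ... | inj₂ refl = root-a
              inv′ : Scan (σ′ [ 5 ≔ σ′ 5 + 1 ])
              inv′ = record
                { σ0 = s0 ; σ1 = s1 ; σ2 = s2 ; h = h ; M≡ = sM≡ ; M≤D = sM≤D ; ord-g = s-ord
                ; 2≤a = ≤-trans (≤-trans 2≤a (n≤1+n a)) (≤-reflexive (sym a+1))
                ; a≤ = ≤-trans (≤-reflexive a+1) a<limit
                ; tried = λ b 2≤b b< → tried′ a∤N b 2≤b (<-≤-trans b< (≤-reflexive a+1))
                ; roots = λ b 0<b b< → subst (λ k → (+ b) ℤ.^ k ≅ 1ℤ ⟨ N ⟩) (sym (s 3 _)) (roots′ b 0<b (<-≤-trans b< (≤-reflexive a+1)))
                ; zeros = s-zeros }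
          decide (no not-root) = spend d refl
            where
            spend : ∀ d₁ → d ≡ d₁ → ∃[ b ] ∃[ t′ ] 64 + b + t′ ≤ t × Tri scan-body σ b (Budget t′)
            -- With d = 0 the budget says D < M, against M ≤ D; so a raise always finds d positive.
            spend zero d≡ = ⊥-elim (<⇒≱ D< (≤-trans (≤-reflexive (trans (cong (λ d → M * 2 ^ d) d≡) (*-identityʳ M))) M≤D))
            spend (suc d′) d≡ = bodyCost (64 + heavyCost) , j * lightCost + d′ * heavyStep + 64 , ≤-reflexive (trans (heavy-ledger lightCost heavyStep j d′) (sym (trans t≡ (cong (λ d → j * lightCost + d * heavyStep + 64) {d} {suc d′} d≡)))) ,
                body (64 + heavyCost) hard
              where
              hard : ∀ {σ′} → ¬ a ∣ N → Outside 7 9 σ σ′ → σ′ 9 < N → + σ′ 9 ≅ (+ a) ℤ.^ M ⟨ N ⟩ →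
                     Tri (cond (var 9 ⊟ con 1) heavy (5 ← var 5 ⊞ con 1)) σ′ (64 + heavyCost) (Budget (j * lightCost + d′ * heavyStep + 64))
              hard {σ′} a∤N s r<N r≅ = tri-cond
                  (λ _ → Tri-conseq done (tri-heavy (scan-powmod s) (subst (λ z → Coprime z N) (sym (s 5 _)) cop) r<N
                    (subst₂ (λ b k → + σ′ 9 ≅ (+ b) ℤ.^ k ⟨ N ⟩) (sym (s 5 _)) (sym (s 3 _)) r≅)
                    (subst₂ (λ b k → ¬ (+ b) ℤ.^ k ≅ 1ℤ ⟨ N ⟩) (sym (s 5 _)) (sym (s 3 _)) not-root)))
                  (λ z → ⊥-elim (small (σ′ 9) refl z))
                where
                cop : Coprime a N
                cop = no-divisor⇒coprime 0<a λ b 2≤b b≤a → tried′ a∤N b 2≤b (s≤s b≤a)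
                small : ∀ r → σ′ 9 ≡ r → ¬ (σ′ 9 ∸ 1 ≡ 0)
                -- The test for 1 uses truncated subtraction and would also accept 0; but a ^ M is a
                -- unit modulo N > 1.
                small zero          e _ = <⇒≢ 1<N (sym (Cop.0-coprimeTo-m⇒m≡1 (subst (λ r → Coprime r N) e
                  (coprime-≅ ((+ a) ℤ.^ M) (+ σ′ 9) (≅-sym r≅) (coprime-^ᶻ {a = + a} M cop)))))
                small (suc zero)    e _ = not-root (≅-trans (≅-sym r≅) (≅-reflexive (cong +_ e)))
                small (suc (suc r)) e z = 0≢1+n (trans (sym z) (cong (_∸ 1) e))
                done : ∀ {σ″} → Raised σ′ σ″ → Budget (j * lightCost + d′ * heavyStep + 64) σ″
                done {σ″} (inv″ , a≡ , M*2≤) = inv″ , j , d′ , trans (cong (λ z → j + z) (trans a≡ (s 5 _))) j≡ ,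
                  <-≤-trans D< (≤-trans (≤-reflexive (trans (cong (λ d → M * 2 ^ d) d≡) (sym (*-assoc M 2 (2 ^ d′)))))
                    (*-monoˡ-≤ (2 ^ d′) (≤-trans (≤-reflexive (cong (_* 2) (sym (s 3 _)))) M*2≤))) , refl

    tri-scan : ∀ {σ} → σ 0 ≡ D → σ 1 ≡ N → σ 2 ≡ K → (∀ t → σ (20 + t) ≡ 0) → Tri scan σ scanCost Scanned
    tri-scan {σ} σ0 σ1 σ2 zero-table = tri-bounded λ bσ → asg (con≤X 2) (asg (≤-trans (m∸n≤m (σ 1) 1) (bσ 1)) (asg (con≤X 2)
      (tri-scan-loop (record
        { σ0 = σ0 ; σ1 = σ1 ; σ2 = σ2 ; h = 1 ; M≡ = refl ; M≤D = 2≤D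
        ; ord-g = subst (λ n → Ord N (+ (n ∸ 1)) 2) (sym σ1) (ord-minus-one 3≤N)
        ; 2≤a = ≤-refl
        ; a≤ = s≤s (≤-trans 0<K (m≤m+n K _))
        ; tried = λ b 2≤b b<2 → ⊥-elim (<⇒≱ b<2 2≤b)
        ; roots = λ b 0<b b<2 → subst (λ b → (+ b) ℤ.^ 2 ≅ 1ℤ ⟨ N ⟩) (≤-antisym 0<b (s≤s⁻¹ b<2)) ≅-refl
        ; zeros = λ t _ → zero-table t } ,
        -- The scan starts with a = 2, so 2 K - 1 advances remain, and with M = 2, where S doublings
        -- suffice to exceed D because D < 2 ^ S.
        2 * K ∸ 1 , S , trans (+-suc (2 * K ∸ 1) 1) (cong suc (m∸n+n≡m (≤-trans 0<K (m≤m+n K _)))) ,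
        D<2*2^S , refl))))
      where
      D<2*2^S : D < 2 * 2 ^ S
      D<2*2^S = <-≤-trans (≤-<-trans (<N⇒≤X D<N) X<2^S) (m≤m+n (2 ^ S) _)

    tri-candidate : ∀ {σ} → σ 1 ≡ N → 0 < σ 11 → Tri candidate σ 128 (λ σ′ → σ′ ≡ σ × ¬ (suc (σ 11) ∣ N × suc (σ 11) < N))
    tri-candidate {σ} refl 0<j = tri-cond
        (λ ne → Tri-≤ z≤n (tri-skip (refl , λ (d∣N , d<N) → ne (cong₂ _+_ (trans mod≡ (n∣m⇒m%n≡0 N (suc j) d∣N))
          (m≤n⇒m∸n≡0 (≤-trans (≤-reflexive (+-comm j 2)) d<N))))))
        (λ z → tri-ret λ e₀ e₁ → good-factor (m%n≡0⇒n∣m N (suc j) (trans (sym mod≡) (m+n≡0⇒m≡0 _ z)) , s≤s 0<j ,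
          ≤-trans (≤-reflexive (+-comm 2 j)) (m∸n≡0⇒m≤n (m+n≡0⇒n≡0 (N ∸ N div₀ (j + 1) * (j + 1)) z))) e₀ (trans e₁ (+-comm j 1)))
      where
      j : ℕ
      j = σ 11
      mod≡ : N ∸ N div₀ (j + 1) * (j + 1) ≡ N % suc j
      mod≡ = trans (cong (λ d → N ∸ N div₀ d * d) (+-comm j 1)) (mod≡% N (suc j))

    NoneUpTo : ℕ → ℕ → Set
    NoneUpTo M n = ∀ i j → 0 < i → i < n → i * j ≡ M → ¬ (suc i ∣ N × suc i < N) × ¬ (suc j ∣ N × suc j < N)

    tri-candidates : ∀ {σ M} → 0 < M → σ 1 ≡ N → σ 2 ≡ K → σ 3 ≡ M → Tri candidates σ candidatesCost (λ _ → NoneUpTo M (suc K))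
    tri-candidates {σ₀} {M} 0<M σ₀1 σ₀2 σ₀3 = asg (con≤X 1) (tri-for Cand ((64 + (64 + (128 + (64 + 128)))) + 64) step
        (+-comm K 1 , z<s , σ₀1 , σ₀2 , σ₀3 , λ i j 0<i i<1 _ → ⊥-elim (<⇒≱ i<1 0<i)))
      where
      Cand : ℕ → Store → Set
      Cand n σ = n + σ 10 ≡ suc K × 0 < σ 10 × σ 1 ≡ N × σ 2 ≡ K × σ 3 ≡ M × NoneUpTo M (σ 10)
      Body : Stmt
      Body = cond (var 3 ⊘% var 10) skip (11 ← var 10 ⨾ candidate ⨾ 11 ← var 3 ⊘ var 10 ⨾ candidate) ⨾ 10 ← var 10 ⊞ con 1
      step : ∀ n σ → Cand n σ → Bounded σ → (σ 2 + 1 ∸ σ 10 ≡ 0 × NoneUpTo M (suc K)) ⊎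
             (σ 2 + 1 ∸ σ 10 ≢ 0 × (∃[ n′ ] n ≡ suc n′ × Tri Body σ ((64 + (64 + (128 + (64 + 128)))) + 64) (Cand n′)))
      step zero σ (left , _ , _ , σ2 , _ , none) bσ = inj₁ (trans (cong₂ _∸_ (trans (+-comm (σ 2) 1) (cong suc σ2)) left) (n∸n≡0 (suc K)) ,
        subst (NoneUpTo M) left none)
      step (suc n) σ (left , 0<i , σ1 , σ2 , σ3 , none) bσ = inj₂ (m>n⇒m∸n≢0 {σ 2 + 1} {i} (≤-trans (s≤s i≤K) (≤-reflexive (trans (cong suc (sym σ2)) (+-comm 1 (σ 2))))) , n , refl ,
          tri-⨾ {R = After} (tri-cond skipped tested) λ { {σ′} (e10 , e1 , e2 , e3 , new) _ →
            tri-← (≤-trans (≤-reflexive (cong (_+ 1) e10)) i+1≤X) (trans (cong (λ z → n + (z + 1)) e10) (trans (cong (λ z → n + z) (+-comm i 1)) (trans (+-suc n i) left)) ,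
              ≤-trans (≤-trans 0<i (≤-reflexive (sym e10))) (m≤m+n (σ′ 10) 1) , e1 , e2 , e3 ,
              λ i′ j 0<i′ i′< eq → extend-none new i′ j 0<i′ (<-≤-trans i′< (≤-reflexive (trans (cong (_+ 1) e10) (+-comm i 1)))) eq) })
        where
        i : ℕ
        i = σ 10
        i≤K : i ≤ K
        i≤K = s≤s⁻¹ (subst (i <_) left (s≤s (m≤n+m i n)))
        i+1≤X : i + 1 ≤ X
        i+1≤X = ≤-trans (≤-reflexive (+-comm i 1)) (Y≤X (s≤s (≤-trans i≤K (≤-trans K≤N (m≤n+m N 99)))))
        New : Set
        New = ∀ j → i * j ≡ M → ¬ (suc i ∣ N × suc i < N) × ¬ (suc j ∣ N × suc j < N)
        After : Store → Set
        After σ′ = σ′ 10 ≡ i × σ′ 1 ≡ N × σ′ 2 ≡ K × σ′ 3 ≡ M × New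
        instance
          i≢0 : NonZero i
          i≢0 = >-nonZero 0<i
        mod≡ : σ 3 ∸ σ 3 div₀ i * i ≡ M % i
        mod≡ = trans (mod≡% (σ 3) i) (cong (_% i) σ3)
        skipped : σ 3 ∸ σ 3 div₀ i * i ≢ 0 → Tri skip σ (64 + (128 + (64 + 128))) After
        skipped ne = Tri-≤ z≤n (tri-skip (refl , σ1 , σ2 , σ3 , λ j eq → ⊥-elim (ne (trans mod≡ (n∣m⇒m%n≡0 M i (divides j (trans (sym eq) (*-comm i j))))))))
        tested : σ 3 ∸ σ 3 div₀ i * i ≡ 0 → Tri (11 ← var 10 ⨾ candidate ⨾ 11 ← var 3 ⊘ var 10 ⨾ candidate) σ (64 + (128 + (64 + 128))) After
        tested z = asg (bσ 10) (tri-⨾ (tri-candidate σ1 0<i) λ where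
            (refl , no-i) _ → asg (≤-trans (≤-reflexive quot≡) (≤-trans (m/n≤m M i) (≤-trans (≤-reflexive (sym σ3)) (bσ 3))))
              (Tri-conseq (λ where (refl , no-j) → refl , σ1 , σ2 , σ3 , λ j eq → no-i , subst (λ j → ¬ (suc j ∣ N × suc j < N)) (j≡ j eq) no-j)
                (tri-candidate σ1 (subst (0 <_) (sym quot≡) (m≥n⇒m/n>0 (∣⇒≤ {{>-nonZero 0<M}} (m%n≡0⇒n∣m M i (trans (sym mod≡) z))))))))
          where
          quot≡ : σ 3 div₀ i ≡ M / i
          quot≡ = trans (cong (_div₀ i) σ3) (div₀≡/ M i)
          j≡ : ∀ j → i * j ≡ M → σ 3 div₀ i ≡ j
          j≡ j eq = trans quot≡ (trans (cong (_/ i) (trans (sym eq) (*-comm i j))) (m*n/n≡m j i))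
        extend-none : New → NoneUpTo M (suc i)
        extend-none new i′ j 0<i′ i′≤i eq with m≤n⇒m<n∨m≡n (s≤s⁻¹ i′≤i)
        ... | inj₁ i′<i = none i′ j 0<i′ i′<i eq
        ... | inj₂ refl = new j eq

    tri-root : ∀ {σ} → σ 0 ≡ D → Tri root σ rootCost (λ σ′ → σ′ 2 ≡ K × Outside 2 2 σ σ′)
    tri-root {σ₀} σ₀0 = Tri-≤ (+-monoʳ-≤ 64 (+-monoˡ-≤ 64 (*-monoˡ-≤ 128 (m∸n≤m K 1)))) (asg (con≤X 1) (tri-for Root 64 step
        (m∸n+n≡m 0<K , z<s , update (λ _ _ → refl))))
      where
      update : ∀ {σ v} → Outside 2 2 σ₀ σ → Outside 2 2 σ₀ (σ [ 2 ≔ v ])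
      update {σ} {v} same k o = trans (≔-other σ {2} {k} v λ where refl → o) (same k o)
      Root : ℕ → Store → Set
      Root n σ = n + σ 2 ≡ K × 0 < σ 2 × Outside 2 2 σ₀ σ
      step : ∀ n σ → Root n σ → Bounded σ → (σ 0 + 1 ∸ σ 2 * σ 2 ≡ 0 × (σ 2 ≡ K × Outside 2 2 σ₀ σ)) ⊎
             (σ 0 + 1 ∸ σ 2 * σ 2 ≢ 0 × (∃[ n′ ] n ≡ suc n′ × Tri (2 ← var 2 ⊞ con 1) σ 64 (Root n′)))
      step zero σ (σ2 , _ , same) bσ = inj₁ (m≤n⇒m∸n≡0 (≤-trans (≤-reflexive (trans (+-comm (σ 0) 1) (cong suc (trans (same 0 _) σ₀0))))
        (subst (λ k → suc D ≤ k * k) (sym σ2) D<K²)) , σ2 , same)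
      step (suc n) σ (left , 0<k , same) bσ = inj₂ (m>n⇒m∸n≢0 {σ 0 + 1} (≤-trans (s≤s (≤-trans (*-mono-≤ k≤ k≤) [K-1]²≤D))
          (≤-reflexive (trans (cong suc (sym (trans (same 0 _) σ₀0))) (+-comm 1 (σ 0))))) , n , refl ,
          tri-← (Y≤X (≤-trans (≤-reflexive (+-comm k 1)) (s≤s (≤-trans k≤ (≤-trans (m∸n≤m K 1) (≤-trans K≤N (m≤n+m N 99)))))))
            (trans (cong (λ z → n + z) (+-comm k 1)) (trans (+-suc n k) left) , ≤-trans 0<k (m≤m+n k 1) , update same))
        where
        k : ℕ
        k = σ 2
        k≤ : k ≤ K ∸ 1
        k≤ = ≤-trans (m≤n+m k n) (≤-reflexive (cong (_∸ 1) left))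

    tri-algorithm : ∀ {σ Q} → σ 0 ≡ D → σ 1 ≡ N → (∀ t → σ (20 + t) ≡ 0) → Tri algorithm σ totalCost Q
    tri-algorithm {σ} {Q} σ₀≡D σ₁≡N zero-table = tri-⨾ (tri-root σ₀≡D) λ (σ₂≡K , same) _ →
        tri-⨾ (tri-scan (trans (same 0 _) σ₀≡D) (trans (same 1 _) σ₁≡N) σ₂≡K λ t → trans (same (20 + t) _) (zero-table t)) λ s _ → search s
      where
      search : ∀ {σ} → Scanned σ → Tri (candidates ⨾ ret 3 (con 0)) σ (candidatesCost + 64) Q
      search {σ} (inv , 2K<a) = tri-⨾ (tri-candidates (positive ord-g) σ1 σ2 refl) λ none _ → tri-ret λ e₀ _ →
          good-prime (no-candidate⇒prime {K = K} {h} 1<N 0<h (<-≤-trans (≤-<-trans (≤-trans (≤-reflexive (sym M≡)) M≤D) D<K²) ≤-refl)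
            (λ b 0<b b≤ → subst (λ k → (+ b) ℤ.^ k ≅ 1ℤ ⟨ N ⟩) M≡ (roots b 0<b (≤-<-trans b≤ 2K<a)))
            (λ i j 0<i i≤K eq → none i j 0<i (s≤s i≤K) (trans eq (sym M≡)))) e₀
        where
        open Scan inv
        0<h : 0 < h
        0<h = n≢0⇒n>0 λ h≡0 → <⇒≢ (positive ord-g) (sym (trans M≡ (cong (2 *_) h≡0)))

    -- The postcondition ⊥ guarantees that control never runs off the end of the program, which
    -- would be a crash. The 2 counts the loader.
    halts-on-input : ∀ {s n} → (∀ {σ} → σ 0 ≡ D → σ 1 ≡ N → (∀ t → σ (20 + t) ≡ 0) → Tri s σ n (λ _ → ⊥)) →
                     At P 0 (loader s) → Halts (input D N) (2 + (n + 0))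
    halts-on-input tri (f₀ , f₁ , at) = step! (load (dir 2)) f₀ refl (sizes₂ (≤V 2≤X) (≤V N≤X))
        (step! (store 3) f₁ refl (sizes₂ {m₁ 0} {3} (≤V N≤X) (≤V 3≤X))
        (continue (tri {λ k → m₂ (phys k)} refl refl (λ t → refl)) at
          (λ k → ≤-trans (m₂≤N (phys k)) N≤X)
          (record { agrees = λ k → refl ; bounded = λ i → ≤V (≤-trans (m₂≤N i) N≤X) })
          (λ ())))
      where
      m₀ m₁ m₂ : Memory
      m₀ = ((λ _ → 0) [ 1 ≔ D ]) [ 2 ≔ N ]
      m₁ = m₀ [ 0 ≔ N ]
      m₂ = m₁ [ 3 ≔ N ]
      N≤X : N ≤ X
      N≤X = Y≤X N≤Y
      2≤X : 2 ≤ X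
      2≤X = con≤X 2
      3≤X : 3 ≤ X
      3≤X = con≤X 3
      ≤V : ∀ {v} → v ≤ X → v ≤ V
      ≤V v≤ = ≤-trans v≤ X≤V
      m₂≤N : ∀ i → m₂ i ≤ N
      m₂≤N = ≔-≤ 3 (≔-≤ 0 (≔-≤ 2 (≔-≤ 1 (λ _ → z≤n) (<⇒≤ D<N)) ≤-refl) ≤-refl) ≤-refl

    machine-correct : At P 0 (loader algorithm) → Σ[ t ∈ ℕ ] Σ[ m ∈ Memory ] Σ[ o ∈ Output ]
             Run P (input D N) t m × decode m ≡ just o × Correct D N o × t ≤ (2 + (totalCost + 0)) * ℓ
    machine-correct at = unpack (halts-on-input {algorithm} {totalCost} tri-algorithm at)
      where
      unpack : ∀ {n} → Halts (input D N) n → Σ[ t ∈ ℕ ] Σ[ m ∈ Memory ] Σ[ o ∈ Output ]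
               Run P (input D N) t m × decode m ≡ just o × Correct D N o × t ≤ n * ℓ
      unpack (halts r (o , d , c) t≤) = _ , _ , o , r , d , c , t≤

-- The total cost in terms of K and the length of N.

module CostAnalysis where

  open import Defs using (Memory; Run; Output; decode; Correct; input; size)

  open import Data.Integer.Base using (+_)

  open import Data.Nat.Base

  open import Data.Nat.Properties
  import Data.Nat.Solver
  module ℕS = Data.Nat.Solver.+-*-Solver

  open Hypothesis using (n<2^size; <2^⇒size≤)

  open Compiler
  open Algorithm

  cube<2^ : ∀ y e → y < 2 ^ e → y * (y * y) < 2 ^ (3 * e)
  cube<2^ y e y< = ≤-trans (*-mono-< y< (*-mono-< y< y<)) (≤-reflexive (trans
    (cong (2 ^ e *_) (cong (2 ^ e *_) (sym (*-identityʳ (2 ^ e))))) (trans (^-*-assoc 2 e 3) (cong (2 ^_) (*-comm e 3)))))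

  -- Reified costs, so that the coefficient in front of the leading monomial can be computed.
  data Cost : Set where
    con            : ℕ → Cost
    Kᶜ K-1ᶜ 2K-1ᶜ Sᶜ   : Cost
    _∔_ _∙_        : Cost → Cost → Cost

  infixl 6 _∔_
  infixl 7 _∙_

  evalCost : ℕ → ℕ → Cost → ℕ
  evalCost K S (con n) = n
  evalCost K S Kᶜ       = K
  evalCost K S K-1ᶜ     = K ∸ 1
  evalCost K S 2K-1ᶜ    = 2 * K ∸ 1
  evalCost K S Sᶜ       = S
  evalCost K S (p ∔ q) = evalCost K S p + evalCost K S q
  evalCost K S (p ∙ q) = evalCost K S p * evalCost K S q

  coefficient degK degS : Cost → ℕ
  coefficient (con n) = n
  coefficient Kᶜ       = 1
  coefficient K-1ᶜ     = 1
  coefficient 2K-1ᶜ    = 2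
  coefficient Sᶜ       = 1
  coefficient (p ∔ q) = coefficient p + coefficient q
  coefficient (p ∙ q) = coefficient p * coefficient q
  degK (con _) = 0
  degK Kᶜ       = 1
  degK K-1ᶜ     = 1
  degK 2K-1ᶜ    = 1
  degK Sᶜ       = 0
  degK (p ∔ q) = degK p ⊔ degK q
  degK (p ∙ q) = degK p + degK q
  degS (con _) = 0
  degS Kᶜ       = 0
  degS K-1ᶜ     = 0
  degS 2K-1ᶜ    = 0
  degS Sᶜ       = 1
  degS (p ∔ q) = degS p ⊔ degS q
  degS (p ∙ q) = degS p + degS q

  module _ {K S : ℕ} (0<K : 0 < K) (0<S : 0 < S) where

    monomial : ℕ → ℕ → ℕ
    monomial a b = K ^ a * S ^ b

    private
      instance
        K≢0 : NonZero K
        K≢0 = >-nonZero 0<K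
        S≢0 : NonZero S
        S≢0 = >-nonZero 0<S

      k¹ : K * 1 * 1 ≡ K
      k¹ = trans (*-identityʳ (K * 1)) (*-identityʳ K)

    monomial-mono : ∀ {a b a′ b′} → a ≤ a′ → b ≤ b′ → monomial a b ≤ monomial a′ b′
    monomial-mono a≤ b≤ = *-mono-≤ (^-monoʳ-≤ K a≤) (^-monoʳ-≤ S b≤)

    monomial-* : ∀ a b a′ b′ → monomial a b * monomial a′ b′ ≡ monomial (a + a′) (b + b′)
    monomial-* a b a′ b′ = trans (lem (K ^ a) (S ^ b) (K ^ a′) (S ^ b′)) (sym (cong₂ _*_ (^-distribˡ-+-* K a a′) (^-distribˡ-+-* S b b′)))
      where
      lem : ∀ a b c d → a * b * (c * d) ≡ a * c * (b * d)
      lem = ℕS.solve 4 (λ a b c d → a ℕS.:* b ℕS.:* (c ℕS.:* d) ℕS.:= a ℕS.:* c ℕS.:* (b ℕS.:* d)) refl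

    -- As K and S are at least 1, every monomial is at most the one with the maximal degrees, so
    -- coefficients can simply be added and multiplied.
    cost≤ : ∀ p → evalCost K S p ≤ coefficient p * monomial (degK p) (degS p)
    cost≤ (con n) = ≤-reflexive (sym (*-identityʳ n))
    cost≤ Kᶜ       = ≤-reflexive (sym (trans (*-identityˡ (K * 1 * 1)) k¹))
    cost≤ K-1ᶜ     = ≤-trans (m∸n≤m K 1) (≤-reflexive (sym (trans (*-identityˡ (K * 1 * 1)) k¹)))
    cost≤ 2K-1ᶜ    = ≤-trans (m∸n≤m (2 * K) 1) (≤-reflexive (sym (cong (2 *_) k¹)))
    cost≤ Sᶜ       = ≤-reflexive (sym (trans (*-identityˡ (1 * (S * 1))) (trans (*-identityˡ (S * 1)) (*-identityʳ S))))
    cost≤ (p ∔ q) = ≤-trans (+-mono-≤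
        (≤-trans (cost≤ p) (*-monoʳ-≤ (coefficient p) (monomial-mono (m≤m⊔n (degK p) (degK q)) (m≤m⊔n (degS p) (degS q)))))
        (≤-trans (cost≤ q) (*-monoʳ-≤ (coefficient q) (monomial-mono (m≤n⊔m (degK p) (degK q)) (m≤n⊔m (degS p) (degS q))))))
      (≤-reflexive (sym (*-distribʳ-+ (monomial (degK (p ∔ q)) (degS (p ∔ q))) (coefficient p) (coefficient q))))
    cost≤ (p ∙ q) = ≤-trans (*-mono-≤ (cost≤ p) (cost≤ q)) (≤-reflexive (trans
      (lem (coefficient p) (monomial (degK p) (degS p)) (coefficient q) (monomial (degK q) (degS q)))
      (cong (coefficient p * coefficient q *_) (monomial-* (degK p) (degS p) (degK q) (degS q)))))
      where
      lem : ∀ a b c d → a * b * (c * d) ≡ a * c * (b * d)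
      lem = ℕS.solve 4 (λ a b c d → a ℕS.:* b ℕS.:* (c ℕS.:* d) ℕS.:= a ℕS.:* c ℕS.:* (b ℕS.:* d)) refl

  -- These evaluate to the sums in `Costs` by computation. The dominant terms come from S raises of
  -- M with searches of length K and powers of length S, whence the monomial K S².
  powerᶜ babyGiantᶜ trialᶜ splitᶜ extendᶜ heavyᶜ lightᶜ heavyStepᶜ scanᶜ candidatesᶜ totalᶜ : Cost
  powerᶜ = con 64 ∔ (Sᶜ ∙ con 320 ∔ con 64)
  babyGiantᶜ = con 64 ∔ (con 64 ∔ ((Kᶜ ∙ con 320 ∔ con 64) ∔ (con 64 ∔ (con 64 ∔ ((Kᶜ ∙ con 192 ∔ con 64) ∔ con 192)))))
  trialᶜ = con 64 ∔ ((K-1ᶜ ∙ con 128 ∔ con 64) ∔ con 128)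
  splitᶜ = con 64 ∔ (con 64 ∔ (Sᶜ ∙ con 192 ∔ con 64))
  extendᶜ = con 64 ∔ (con 64 ∔ (powerᶜ ∔ (con 64 ∔ (splitᶜ ∔ (con 64 ∔ (con 64 ∔ (powerᶜ ∔ (con 64 ∔ (con 64 ∔ (con 64 ∔
    (powerᶜ ∔ con 256)))))))))))
  heavyᶜ = con 64 ∔ (babyGiantᶜ ∔ (trialᶜ ∔ extendᶜ))
  lightᶜ = con 64 ∔ (con 192 ∔ (con 64 ∔ (con 64 ∔ (powerᶜ ∔ con 128))))
  heavyStepᶜ = con 64 ∔ (con 192 ∔ (con 64 ∔ (con 64 ∔ (powerᶜ ∔ (con 64 ∔ heavyᶜ)))))
  scanᶜ = con 64 ∔ (con 64 ∔ (con 64 ∔ (2K-1ᶜ ∙ lightᶜ ∔ Sᶜ ∙ heavyStepᶜ ∔ con 64)))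
  candidatesᶜ = con 64 ∔ (Kᶜ ∙ con 576 ∔ con 64)
  totalᶜ = (con 64 ∔ (Kᶜ ∙ con 128 ∔ con 64)) ∔ (scanᶜ ∔ (candidatesᶜ ∔ con 64))

  -- The 2 counts the loader. With w = size N, `100 + N ≤ 128 * N` gives X < 2 ^ (3 (7 + w)), so S ≤
  -- 24 w. V = X ^ 16 has at most 1 + 16 * 24 w ≤ 385 w digits, and the cost ℓ of an instruction is
  -- three times that, 1155 w.
  constantC constantA : ℕ
  constantC = 2 + coefficient totalᶜ
  constantA = constantC * (24 * 24) * 1155

  module Analysis {D N K X V ℓ S w : ℕ} (2≤D : 2 ≤ D) (D<N : D < N) (0<K : 0 < K) (D<K² : D < K * K) ([K-1]²≤D : (K ∸ 1) * (K ∸ 1) ≤ D)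
                  (X≡ : (100 + N) * ((100 + N) * (100 + N)) ≡ X) (V≡ : X ^ 16 ≡ V) (ℓ≡ : 3 * size V ≡ ℓ) (S≡ : size X ≡ S) (s≡ : size N ≡ w) where
    private
      99<X : 99 < X
      99<X = ≤-trans (≤-trans (m≤m+n 100 N) (m≤m*n (100 + N) ((100 + N) * (100 + N)))) (≤-reflexive X≡)

      total : ℕ
      total = 2 + (Costs.totalCost K S + 0)

      result-run : Σ[ t ∈ ℕ ] Σ[ m ∈ Memory ] Σ[ o ∈ Output ]
                   Run (loader algorithm) (input D N) t m × decode m ≡ just o × Correct D N o × t ≤ total * ℓ
      result-run = Verify.machine-correct 2≤D D<N 0<K D<K² [K-1]²≤D (loader algorithm) {S = S} 99<X (≤-reflexive V≡) (≤-reflexive ℓ≡) (≤-reflexive X≡)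
        (subst (λ z → X < 2 ^ z) S≡ (n<2^size X)) (At-self (loader algorithm))

      0<S : 0 < S
      0<S = subst (0 <_) S≡ z<s

      totalCost≤ : total ≤ constantC * (K * (S * S))
      totalCost≤ = ≤-trans (+-mono-≤ {2} {2 * (K * (S * S))} (m≤m*n 2 (K * (S * S)) {{>-nonZero (*-mono-≤ 0<K (*-mono-≤ 0<S 0<S))}})
          (≤-trans (≤-reflexive (+-identityʳ (Costs.totalCost K S))) (≤-trans (cost≤ 0<K 0<S totalᶜ)
            (≤-reflexive (cong (coefficient totalᶜ *_) (cong₂ _*_ (*-identityʳ K) (cong (S *_) (*-identityʳ S))))))))
        (≤-reflexive (sym (*-distribʳ-+ (K * (S * S)) 2 (coefficient totalᶜ))))

      100+N<2^ : 100 + N < 2 ^ (7 + w)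
      100+N<2^ = ≤-<-trans 100+N≤ (≤-trans (*-monoʳ-< 128 (subst (λ z → N < 2 ^ z) s≡ (n<2^size N))) (≤-reflexive (sym (^-distribˡ-+-* 2 7 w))))
        where
        100+N≤ : 100 + N ≤ 128 * N
        100+N≤ = ≤-trans (+-monoˡ-≤ N (≤-trans (≤-trans (n≤1+n 100) (≤ᵇ⇒≤ 101 127 _)) (m≤m*n 127 N {{>-nonZero (≤-<-trans z≤n D<N)}})))
          (≤-reflexive (+-comm (127 * N) N))

      X<2^ : X < 2 ^ (3 * (7 + w))
      X<2^ = ≤-trans (s≤s (≤-reflexive (sym X≡))) (cube<2^ (100 + N) (7 + w) 100+N<2^)

      0<s : 0 < w
      0<s = subst (0 <_) s≡ z<s

      7+s≤8s : 7 + w ≤ 8 * w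
      7+s≤8s = ≤-trans (+-monoˡ-≤ w (m≤m*n 7 w {{>-nonZero 0<s}})) (≤-reflexive (+-comm (7 * w) w))

      S≤ : S ≤ 24 * w
      S≤ = ≤-trans (≤-reflexive (sym S≡)) (≤-trans (<2^⇒size≤ X (3 * (7 + w)) (≤-trans z<s 99<X) X<2^) (≤-trans (*-monoʳ-≤ 3 7+s≤8s) (≤-reflexive (sym (*-assoc 3 8 w)))))

      ℓ≤ : ℓ ≤ 1155 * w
      ℓ≤ = ≤-trans (≤-reflexive (sym ℓ≡)) (≤-trans (*-monoʳ-≤ 3 sizeV≤) (≤-reflexive (sym (*-assoc 3 385 w))))
        where
        V<2^ : V < 2 ^ (1 + 24 * w * 16)
        V<2^ = ≤-<-trans (≤-reflexive (sym V≡)) (≤-<-trans (^-monoˡ-≤ 16 (≤-trans (<⇒≤ (n<2^size X)) (^-monoʳ-≤ 2 (≤-trans (≤-reflexive S≡) S≤)))) (≤-<-trans (≤-reflexive (^-*-assoc 2 (24 * w) 16))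
          (^-monoʳ-< 2 (s≤s (s≤s z≤n)) (n<1+n (24 * w * 16)))))
        sizeV≤ : size V ≤ 385 * w
        sizeV≤ = ≤-trans (<2^⇒size≤ V _ (subst (0 <_) V≡ (m^n>0 X {{>-nonZero (≤-trans z<s 99<X)}} 16)) V<2^)
          (+-mono-≤ {1} {w} 0<s (≤-reflexive (trans (*-comm (24 * w) 16) (sym (*-assoc 16 24 w)))))

      run-time≤ : ∀ {t} → t ≤ total * ℓ → t ≤ constantA * (K * (w * w * w))
      run-time≤ t≤ = ≤-trans t≤ (≤-trans (*-mono-≤ (≤-trans totalCost≤ (*-monoʳ-≤ constantC (*-monoʳ-≤ K (*-mono-≤ S≤ S≤)))) ℓ≤)
        (≤-reflexive (lem constantC 24 1155 K w)))
        where
        lem : ∀ a b c K w → a * (K * (b * w * (b * w))) * (c * w) ≡ a * (b * b) * c * (K * (w * w * w))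
        lem = ℕS.solve 5 (λ a b c K w → a ℕS.:* (K ℕS.:* (b ℕS.:* w ℕS.:* (b ℕS.:* w))) ℕS.:* (c ℕS.:* w)
          ℕS.:= a ℕS.:* (b ℕS.:* b) ℕS.:* c ℕS.:* (K ℕS.:* (w ℕS.:* w ℕS.:* w))) refl

      -- D ≥ 2 forces K ≥ 2, hence K ≤ 2 (K - 1), and (K - 1)² ≤ D.
      K²≤4D : K * K ≤ 4 * D
      K²≤4D = ≤-trans (*-mono-≤ K≤ K≤) (≤-trans (≤-reflexive (lem (K ∸ 1))) (*-monoʳ-≤ 4 [K-1]²≤D))
        where
        lem : ∀ k → 2 * k * (2 * k) ≡ 4 * (k * k)
        lem = ℕS.solve 1 (λ k → ℕS.con 2 ℕS.:* k ℕS.:* (ℕS.con 2 ℕS.:* k) ℕS.:= ℕS.con 4 ℕS.:* (k ℕS.:* k)) refl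
        double : ∀ K → 2 < K * K → K ≤ 2 * (K ∸ 1)
        double (suc zero) (s≤s ())
        double (suc (suc k)) _ = s≤s (≤-trans (≤-reflexive (+-comm 1 k)) (+-monoʳ-≤ k (s≤s z≤n)))
        K≤ : K ≤ 2 * (K ∸ 1)
        K≤ = double K (≤-<-trans 2≤D D<K²)

    -- The time is squared because √D need not be an integer: t is at most `constantA` times K w³,
    -- and K² ≤ 4 D.
    algorithm-correct : Σ[ t ∈ ℕ ] Σ[ m ∈ Memory ] Σ[ o ∈ Output ] Run (loader algorithm) (input D N) t m × decode m ≡ just o × Correct D N o ×
                        t * t ≤ 4 * (constantA * constantA) * (D * w ^ 6)
    algorithm-correct = let t , m , o , r , d , c , t≤ = result-run in
      t , m , o , r , d , c , ≤-trans (*-mono-≤ (run-time≤ t≤) (run-time≤ t≤)) (≤-trans (≤-reflexive (lem constantA K w))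
        (≤-trans (*-monoʳ-≤ (constantA * constantA) (*-monoˡ-≤ (w ^ 6) K²≤4D)) (≤-reflexive (lem₂ (constantA * constantA) D (w ^ 6)))))
      where
      lem : ∀ c K w → c * (K * (w * w * w)) * (c * (K * (w * w * w))) ≡ c * c * (K * K * w ^ 6)
      lem = ℕS.solve 3 (λ c K w → c ℕS.:* (K ℕS.:* (w ℕS.:* w ℕS.:* w)) ℕS.:* (c ℕS.:* (K ℕS.:* (w ℕS.:* w ℕS.:* w)))
        ℕS.:= c ℕS.:* c ℕS.:* (K ℕS.:* K ℕS.:* w ℕS.:^ 6)) refl
      lem₂ : ∀ c d w → c * (4 * d * w) ≡ 4 * c * (d * w)
      lem₂ = ℕS.solve 3 (λ c d w → c ℕS.:* (ℕS.con 4 ℕS.:* d ℕS.:* w) ℕS.:= ℕS.con 4 ℕS.:* c ℕS.:* (d ℕS.:* w)) refl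

-- The exponent 1/2 + o(1).

module RunningTime where

  open import Defs using (size; _≤_·_^^_; TendsToZero)

  open import Data.Integer.Base as ℤ using (ℤ; +_; -[1+_])
  import Data.Integer.Properties as ℤₚ

  open import Data.Nat.Base
  open import Data.Nat.Logarithm using (⌊log₂_⌋; ⌊log₂⌋-mono-≤; ⌊log₂[2^n]⌋≡n)
  open import Data.Nat.Properties
  import Data.Nat.Solver
  module ℕS = Data.Nat.Solver.+-*-Solver
  open import Data.Rational.Base as ℚ using (ℚ; 0ℚ; ½; ↥_; ↧ₙ_)
  import Data.Rational.Properties as ℚₚ
  import Data.Rational.Unnormalised.Base as ℚᵘ
  import Data.Rational.Unnormalised.Properties as ℚᵘₚ

  open ExponentialBounds using (ℕ^-distribʳ-*; n<2^n)
  open Hypothesis using (n<2^size; 2^⌊log₂⌋≤)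

  ^-cancelˡ-≤ : ∀ b {x y} → 0 < b → x ^ b ≤ y ^ b → x ≤ y
  ^-cancelˡ-≤ b@(suc _) 0<b p = ≮⇒≥ λ y<x → <⇒≱ (^-monoˡ-< b y<x) p

  -- The exponent may be given by any fraction a / b, not necessarily in lowest terms.
  ≤·^^-fraction : ∀ {t C D} e a b → 0 < b → ↥ e ℤ.* + b ≡ + a ℤ.* + ↧ₙ e → t ^ b ≤ C ^ b * D ^ a → t ≤ C · D ^^ e
  ≤·^^-fraction {t} {C} {D} e a b@(suc _) 0<b eq p with ↥ e
  ... | + n = ^-cancelˡ-≤ b 0<b (begin
      (t ^ d) ^ b              ≡⟨ trans (^-*-assoc t d b) (trans (cong (t ^_) (*-comm d b)) (sym (^-*-assoc t b d))) ⟩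
      (t ^ b) ^ d              ≤⟨ ^-monoˡ-≤ d p ⟩
      (C ^ b * D ^ a) ^ d      ≡⟨ ℕ^-distribʳ-* (C ^ b) (D ^ a) d ⟩
      (C ^ b) ^ d * (D ^ a) ^ d ≡⟨ cong₂ _*_ (trans (^-*-assoc C b d) (trans (cong (C ^_) (*-comm b d)) (sym (^-*-assoc C d b))))
                                    (trans (^-*-assoc D a d) (trans (cong (D ^_) (sym nb≡ad)) (sym (^-*-assoc D n b)))) ⟩
      (C ^ d) ^ b * (D ^ n) ^ b ≡⟨ ℕ^-distribʳ-* (C ^ d) (D ^ n) b ⟨
      (C ^ d * D ^ n) ^ b      ∎)
    where
    open ≤-Reasoning
    d : ℕ
    d = ↧ₙ e
    nb≡ad : n * b ≡ a * d
    nb≡ad = ℤₚ.+-injective (trans (ℤₚ.pos-* n b) (trans eq (sym (ℤₚ.pos-* a d))))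
  ... | -[1+ n ] = ⊥-elim (neg≢pos (trans eq (sym (ℤₚ.pos-* a (↧ₙ e)))))
    where
    neg≢pos : ∀ {m} → -[1+ n ] ℤ.* + b ≢ + m
    neg≢pos ()

  -- D ≥ 2 ^ n for n = ⌊log₂ D ⌋, so D ^ ε D exceeds a fixed power of n + 1.
  ε : ℕ → ℚ
  ε D = + (24 * size (size D)) ℚ./ size D

  toℚᵘ-≃⇒≡ : ∀ e {u} → ℚ.toℚᵘ e ℚᵘ.≃ u → ↥ e ℤ.* ℚᵘ.↧ u ≡ ℚᵘ.↥ u ℤ.* + ↧ₙ e
  toℚᵘ-≃⇒≡ e@record{} (ℚᵘ.*≡* eq) = eq

  -- The exponent as the fraction (L + 48 r) / (2 L), the form in which `≤·^^-fraction` takes it.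
  ½+ε : ∀ D → ↥ (½ ℚ.+ ε D) ℤ.* + (2 * size D) ≡ + (size D + 48 * size (size D)) ℤ.* + ↧ₙ (½ ℚ.+ ε D)
  ½+ε D = trans (toℚᵘ-≃⇒≡ (½ ℚ.+ ε D) {u} e≃) (cong (ℤ._* + ↧ₙ (½ ℚ.+ ε D)) top)
    where
    L r : ℕ
    L = size D
    r = size L
    u : ℚᵘ.ℚᵘ
    u = ℚᵘ.½ ℚᵘ.+ ℚᵘ.mkℚᵘ (+ (24 * r)) ⌊log₂ D ⌋
    e≃ : ℚ.toℚᵘ (½ ℚ.+ ε D) ℚᵘ.≃ u
    e≃ = ℚᵘₚ.≃-trans (ℚₚ.toℚᵘ-homo-+ ½ (ε D)) (ℚᵘₚ.+-cong (ℚᵘₚ.≃-refl {ℚᵘ.½}) (ℚₚ.toℚᵘ-fromℚᵘ (ℚᵘ.mkℚᵘ (+ (24 * r)) ⌊log₂ D ⌋)))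
    top : ℚᵘ.↥ u ≡ + (L + 48 * r)
    top = trans (cong (ℤ._+ + (24 * r) ℤ.* + 2) (ℤₚ.*-identityˡ (+ L))) (trans (cong (λ z → + L ℤ.+ z) (sym (ℤₚ.pos-* (24 * r) 2)))
      (trans (sym (ℤₚ.pos-+ L (24 * r * 2))) (cong (λ z → + (L + z)) (trans (*-comm (24 * r) 2) (sym (*-assoc 2 24 r))))))

  -- The numerator of δ is at least 1, so δ ≥ 1 / q. It remains to see that B (r + 1) < 2 ^ r for r
  -- = ⌊log₂ size D⌋, as 2 ^ r ≤ size D.
  ε-tendsToZero : TendsToZero ε
  ε-tendsToZero δ 0<δ = n₀ , λ D n₀≤D → subst (ℚ._< δ) (sym (ℚₚ.0≤p⇒∣p∣≡p (0≤ε D))) (ε<δ D n₀≤D)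
    where
    q B r₀ n₀ : ℕ
    q = ↧ₙ δ
    B = 24 * q
    -- At r = 4 B the inequality holds because B (4 B + 1) < (2 B + 1)² ≤ 2 ^ (4 B), and it persists
    -- for larger r. The double exponential n₀ ensures r ≥ r₀.
    r₀ = 4 * B
    n₀ = 2 ^ 2 ^ r₀
    0≤ε : ∀ D → 0ℚ ℚ.≤ ε D
    0≤ε D = ℚₚ.toℚᵘ-cancel-≤ (ℚᵘₚ.≤-respʳ-≃ (ℚᵘₚ.≃-sym (ℚₚ.toℚᵘ-fromℚᵘ (ℚᵘ.mkℚᵘ (+ (24 * size (size D))) ⌊log₂ D ⌋)))
      (ℚᵘ.*≤* (ℤₚ.≤-trans (ℤₚ.≤-reflexive refl) (ℤₚ.≤-trans (ℤ.+≤+ z≤n) (ℤₚ.≤-reflexive (sym (ℤₚ.*-identityʳ (+ (24 * size (size D))))))))))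
    base : B * suc r₀ < 2 ^ r₀
    base = <-≤-trans (≤-<-trans (≤-trans (≤-reflexive (lem₁ B)) (m≤m+n (4 * (B * B) + B) (3 * B))) (n<1+n _))
      (≤-trans (≤-reflexive (lem₂ B)) (≤-trans (*-mono-≤ (n<2^n (2 * B)) (n<2^n (2 * B))) (≤-reflexive (trans (sym (^-distribˡ-+-* 2 (2 * B) (2 * B)))
        (cong (2 ^_) (lem₃ B))))))
      where
      open Data.Nat.Solver.+-*-Solver
      lem₁ : ∀ B → B * suc (4 * B) ≡ 4 * (B * B) + B
      lem₁ = solve 1 (λ B → B :* (con 1 :+ con 4 :* B) := con 4 :* (B :* B) :+ B) refl
      lem₂ : ∀ B → suc (4 * (B * B) + B + 3 * B) ≡ suc (2 * B) * suc (2 * B)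
      lem₂ = solve 1 (λ B → con 1 :+ (con 4 :* (B :* B) :+ B :+ con 3 :* B) := (con 1 :+ con 2 :* B) :* (con 1 :+ con 2 :* B)) refl
      lem₃ : ∀ B → 2 * B + 2 * B ≡ 4 * B
      lem₃ = solve 1 (λ B → con 2 :* B :+ con 2 :* B := con 4 :* B) refl
    grow : ∀ d → B * suc (d + r₀) < 2 ^ (d + r₀)
    grow zero    = base
    grow (suc d) = ≤-<-trans (≤-reflexive (trans (*-suc B (suc (d + r₀))) (+-comm B _)))
      (<-≤-trans (+-mono-<-≤ (grow d) (≤-trans (m≤m*n B (suc (d + r₀))) (<⇒≤ (grow d)))) (≤-reflexive (cong (λ z → 2 ^ (d + r₀) + z) (sym (+-identityʳ _)))))
    ε-numerator : ∀ D → n₀ ≤ D → 24 * size (size D) * q < size D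
    ε-numerator D n₀≤D = <-≤-trans (≤-<-trans (≤-reflexive (trans (*-assoc 24 (suc r) q) (trans (cong (24 *_) (*-comm (suc r) q)) (sym (*-assoc 24 q (suc r))))))
        (subst (λ r → B * suc r < 2 ^ r) (m∸n+n≡m r₀≤r) (grow (r ∸ r₀)))) (2^⌊log₂⌋≤ (size D) z<s)
      where
      r : ℕ
      r = ⌊log₂ size D ⌋
      r₀≤r : r₀ ≤ r
      r₀≤r = ≤-trans (≤-reflexive (sym (⌊log₂[2^n]⌋≡n r₀))) (⌊log₂⌋-mono-≤ (≤-trans (≤-reflexive (sym (⌊log₂[2^n]⌋≡n (2 ^ r₀))))
        (≤-trans (⌊log₂⌋-mono-≤ n₀≤D) (n≤1+n _))))
    ε<δ : ∀ D → n₀ ≤ D → ε D ℚ.< δ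
    ε<δ D n₀≤D = ℚₚ.toℚᵘ-cancel-< (ℚᵘₚ.<-respˡ-≃ (ℚᵘₚ.≃-sym (ℚₚ.toℚᵘ-fromℚᵘ (ℚᵘ.mkℚᵘ (+ (24 * size (size D))) ⌊log₂ D ⌋))) (below δ refl))
      where
      below : ∀ δ′ → δ′ ≡ δ → ℚᵘ.mkℚᵘ (+ (24 * size (size D))) ⌊log₂ D ⌋ ℚᵘ.< ℚ.toℚᵘ δ′
      below δ′@record{} refl = ℚᵘ.*<* (ℤₚ.<-≤-trans (ℤₚ.≤-<-trans (ℤₚ.≤-reflexive (sym (ℤₚ.pos-* (24 * size (size D)) q))) (ℤ.+<+ (ε-numerator D n₀≤D)))
        (ℤₚ.≤-trans (ℤₚ.≤-reflexive (sym (ℤₚ.*-identityˡ (+ size D)))) (ℤₚ.*-monoʳ-≤-nonNeg (+ size D) (1≤↥ (ℚₚ.drop-*<* 0<δ)))))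
        where
        1≤↥ : + 0 ℤ.* + q ℤ.< ↥ δ ℤ.* + 1 → + 1 ℤ.≤ ↥ δ
        1≤↥ p = ℤₚ.i<j⇒suc[i]≤j (subst₂ ℤ._<_ (ℤₚ.*-zeroˡ (+ q)) (ℤₚ.*-identityʳ (↥ δ)) p)

  -- The sixth power of w is where the exponent 24 = 4 * 6 of L arises; 2 c b³ is the square root of
  -- the constant 4 c² b ^ 6.
  squared-time : ∀ c b {t D w L} → t * t ≤ 4 * (c * c) * (D * w ^ 6) → w ≤ b * L ^ 4 → t ^ 2 ≤ (2 * c * b ^ 3) ^ 2 * (D * L ^ 24)
  squared-time c b {t} {D} {w} {L} t² w≤ = begin
    t ^ 2                                      ≡⟨ cong (t *_) (*-identityʳ t) ⟩
    t * t                                      ≤⟨ t² ⟩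
    4 * (c * c) * (D * w ^ 6)                  ≤⟨ *-monoʳ-≤ (4 * (c * c)) (*-monoʳ-≤ D (^-monoˡ-≤ 6 w≤)) ⟩
    4 * (c * c) * (D * (b * L ^ 4) ^ 6)        ≡⟨ cong (λ z → 4 * (c * c) * (D * z)) (trans (ℕ^-distribʳ-* b (L ^ 4) 6) (cong (b ^ 6 *_) (^-*-assoc L 4 6))) ⟩
    4 * (c * c) * (D * (b ^ 6 * L ^ 24))       ≡⟨ lem c (b ^ 6) D (L ^ 24) ⟩
    4 * (c * c) * b ^ 6 * (D * L ^ 24)         ≡⟨ cong (_* (D * L ^ 24)) (cong₂ _*_ (sq c) (^-*-assoc b 3 2)) ⟨
    (2 * c) ^ 2 * (b ^ 3) ^ 2 * (D * L ^ 24)   ≡⟨ cong (_* (D * L ^ 24)) (ℕ^-distribʳ-* (2 * c) (b ^ 3) 2) ⟨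
    (2 * c * b ^ 3) ^ 2 * (D * L ^ 24)         ∎
    where
    open ≤-Reasoning
    lem : ∀ c x D y → 4 * (c * c) * (D * (x * y)) ≡ 4 * (c * c) * x * (D * y)
    lem = ℕS.solve 4 (λ c x D y → ℕS.con 4 ℕS.:* (c ℕS.:* c) ℕS.:* (D ℕS.:* (x ℕS.:* y)) ℕS.:= ℕS.con 4 ℕS.:* (c ℕS.:* c) ℕS.:* x ℕS.:* (D ℕS.:* y)) refl
    sq : ∀ c → (2 * c) ^ 2 ≡ 4 * (c * c)
    sq = ℕS.solve 1 (λ c → (ℕS.con 2 ℕS.:* c) ℕS.:^ 2 ℕS.:= ℕS.con 4 ℕS.:* (c ℕS.:* c)) refl

  module _ {D w t c b : ℕ} (130≡b : 130 ≡ b) (2≤D : 2 ≤ D) (w≤ : w ≤ 65 + (1 + 2 * (2 * size D * (2 * size D)) * (2 * (2 * size D * (2 * size D)))))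
           (t² : t * t ≤ 4 * (c * c) * (D * w ^ 6)) where
    private
      L r : ℕ
      L = size D
      r = size L

      -- The bound expands to 66 + 64 L ^ 4, and L ≥ 1.
      w≤130L⁴ : w ≤ 130 * L ^ 4
      w≤130L⁴ = ≤-trans w≤ (≤-trans (≤-reflexive (lem L)) (≤-trans (+-monoˡ-≤ (64 * L ^ 4) (m≤m*n 66 (L ^ 4) {{m^n≢0 L 4}}))
        (≤-reflexive (sym (*-distribʳ-+ (L ^ 4) 66 64)))))
        where
        open Data.Nat.Solver.+-*-Solver
        lem : ∀ L → 65 + (1 + 2 * (2 * L * (2 * L)) * (2 * (2 * L * (2 * L)))) ≡ 66 + 64 * L ^ 4
        lem = solve 1 (λ L → con 65 :+ (con 1 :+ con 2 :* (con 2 :* L :* (con 2 :* L)) :* (con 2 :* (con 2 :* L :* (con 2 :* L)))) := con 66 :+ con 64 :* L :^ 4) refl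

      constantB : ℕ
      constantB = 2 * c * b ^ 3

      t²≤ : t ^ 2 ≤ constantB ^ 2 * (D * L ^ 24)
      t²≤ = squared-time c b {t} {D} {w} {L} t² (subst (λ b → w ≤ b * L ^ 4) 130≡b w≤130L⁴)

      2^L≤D² : 2 ^ L ≤ D ^ 2
      2^L≤D² = ≤-trans (*-mono-≤ 2≤D (2^⌊log₂⌋≤ D (<-trans z<s 2≤D))) (≤-reflexive (cong (D *_) (sym (*-identityʳ D))))

      -- A power of the length of D is D ^ o(1): L < 2 ^ r, and 2 ^ L ≤ D² turns the exponent L into
      -- a power of D. Divided by 2 L, the exponent 48 r becomes `ε D`.
      L^≤ : L ^ (24 * L) ≤ D ^ (48 * r)
      L^≤ = begin
        L ^ (24 * L)            ≤⟨ ^-monoˡ-≤ (24 * L) (<⇒≤ (n<2^size L)) ⟩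
        (2 ^ r) ^ (24 * L)      ≡⟨ ^-*-assoc 2 r (24 * L) ⟩
        2 ^ (r * (24 * L))      ≡⟨ cong (2 ^_) (trans (*-comm r (24 * L)) (trans (cong (_* r) (*-comm 24 L)) (*-assoc L 24 r))) ⟩
        2 ^ (L * (24 * r))      ≡⟨ ^-*-assoc 2 L (24 * r) ⟨
        (2 ^ L) ^ (24 * r)      ≤⟨ ^-monoˡ-≤ (24 * r) 2^L≤D² ⟩
        (D ^ 2) ^ (24 * r)      ≡⟨ ^-*-assoc D 2 (24 * r) ⟩
        D ^ (2 * (24 * r))      ≡⟨ cong (D ^_) (sym (*-assoc 2 24 r)) ⟩
        D ^ (48 * r)            ∎
        where open ≤-Reasoning

    -- The bound for t² is raised to the power L, which clears the denominator 2 L of the exponent.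
    -- The constant 130 is kept as a variable b, so that its powers stay symbolic.
    time-bound : t ≤ 2 * c * b ^ 3 · D ^^ (½ ℚ.+ ε D)
    time-bound = ≤·^^-fraction (½ ℚ.+ ε D) (L + 48 * r) (2 * L) (s≤s z≤n) (½+ε D) (begin
        t ^ (2 * L)                                            ≡⟨ ^-*-assoc t 2 L ⟨
        (t ^ 2) ^ L                                            ≤⟨ ^-monoˡ-≤ L t²≤ ⟩
        (constantB ^ 2 * (D * L ^ 24)) ^ L                     ≡⟨ trans (ℕ^-distribʳ-* (constantB ^ 2) (D * L ^ 24) L) (cong₂ _*_ (^-*-assoc constantB 2 L)
                                                                   (trans (ℕ^-distribʳ-* D (L ^ 24) L) (cong (D ^ L *_) (^-*-assoc L 24 L)))) ⟩
        constantB ^ (2 * L) * (D ^ L * L ^ (24 * L))           ≤⟨ *-monoʳ-≤ (constantB ^ (2 * L)) (*-monoʳ-≤ (D ^ L) L^≤) ⟩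
        constantB ^ (2 * L) * (D ^ L * D ^ (48 * r))           ≡⟨ cong (constantB ^ (2 * L) *_) (sym (^-distribˡ-+-* D L (48 * r))) ⟩
        constantB ^ (2 * L) * D ^ (L + 48 * r)                 ∎)
      where open ≤-Reasoning

-- The machine, its constant and its exponent put together.

open import Defs
open import Data.Nat.Base using (ℕ; _≤_; _<_; _*_; _^_)
open import Data.Rational.Base using (ℚ; ½) renaming (_+_ to _+ℚ_)
open Hypothesis using (2≤D; size-bound)
open Arithmetic using (square-root)
open Algorithm using (loader; algorithm)
open CostAnalysis using (constantA; module Analysis)
open RunningTime using (ε; ε-tendsToZero; time-bound)

theorem1p1 : Σ[ P ∈ Program ] Σ[ C ∈ ℕ ] Σ[ ε ∈ (ℕ → ℚ) ] TendsToZero ε ×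
    (∀ D N → 1 ≤ D → D < N → 3 ≤ N →
    exp (√ (real 2 *ᵣ log (real N) *ᵣ log (log (real N)))) <ᵣ fromℕ D →
    Σ[ t ∈ ℕ ] Σ[ m ∈ Memory ] Σ[ o ∈ Output ]
    Run P (input D N) t m × decode m ≡ just o × Correct D N o ×
    t ≤ C · D ^^ (½ +ℚ ε D))
theorem1p1 = loader algorithm , 2 * constantA * 130 ^ 3 , ε , ε-tendsToZero , solves
  where
  solves : ∀ D N → 1 ≤ D → D < N → 3 ≤ N → exp (√ (real 2 *ᵣ log (real N) *ᵣ log (log (real N)))) <ᵣ fromℕ D →
           Σ[ t ∈ ℕ ] Σ[ m ∈ Memory ] Σ[ o ∈ Output ]
           Run (loader algorithm) (input D N) t m × decode m ≡ just o × Correct D N o × t ≤ 2 * constantA * 130 ^ 3 · D ^^ (½ +ℚ ε D)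
  -- The program computes this K itself in `root`; here it is only the parameter in which its cost
  -- is expressed.
  solves D N _ D<N 3≤N hyp = let K , 0<K , D<K² , [K-1]²≤D = square-root D
                                 t , m , o , run , dec , correct , t²≤ = Analysis.algorithm-correct (2≤D {D} {N} 3≤N hyp) D<N 0<K D<K² [K-1]²≤D refl refl refl refl refl
                             in t , m , o , run , dec , correct , time-bound {D} {size N} {t} {constantA} refl (2≤D {D} {N} 3≤N hyp) (size-bound {D} {N} 3≤N hyp) t²≤
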